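{- Let $r=t(x+u-xu)$ and $G(t;x,y,u,z,v)=\sum_{n\ge1}t^n\sum_{s\in\mathcal{A}_n}x^{\mathrm{rep}(s)}y^{\max(s)}u^{\mathrm{asc}(s)}z^{\mathrm{zero}(s)}v^{\mathrm{rmin}(s)}$. Then \begin{align*} G(t;x,y,u,z,v)&=\frac{vytz}{1-vytu}\\ &+\sum_{k\ge0}\frac{yr^2vxz\bigl(tuv+z(r-tuv)-tuv(1-z)(1-yr)(1-r)^k\bigr)(1-yr)(1-r)^k}{\bigl(x-ux+u(1-yr)(1-r)^k\bigr)\bigl(r-tuv+tuv(1-yr)(1-r)^{k+1}\bigr)\bigl(x-u(x-1)(1-yr)(1-r)^k\bigr)}\prod_{i=0}^{k-1}\frac{x-x(1-rz)(1-yr)(1-r)^i}{x-u(x-1)(1-yr)(1-r)^i}\\ &+\sum_{k\ge0}\frac{yr^2u^2vtz(1-v)\bigl(tuv+z(r-tuv)-tuv(1-z)(1-yr)(1-r)^k\bigr)(1-yr)(1-r)^k}{\bigl(x-xu+u(1-yr)(1-r)^k\bigr)\bigl(r-tuv+tuv(1-yr)(1-r)^{k+1}\bigr)\bigl(r-tuv+tuv(1-yr)(1-r)^{k}\bigr)}\\ &\qquad\times\sum_{m\ge k}\frac{rv(1-yr)(1-r)^m}{x-xu+u(1-yr)(1-r)^m}\prod_{i=k}^{m}\frac{x\bigl(1-(1-yr)(1-r)^i\bigr)\bigl(x-xu+u(1-yr)(1-r)^i\bigr)}{\bigl(x-u(x-1)(1-yr)(1-r)^i\bigr)\bigl(x-xu+u(1-rv)(1-yr)(1-r)^i\bigr)}\\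 &\qquad\times\prod_{j=0}^{k-1}\frac{x-x(1-rz)(1-yr)(1-r)^j}{x-u(x-1)(1-yr)(1-r)^j}. \end{align*}
   Context: An inversion sequence of length $n$ is a sequence $s=(s_1,\dots,s_n)$ of integers with $0\le s_i<i$. For such $s$, $\mathrm{asc}(s)=|\{i\in[n-1]:s_i<s_{i+1}\}|$. An ascent sequence is an inversion sequence with $s_i\le \mathrm{asc}(s_1,\dots,s_{i-1})+1$ for $2\le i\le n$; $\mathcal{A}_n$ is the set of ascent sequences of length $n$. Statistics: $\mathrm{rep}(s)=n-|\{s_1,\dots,s_n\}|$; $\mathrm{zero}(s)=|\{i:s_i=0\}|$; $\max(s)=|\{i:s_i=i-1\}|$; $\mathrm{rmin}(s)=|\{s_i:s_i<s_j\text{ for all }j>i\}|$. The identity is one of formal power series in $t$. -}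

module Defs where

open import Data.Nat using (ℕ; zero; suc; _∸_; _≤_; _≤ᵇ_; _<ᵇ_; _≡ᵇ_)
import Data.Nat as ℕ
open import Data.Bool using (Bool; true; false; if_then_else_)
open import Data.List using (List; []; _∷_; _++_; [_]; map; concatMap; upTo; length; filterᵇ; take; drop; deduplicate; foldr)
open import Data.Product using (∃)
open import Algebra.Bundles using (CommutativeRing)

-- Sequences are lists of naturals s = (s_1,…,s_n); position p (0-indexed)
-- holds s_{p+1}.

-- s_{p+1}, with default 0 outside the range (never used out of range)
nth : List ℕ → ℕ → ℕ
nth []       _       = 0
nth (a ∷ _)  zero    = a
nth (_ ∷ s)  (suc p) = nth s p

positions : List ℕ → List ℕ
positions s = upTo (length s)

allB : (ℕ → Bool) → List ℕ → Bool
allB p []      = true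
allB p (a ∷ l) = if p a then allB p l else false

count : (ℕ → Bool) → List ℕ → ℕ
count p l = length (filterᵇ p l)

asc : List ℕ → ℕ
asc []            = 0
asc (a ∷ [])      = 0
asc (a ∷ b ∷ s)   = (if a <ᵇ b then 1 else 0) ℕ.+ asc (b ∷ s)

invSeqs : ℕ → List (List ℕ)
invSeqs zero    = [ [] ]
invSeqs (suc n) = concatMap (λ s → map (λ a → s ++ [ a ]) (upTo (suc n))) (invSeqs n)

isAscent : List ℕ → Bool
isAscent s = allB (λ p → if p ≡ᵇ 0 then true else (nth s p ≤ᵇ asc (take p s) ℕ.+ 1)) (positions s)

ascentSeqs : ℕ → List (List ℕ)
ascentSeqs n = filterᵇ isAscent (invSeqs n)

rep : List ℕ → ℕ
rep s = length s ∸ length (deduplicate ℕ._≟_ s)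

zeroStat : List ℕ → ℕ
zeroStat s = count (λ a → a ≡ᵇ 0) s

maxStat : List ℕ → ℕ
maxStat s = count (λ p → nth s p ≡ᵇ p) (positions s)

rmin : List ℕ → ℕ
rmin s = length (deduplicate ℕ._≟_
           (map (nth s)
             (filterᵇ (λ p → allB (λ q → if p <ᵇ q then nth s p <ᵇ nth s q else true) (positions s))
                      (positions s))))

module Series {c ℓ} (R : CommutativeRing c ℓ) where
  open CommutativeRing R

  PS : Set c
  PS = ℕ → Carrier

  _^ᶜ_ : Carrier → ℕ → Carrier
  a ^ᶜ zero  = 1#
  a ^ᶜ suc n = (a ^ᶜ n) * a

  sumR : ℕ → (ℕ → Carrier) → Carrier
  sumR zero    f = 0#
  sumR (suc n) f = sumR n f + f n

  sumList : List Carrier → Carrier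
  sumList = foldr _+_ 0#

  ĉ : Carrier → PS
  ĉ a zero    = a
  ĉ a (suc _) = 0#

  tt : PS
  tt (suc zero) = 1#
  tt _          = 0#

  infixl 6 _⊕_ _⊖_
  infixl 7 _⊗_
  infixr 8 _^ₛ_

  _⊕_ : PS → PS → PS
  (f ⊕ g) n = f n + g n

  _⊖_ : PS → PS → PS
  (f ⊖ g) n = f n + (- g n)

  _⊗_ : PS → PS → PS
  (f ⊗ g) n = sumR (suc n) (λ i → f i * g (n ∸ i))

  _^ₛ_ : PS → ℕ → PS
  f ^ₛ zero  = ĉ 1#
  f ^ₛ suc k = (f ^ₛ k) ⊗ f

  sumFrom : ℕ → ℕ → (ℕ → PS) → PS
  sumFrom a zero      f = ĉ 0#
  sumFrom a (suc len) f = f a ⊕ sumFrom (suc a) len f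

  prodFrom : ℕ → ℕ → (ℕ → PS) → PS
  prodFrom a zero      f = ĉ 1#
  prodFrom a (suc len) f = f a ⊗ prodFrom (suc a) len f

  shift : ℕ → PS → PS
  shift a f n = f (a ℕ.+ n)

  -- Inverse of a series D whose constant term D 0 has inverse w:
  -- b_0 = w,  b_n = - w · Σ_{i=1}^{n} D_i b_{n-i}.
  -- invList w D n = [b_0, …, b_{n-1}]
  private
    lookupC : List Carrier → ℕ → Carrier
    lookupC []      _       = 0#
    lookupC (a ∷ _) zero    = a
    lookupC (_ ∷ l) (suc p) = lookupC l p

  invList : Carrier → PS → ℕ → List Carrier
  invList w D zero    = []
  invList w D (suc n) =
    let p = invList w D n in
    p ++ [ (if n ≡ᵇ 0 then w
            else - (w * sumR n (λ j → D (n ∸ j) * lookupC p j))) ]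

  inv : Carrier → PS → PS
  inv w D n = lookupC (invList w D (suc n)) n

  -- The quotient N / D in the field of fractions, where D = t^a · D'
  -- with D' 0 invertible (inverse w) and t^a dividing N:
  -- N / D = (N / t^a) · (D / t^a)⁻¹.
  divBy : ℕ → Carrier → PS → PS → PS
  divBy a w N D = shift a N ⊗ inv w (shift a D)

  Tends : (ℕ → PS) → PS → Set ℓ
  Tends seq S = ∀ n → ∃ λ K → ∀ K′ → K ≤ K′ → seq K′ n ≈ S n

  monomial : Carrier → Carrier → Carrier → Carrier → Carrier → List ℕ → Carrier
  monomial x y u z v s =
    (x ^ᶜ rep s) * (y ^ᶜ maxStat s) * (u ^ᶜ asc s) * (z ^ᶜ zeroStat s) * (v ^ᶜ rmin s)

  G : Carrier → Carrier → Carrier → Carrier → Carrier → PS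
  G x y u z v zero    = 0#
  G x y u z v (suc n) = sumList (map (monomial x y u z v) (ascentSeqs (suc n)))

  -- Right-hand side.  w is the inverse of x + u - xu (the constant term,
  -- after removing powers of t, of every denominator).

  module RHS (x y u z v w : Carrier) where
    r : PS
    r = tt ⊗ (ĉ x ⊕ ĉ u ⊖ ĉ (x * u))

    tuv : PS
    tuv = tt ⊗ ĉ (u * v)

    P : ℕ → PS
    P k = (ĉ 1# ⊖ ĉ y ⊗ r) ⊗ (ĉ 1# ⊖ r) ^ₛ k

    B : ℕ → PS
    B k = tuv ⊕ ĉ z ⊗ (r ⊖ tuv) ⊖ tuv ⊗ (ĉ 1# ⊖ ĉ z) ⊗ P k

    E : ℕ → PS
    E k = ĉ x ⊖ ĉ (x * u) ⊕ ĉ u ⊗ P k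

    F : ℕ → PS
    F k = r ⊖ tuv ⊕ tuv ⊗ P k

    H : ℕ → PS
    H k = ĉ x ⊖ ĉ (u * (x + - 1#)) ⊗ P k

    factor1 : ℕ → PS
    factor1 i = divBy 0 w (ĉ x ⊖ ĉ x ⊗ (ĉ 1# ⊖ r ⊗ ĉ z) ⊗ P i) (H i)

    factor2 : ℕ → PS
    factor2 i = divBy 0 (w * w)
                  (ĉ x ⊗ (ĉ 1# ⊖ P i) ⊗ E i)
                  (H i ⊗ (ĉ x ⊖ ĉ (x * u) ⊕ ĉ u ⊗ (ĉ 1# ⊖ r ⊗ ĉ v) ⊗ P i))

    inner : ℕ → PS
    inner m = divBy 0 w (r ⊗ ĉ v ⊗ P m) (E m)

    term0 : PS
    term0 = divBy 0 1# (ĉ v ⊗ ĉ y ⊗ tt ⊗ ĉ z) (ĉ 1# ⊖ ĉ v ⊗ ĉ y ⊗ tt ⊗ ĉ u)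

    term1 : ℕ → PS
    term1 k = divBy 1 (w * w * w)
                (ĉ y ⊗ r ^ₛ 2 ⊗ ĉ v ⊗ ĉ x ⊗ ĉ z ⊗ B k ⊗ P k)
                (E k ⊗ F (suc k) ⊗ H k)
              ⊗ prodFrom 0 k factor1

    term2 : ℕ → ℕ → PS
    term2 k m = divBy 2 (w * w * w)
                  (ĉ y ⊗ r ^ₛ 2 ⊗ ĉ u ^ₛ 2 ⊗ ĉ v ⊗ tt ⊗ ĉ z ⊗ (ĉ 1# ⊖ ĉ v) ⊗ B k ⊗ P k)
                  (E k ⊗ F (suc k) ⊗ F k)
                ⊗ (inner m ⊗ prodFrom k (suc m ∸ k) factor2)
                ⊗ prodFrom 0 k factor1

    partial : ℕ → PS
    partial K = term0
              ⊕ sumFrom 0 K term1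
              ⊕ sumFrom 0 K (λ k → sumFrom k (K ∸ k) (λ m → term2 k m))

{-# OPTIONS --safe #-}
module Submission where

-- Read an ascent sequence letter by letter.  After a prefix, the weight of all continuations depends only on the word
-- that records, for every value up to asc + 1, whether it already occurs in the prefix and whether it currently is a
-- right-to-left minimum, together with the position of the last letter.  Three linear relations reduce all such words
-- to words of used values.  (1) Deletion: a used value is x times an unused one plus 1 - x times no value at all.
-- (2) Promotion: turning a current minimum into an ordinary used value changes the weight by v - 1 times the process
-- that never goes below it, that is, the process with z = 0.  (3) Gap: moving the last letter across a value.
-- Summing over the length of the initial run 0 1 2 …, whose entries are marked by y, and eliminating, one obtains a
-- functional equation that relates the series at y and at y + 1 - r y.  As 1 - r (y + 1 - r y) = (1 - r y) (1 - r),
-- iteration replaces 1 - y r by (1 - y r) (1 - r)^k.  The process with z = 0 satisfies an equation of the same kind,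
-- which yields the inner sum; the general process yields the outer one.  Each step gains a factor t, so the remainders
-- tend to 0.

-- The constants come from one computation. In the gap relation for words of used values the
-- coefficient of `X (suc i) l` is 1 - t x - t u (1 - x), and this is 1 - r. Summing over i with
-- ratio t u Y leaves t u (Y - 1) in front of the sum for l + 1. For Y = y + 1 - r y one has Y - 1 =
-- (1 - r) y, so that the recursion in l becomes geometric with ratio t u y; this is the origin of
-- the substitution. Words of used values only are formal: in a word that comes from a prefix the
-- topmost value asc + 1 is always new. They are studied because they form a family with two indices
-- in which the relations close up, and deletion leads back to genuine words. The obstacle is v,
-- since a visited value becomes a minimum and the word leaves the family. Promotion brings it back
-- at the cost of a correction that does not depend on i, so it passes through the summation over i
-- as a constant. The inhomogeneous part of the functional equation is moreover free of z.
-- Subtracting its instance at z = 0 removes this part, and a recursion that telescopes remains.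

open import Defs
open import Algebra.Bundles using (CommutativeRing; RawRing)
open import Data.Bool.Base using (Bool; true; false; if_then_else_; _∧_)
import Data.Bool.Properties as Boolₚ
open import Data.List.Base using (List; []; _∷_; _++_; _∷ʳ_; [_]; length; map; concatMap; filterᵇ; upTo; replicate)
import Data.List.Properties as Listₚ
open import Data.List.Relation.Unary.All as All using (All; []; _∷_)
import Data.List.Relation.Unary.All.Properties as Allₚ
open import Data.Maybe.Base using (Maybe; just; nothing)
open import Data.Nat.Base as ℕ using (ℕ; zero; suc; _∸_; _≤_; _<_; _<ᵇ_; _≤ᵇ_; _≡ᵇ_; z≤n; s≤s)
import Data.Nat.Properties as ℕₚ
open import Data.Product.Base as Product using (∃; ∃₂; _,_)
open import Data.Sum.Base using (inj₁; inj₂)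
open import Function.Base using (_∘_)
open import Relation.Binary.PropositionalEquality as ≡ using (_≡_)
open import Relation.Nullary using (yes; no)

-- Ring identities with integer coefficients in an arbitrary commutative ring.

module IntegerSolver {c ℓ} (A : CommutativeRing c ℓ) where
  open CommutativeRing A
  open import Data.Integer.Base as ℤ using (ℤ; +_; -[1+_])
  import Data.Integer.Properties as ℤₚ
  open import Algebra.Properties.Ring ring
    using (-‿distribˡ-*; -‿distribʳ-*; -‿involutive; -0#≈0#)
  open import Algebra.Properties.AbelianGroup +-abelianGroup using (⁻¹-∙-comm)
  open import Algebra.Properties.Semiring.Mult.TCOptimised semiring
    using (_×_; 1+×; ×-homo-+; ×1-homo-*)
  open import Algebra.Solver.Ring.AlmostCommutativeRing
  open import Relation.Binary.Reasoning.Setoid setoid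

  -- The optimised multiple has `1 × 1#` equal to `1#` by computation, so the solver's constants 0
  -- and 1 denote `0#` and `1#` on the nose.
  ⟦_⟧ᶻ : ℤ → Carrier
  ⟦ + n ⟧ᶻ      = n × 1#
  ⟦ -[1+ n ] ⟧ᶻ = - (suc n × 1#)

  private
    neg-homo : ∀ i → ⟦ ℤ.- i ⟧ᶻ ≈ - ⟦ i ⟧ᶻ
    neg-homo (+ zero)  = sym -0#≈0#
    neg-homo (+ suc n) = refl
    neg-homo -[1+ n ]  = sym (-‿involutive _)

    ⊖-homo : ∀ m n → ⟦ m ℤ.⊖ n ⟧ᶻ ≈ m × 1# + - (n × 1#)
    ⊖-homo m zero = begin
      m × 1#         ≈⟨ +-identityʳ _ ⟨
      m × 1# + 0#    ≈⟨ +-congˡ -0#≈0# ⟨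
      m × 1# + - 0#  ∎
    ⊖-homo zero (suc n) = sym (+-identityˡ _)
    ⊖-homo (suc m) (suc n) = begin
      ⟦ suc m ℤ.⊖ suc n ⟧ᶻ        ≡⟨ ≡.cong ⟦_⟧ᶻ (ℤₚ.[1+m]⊖[1+n]≡m⊖n m n) ⟩
      ⟦ m ℤ.⊖ n ⟧ᶻ                ≈⟨ ⊖-homo m n ⟩
      a + - b                     ≈⟨ +-identityˡ _ ⟨
      0# + (a + - b)              ≈⟨ +-congʳ (-‿inverseʳ 1#) ⟨
      (1# + - 1#) + (a + - b)     ≈⟨ +-assoc _ _ _ ⟩
      1# + (- 1# + (a + - b))     ≈⟨ +-congˡ (+-assoc _ _ _) ⟨
      1# + ((- 1# + a) + - b)     ≈⟨ +-congˡ (+-congʳ (+-comm _ _)) ⟩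
      1# + ((a + - 1#) + - b)     ≈⟨ +-congˡ (+-assoc _ _ _) ⟩
      1# + (a + (- 1# + - b))     ≈⟨ +-assoc _ _ _ ⟨
      (1# + a) + (- 1# + - b)     ≈⟨ +-congˡ (⁻¹-∙-comm _ _) ⟩
      (1# + a) + - (1# + b)       ≈⟨ +-cong (1+× m 1#) (-‿cong (1+× n 1#)) ⟨
      suc m × 1# + - (suc n × 1#) ∎
      where a = m × 1#
            b = n × 1#

    +-homo : ∀ i j → ⟦ i ℤ.+ j ⟧ᶻ ≈ ⟦ i ⟧ᶻ + ⟦ j ⟧ᶻ
    +-homo (+ m)    (+ n)    = ×-homo-+ 1# m n
    +-homo (+ m)    -[1+ n ] = ⊖-homo m (suc n)
    +-homo -[1+ m ] (+ n)    = trans (⊖-homo n (suc m)) (+-comm _ _)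
    +-homo -[1+ m ] -[1+ n ] = begin
      - (suc (suc (m ℕ.+ n)) × 1#)       ≡⟨ ≡.cong (λ k → - (suc k × 1#)) (ℕₚ.+-suc m n) ⟨
      - ((suc m ℕ.+ suc n) × 1#)         ≈⟨ -‿cong (×-homo-+ 1# (suc m) (suc n)) ⟩
      - (suc m × 1# + suc n × 1#)        ≈⟨ ⁻¹-∙-comm _ _ ⟨
      - (suc m × 1#) + - (suc n × 1#)    ∎

    *-homo : ∀ i j → ⟦ i ℤ.* j ⟧ᶻ ≈ ⟦ i ⟧ᶻ * ⟦ j ⟧ᶻ
    *-homo (+ m) (+ n) = begin
      ⟦ + m ℤ.* + n ⟧ᶻ      ≡⟨ ≡.cong ⟦_⟧ᶻ (ℤₚ.pos-* m n) ⟨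
      (m ℕ.* n) × 1#        ≈⟨ ×1-homo-* m n ⟩
      (m × 1#) * (n × 1#)   ∎
    *-homo (+ m) -[1+ n ] = begin
      ⟦ + m ℤ.* -[1+ n ] ⟧ᶻ       ≡⟨ ≡.cong ⟦_⟧ᶻ (ℤₚ.neg-distribʳ-* (+ m) (+ suc n)) ⟨
      ⟦ ℤ.- (+ m ℤ.* + suc n) ⟧ᶻ  ≈⟨ neg-homo (+ m ℤ.* + suc n) ⟩
      - ⟦ + m ℤ.* + suc n ⟧ᶻ      ≈⟨ -‿cong (*-homo (+ m) (+ suc n)) ⟩
      - ((m × 1#) * (suc n × 1#)) ≈⟨ -‿distribʳ-* _ _ ⟩
      (m × 1#) * - (suc n × 1#)   ∎
    *-homo -[1+ m ] (+ n) = begin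
      ⟦ -[1+ m ] ℤ.* + n ⟧ᶻ       ≡⟨ ≡.cong ⟦_⟧ᶻ (ℤₚ.neg-distribˡ-* (+ suc m) (+ n)) ⟨
      ⟦ ℤ.- (+ suc m ℤ.* + n) ⟧ᶻ  ≈⟨ neg-homo (+ suc m ℤ.* + n) ⟩
      - ⟦ + suc m ℤ.* + n ⟧ᶻ      ≈⟨ -‿cong (*-homo (+ suc m) (+ n)) ⟩
      - ((suc m × 1#) * (n × 1#)) ≈⟨ -‿distribˡ-* _ _ ⟩
      - (suc m × 1#) * (n × 1#)   ∎
    *-homo -[1+ m ] -[1+ n ] = begin
      (suc m ℕ.* suc n) × 1#            ≈⟨ ×1-homo-* (suc m) (suc n) ⟩
      (suc m × 1#) * (suc n × 1#)       ≈⟨ -‿involutive _ ⟨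
      - - ((suc m × 1#) * (suc n × 1#)) ≈⟨ -‿cong (-‿distribʳ-* _ _) ⟩
      - ((suc m × 1#) * - (suc n × 1#)) ≈⟨ -‿distribˡ-* _ _ ⟩
      - (suc m × 1#) * - (suc n × 1#)   ∎

    ℤ-rawRing : RawRing _ _
    ℤ-rawRing = record
      { Carrier = ℤ ; _≈_ = _≡_ ; _+_ = ℤ._+_ ; _*_ = ℤ._*_ ; -_ = ℤ.-_ ; 0# = ℤ.0ℤ ; 1# = ℤ.1ℤ }

    homomorphism : ℤ-rawRing -Raw-AlmostCommutative⟶ fromCommutativeRing A
    homomorphism = record
      { ⟦_⟧ = ⟦_⟧ᶻ ; +-homo = +-homo ; *-homo = *-homo ; -‿homo = neg-homo
      ; 0-homo = refl ; 1-homo = refl }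

    dec : ∀ i j → Maybe (⟦ i ⟧ᶻ ≈ ⟦ j ⟧ᶻ)
    dec i j with i ℤₚ.≟ j
    ... | yes i≡j = just (reflexive (≡.cong ⟦_⟧ᶻ i≡j))
    ... | no _    = nothing

  open import Algebra.Solver.Ring ℤ-rawRing (fromCommutativeRing A) homomorphism dec public
    using (Polynomial; con; solve; _:=_; _:+_; _:*_; _:-_; :-_)

-- Formal power series: ring laws and first-order recursions.

module PowerSeries {c ℓ} (R : CommutativeRing c ℓ) where
  open CommutativeRing R
  open Series R
  open import Algebra.Properties.Ring ring using (-‿distribˡ-*; -0#≈0#)
  open import Algebra.Properties.AbelianGroup +-abelianGroup using (⁻¹-∙-comm)
  open import Algebra.Properties.CommutativeSemigroup +-commutativeSemigroup using (interchange)
  open import Relation.Binary.Reasoning.Setoid setoid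

  infix 4 _≋_
  -- A record, since the two series can then be recovered from a goal by unification; from a family
  -- `f n ≈ g n` they could not.
  record _≋_ (f g : PS) : Set ℓ where
    constructor pointwise
    field at : ∀ n → f n ≈ g n
  open _≋_ public

  sumR-cong : ∀ n {f g} → (∀ i → i < n → f i ≈ g i) → sumR n f ≈ sumR n g
  sumR-cong zero    e = refl
  sumR-cong (suc n) e =
    +-cong (sumR-cong n (λ i i<n → e i (ℕₚ.m<n⇒m<1+n i<n))) (e n (ℕₚ.n<1+n n))

  sumR-+ : ∀ n f g → sumR n (λ i → f i + g i) ≈ sumR n f + sumR n g
  sumR-+ zero    f g = sym (+-identityˡ 0#)
  sumR-+ (suc n) f g = trans (+-congʳ (sumR-+ n f g)) (interchange _ _ _ _)

  sumR-*ˡ : ∀ n a f → sumR n (λ i → a * f i) ≈ a * sumR n f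
  sumR-*ˡ zero    a f = sym (zeroʳ a)
  sumR-*ˡ (suc n) a f = trans (+-congʳ (sumR-*ˡ n a f)) (sym (distribˡ a _ _))

  sumR-0 : ∀ n → sumR n (λ _ → 0#) ≈ 0#
  sumR-0 zero    = refl
  sumR-0 (suc n) = trans (+-identityʳ _) (sumR-0 n)

  sumR-head : ∀ n f → sumR (suc n) f ≈ f 0 + sumR n (λ i → f (suc i))
  sumR-head zero    f = +-comm _ _
  sumR-head (suc n) f = trans (+-congʳ (sumR-head n f)) (+-assoc _ _ _)

  tail : PS → PS
  tail f n = f (suc n)

  ⊗-zero : ∀ f g → (f ⊗ g) 0 ≈ f 0 * g 0
  ⊗-zero f g = +-identityˡ _

  ⊗-suc : ∀ f g n → (f ⊗ g) (suc n) ≈ f 0 * g (suc n) + (tail f ⊗ g) n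
  ⊗-suc f g n = sumR-head (suc n) _

  -- The mirror image of `⊗-suc`, peeling off the last summand; the two together make `⊗-comm` an
  -- induction on the coefficient index.
  ⊗-suc′ : ∀ f g n → (f ⊗ g) (suc n) ≈ (f ⊗ tail g) n + f (suc n) * g 0
  ⊗-suc′ f g n = +-cong
    (sumR-cong (suc n) λ i i≤n → reflexive (≡.cong (λ k → f i * g k) (ℕₚ.+-∸-assoc 1 (ℕₚ.≤-pred i≤n))))
    (reflexive (≡.cong (λ k → f (suc n) * g k) (ℕₚ.n∸n≡0 n)))

  ⊗-cong : ∀ {f f′ g g′} → f ≋ f′ → g ≋ g′ → (f ⊗ g) ≋ (f′ ⊗ g′)
  ⊗-cong e e′ .at n = sumR-cong (suc n) λ i _ → *-cong (at e i) (at e′ (n ∸ i))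

  ⊗-comm : ∀ f g → (f ⊗ g) ≋ (g ⊗ f)
  ⊗-comm f g .at n = go f g n
    where
    go : ∀ f g n → (f ⊗ g) n ≈ (g ⊗ f) n
    go f g zero    = trans (⊗-zero f g) (trans (*-comm _ _) (sym (⊗-zero g f)))
    go f g (suc n) = begin
      (f ⊗ g) (suc n)                     ≈⟨ ⊗-suc f g n ⟩
      f 0 * g (suc n) + (tail f ⊗ g) n    ≈⟨ +-cong (*-comm _ _) (go (tail f) g n) ⟩
      g (suc n) * f 0 + (g ⊗ tail f) n    ≈⟨ +-comm _ _ ⟩
      (g ⊗ tail f) n + g (suc n) * f 0    ≈⟨ ⊗-suc′ g f n ⟨
      (g ⊗ f) (suc n)                     ∎

  ⊗-distribʳ : ∀ h f g → ((f ⊕ g) ⊗ h) ≋ ((f ⊗ h) ⊕ (g ⊗ h))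
  ⊗-distribʳ h f g .at n = trans
    (sumR-cong (suc n) λ i _ → distribʳ (h (n ∸ i)) (f i) (g i))
    (sumR-+ (suc n) _ _)

  ⊗-scaleˡ : ∀ a f g n → ((λ i → a * f i) ⊗ g) n ≈ a * (f ⊗ g) n
  ⊗-scaleˡ a f g n = trans
    (sumR-cong (suc n) λ i _ → *-assoc a (f i) (g (n ∸ i)))
    (sumR-*ˡ (suc n) a _)

  ⊗-assoc : ∀ f g h → ((f ⊗ g) ⊗ h) ≋ (f ⊗ (g ⊗ h))
  ⊗-assoc f g h .at n = go f n
    where
    go : ∀ f n → ((f ⊗ g) ⊗ h) n ≈ (f ⊗ (g ⊗ h)) n
    go f zero = begin
      ((f ⊗ g) ⊗ h) 0        ≈⟨ ⊗-zero (f ⊗ g) h ⟩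
      (f ⊗ g) 0 * h 0        ≈⟨ *-congʳ (⊗-zero f g) ⟩
      (f 0 * g 0) * h 0      ≈⟨ *-assoc _ _ _ ⟩
      f 0 * (g 0 * h 0)      ≈⟨ *-congˡ (⊗-zero g h) ⟨
      f 0 * (g ⊗ h) 0        ≈⟨ ⊗-zero f (g ⊗ h) ⟨
      (f ⊗ (g ⊗ h)) 0        ∎
    go f (suc n) = begin
      ((f ⊗ g) ⊗ h) (suc n)
        ≈⟨ ⊗-suc (f ⊗ g) h n ⟩
      (f ⊗ g) 0 * h (suc n) + (tail (f ⊗ g) ⊗ h) n
        ≈⟨ +-cong (*-congʳ (⊗-zero f g)) (at (⊗-cong {g = h} (pointwise (⊗-suc f g)) (pointwise λ _ → refl)) n) ⟩
      (f 0 * g 0) * h (suc n) + (((λ i → f 0 * tail g i) ⊕ (tail f ⊗ g)) ⊗ h) n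
        ≈⟨ +-cong (*-assoc _ _ _) (at (⊗-distribʳ h _ _) n) ⟩
      f 0 * (g 0 * h (suc n)) + (((λ i → f 0 * tail g i) ⊗ h) n + ((tail f ⊗ g) ⊗ h) n)
        ≈⟨ +-assoc _ _ _ ⟨
      (f 0 * (g 0 * h (suc n)) + ((λ i → f 0 * tail g i) ⊗ h) n) + ((tail f ⊗ g) ⊗ h) n
        ≈⟨ +-cong (+-congˡ (⊗-scaleˡ (f 0) (tail g) h n)) (go (tail f) n) ⟩
      (f 0 * (g 0 * h (suc n)) + f 0 * (tail g ⊗ h) n) + (tail f ⊗ (g ⊗ h)) n
        ≈⟨ +-congʳ (distribˡ _ _ _) ⟨
      f 0 * (g 0 * h (suc n) + (tail g ⊗ h) n) + (tail f ⊗ (g ⊗ h)) n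
        ≈⟨ +-congʳ (*-congˡ (⊗-suc g h n)) ⟨
      f 0 * (g ⊗ h) (suc n) + (tail f ⊗ (g ⊗ h)) n
        ≈⟨ ⊗-suc f (g ⊗ h) n ⟨
      (f ⊗ (g ⊗ h)) (suc n) ∎

  ĉ0≈0 : ∀ n → ĉ 0# n ≈ 0#
  ĉ0≈0 zero    = refl
  ĉ0≈0 (suc n) = refl

  0⊗ : ∀ {f} → (∀ n → f n ≈ 0#) → ∀ g n → (f ⊗ g) n ≈ 0#
  0⊗ e g n = trans (sumR-cong (suc n) λ i _ → trans (*-congʳ (e i)) (zeroˡ _)) (sumR-0 (suc n))

  ĉ-⊗ : ∀ a f n → (ĉ a ⊗ f) n ≈ a * f n
  ĉ-⊗ a f zero    = ⊗-zero (ĉ a) f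
  ĉ-⊗ a f (suc n) = begin
    (ĉ a ⊗ f) (suc n)                      ≈⟨ ⊗-suc (ĉ a) f n ⟩
    a * f (suc n) + (tail (ĉ a) ⊗ f) n     ≈⟨ +-congˡ (0⊗ (λ _ → refl) f n) ⟩
    a * f (suc n) + 0#                     ≈⟨ +-identityʳ _ ⟩
    a * f (suc n)                          ∎

  tt-zero : ∀ f → (tt ⊗ f) 0 ≈ 0#
  tt-zero f = trans (⊗-zero tt f) (zeroˡ _)

  tt-suc : ∀ f n → (tt ⊗ f) (suc n) ≈ f n
  tt-suc f n = begin
    (tt ⊗ f) (suc n)                 ≈⟨ ⊗-suc tt f n ⟩
    0# * f (suc n) + (tail tt ⊗ f) n ≈⟨ +-congʳ (zeroˡ _) ⟩
    0# + (tail tt ⊗ f) n             ≈⟨ +-identityˡ _ ⟩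
    (tail tt ⊗ f) n                  ≈⟨ at (⊗-cong {g = f} (pointwise tail-tt) (pointwise λ _ → refl)) n ⟩
    (ĉ 1# ⊗ f) n                     ≈⟨ ĉ-⊗ 1# f n ⟩
    1# * f n                         ≈⟨ *-identityˡ _ ⟩
    f n                              ∎
    where
    tail-tt : ∀ n → tail tt n ≈ ĉ 1# n
    tail-tt zero    = refl
    tail-tt (suc n) = refl

  neg : PS → PS
  neg f n = - f n

  seriesRing : CommutativeRing c ℓ
  seriesRing = record
    { Carrier = PS ; _≈_ = _≋_ ; _+_ = _⊕_ ; _*_ = _⊗_ ; -_ = neg ; 0# = ĉ 0# ; 1# = ĉ 1#
    ; isCommutativeRing = record
      { isRing = record
        { +-isAbelianGroup = record
          { isGroup = record
            { isMonoid = record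
              { isSemigroup = record
                { isMagma = record
                  { isEquivalence = record
                    { refl  = pointwise λ _ → refl
                    ; sym   = λ e → pointwise λ n → sym (at e n)
                    ; trans = λ e e′ → pointwise λ n → trans (at e n) (at e′ n)
                    }
                  ; ∙-cong = λ e e′ → pointwise λ n → +-cong (at e n) (at e′ n)
                  }
                ; assoc = λ f g h → pointwise λ n → +-assoc _ _ _
                }
              ; identity = (λ f → pointwise λ n → trans (+-congʳ (ĉ0≈0 n)) (+-identityˡ _))
                         , (λ f → pointwise λ n → trans (+-congˡ (ĉ0≈0 n)) (+-identityʳ _))
              }
            ; inverse = (λ f → pointwise λ n → trans (-‿inverseˡ _) (sym (ĉ0≈0 n)))
                      , (λ f → pointwise λ n → trans (-‿inverseʳ _) (sym (ĉ0≈0 n)))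
            ; ⁻¹-cong = λ e → pointwise λ n → -‿cong (at e n)
            }
          ; comm = λ f g → pointwise λ n → +-comm _ _
          }
        ; *-cong = ⊗-cong
        ; *-assoc = ⊗-assoc
        ; *-identity = 1⊗ , (λ f → pointwise λ n → trans (at (⊗-comm f (ĉ 1#)) n) (at (1⊗ f) n))
        ; distrib = (λ h f g → pointwise λ n → trans (at (⊗-comm h (f ⊕ g)) n)
                      (trans (at (⊗-distribʳ h f g) n) (+-cong (at (⊗-comm f h) n) (at (⊗-comm g h) n))))
                  , ⊗-distribʳ
        }
      ; *-comm = ⊗-comm
      }
    }
    where
    1⊗ : ∀ f → (ĉ 1# ⊗ f) ≋ f
    1⊗ f = pointwise λ n → trans (ĉ-⊗ 1# f n) (*-identityˡ _)

  -- The solution f of the recursion f l = c l + t Y · f (1 + l), that is, f l = Σ_m (t Y)^m c (l + m).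
  module _ (Y : PS) (c : ℕ → PS) where
    horner : ℕ → ℕ → PS
    horner zero    l = ĉ 0#
    horner (suc K) l = c l ⊕ tt ⊗ (Y ⊗ horner K (suc l))

    geom : ℕ → PS
    geom l n = horner (suc n) l n

  ⊗-agree : ∀ Y {f g} n → (∀ i → i ≤ n → f i ≈ g i) → (Y ⊗ f) n ≈ (Y ⊗ g) n
  ⊗-agree Y n e = sumR-cong (suc n) λ i _ → *-congˡ (e (n ∸ i) (ℕₚ.m∸n≤m n i))

  tt-agree : ∀ {f g} n → (∀ i → i < n → f i ≈ g i) → (tt ⊗ f) n ≈ (tt ⊗ g) n
  tt-agree {f} {g} zero e = trans (tt-zero f) (sym (tt-zero g))
  tt-agree {f} {g} (suc n) e = trans (tt-suc f n) (trans (e n (ℕₚ.n<1+n n)) (sym (tt-suc g n)))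

  contract : ∀ Y (f g : PS) n → (∀ i → i < n → f i ≈ g i) → (tt ⊗ (Y ⊗ f)) n ≈ (tt ⊗ (Y ⊗ g)) n
  contract Y f g n e = tt-agree n λ i i<n → ⊗-agree Y i λ j j≤i → e j (ℕₚ.≤-<-trans j≤i i<n)

  -- Every unfolding contributes a factor t, so a depth above n no longer affects coefficient n.
  -- Hence the diagonal choice `suc n` in `geom`.
  horner-stable : ∀ Y c K L l n → n < K → n < L → horner Y c K l n ≈ horner Y c L l n
  horner-stable Y c (suc K) (suc L) l n (s≤s n≤K) (s≤s n≤L) =
    +-congˡ (contract Y _ _ n λ i i<n →
      horner-stable Y c K L (suc l) i (ℕₚ.<-≤-trans i<n n≤K) (ℕₚ.<-≤-trans i<n n≤L))

  geom-rec : ∀ Y (c : ℕ → PS) l → geom Y c l ≋ (c l ⊕ tt ⊗ (Y ⊗ geom Y c (suc l)))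
  geom-rec Y c l .at n = +-congˡ (contract Y _ _ n λ i i<n →
    horner-stable Y c n (suc i) (suc l) i i<n (ℕₚ.n<1+n i))

  -- The right-hand side is a contraction: its coefficient n sees only lower coefficients of the
  -- unknown, but at the index l + 1. The induction on n therefore treats all l at once.
  geom-unique : ∀ Y (c f : ℕ → PS) → (∀ l → f l ≋ (c l ⊕ tt ⊗ (Y ⊗ f (suc l)))) → ∀ l → f l ≋ geom Y c l
  geom-unique Y c f e l .at n = go (suc n) n (ℕₚ.n<1+n n) l
    where
    go : ∀ m n → n < m → ∀ l → f l n ≈ geom Y c l n
    go (suc m) n (s≤s n≤m) l = begin
      f l n                                      ≈⟨ at (e l) n ⟩
      c l n + (tt ⊗ (Y ⊗ f (suc l))) n           ≈⟨ +-congˡ (contract Y _ _ n λ i i<n →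
                                                       go m i (ℕₚ.<-≤-trans i<n n≤m) (suc l)) ⟩
      c l n + (tt ⊗ (Y ⊗ geom Y c (suc l))) n    ≈⟨ at (geom-rec Y c l) n ⟨
      geom Y c l n                               ∎

-- Elimination by adding multiples of equations.

module LinearCombination {c ℓ} (A : CommutativeRing c ℓ) where
  open CommutativeRing A
  open import Data.Integer.Base using (+_)
  open IntegerSolver A public
  open import Algebra.Properties.AbelianGroup +-abelianGroup using (∙-cancelʳ)

  -- k ×[ e ] e′ adds k times the equation e to the goal, which leaves a ring identity at the end of a chain.
  infixr 0 _×[_]_
  _×[_]_ : ∀ k {l r a b} → l ≈ r → a + k * r ≈ b + k * l → a ≈ b
  k ×[ e ] e′ = ∙-cancelʳ _ _ _ (trans (+-congˡ (*-congˡ e)) e′)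

  one : ∀ {n} → Polynomial n
  one = con (+ 1)

  nil : ∀ {n} → Polynomial n
  nil = con (+ 0)

module Recursion {c ℓ} (A : CommutativeRing c ℓ) where
  open CommutativeRing A

  Solves : Carrier → Carrier → (ℕ → Carrier) → (ℕ → Carrier) → Set ℓ
  Solves t Y c f = ∀ l → f l ≈ c l + t * (Y * f (suc l))

  _≗_ : (ℕ → Carrier) → (ℕ → Carrier) → Set ℓ
  f ≗ g = ∀ l → f l ≈ g l

-- Only existence and uniqueness of the solution of f l = c l + t Y f (l + 1) enter here, so the
-- whole elimination takes place in an abstract ring and never inspects coefficients.
module Complete {c ℓ} (A : CommutativeRing c ℓ)
  (t : CommutativeRing.Carrier A)
  (geom : CommutativeRing.Carrier A → (ℕ → CommutativeRing.Carrier A) → ℕ → CommutativeRing.Carrier A)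
  (geom-rec : ∀ Y c → Recursion.Solves A t Y c (geom Y c))
  (geom-unique : ∀ Y c f → Recursion.Solves A t Y c f → Recursion._≗_ A f (geom Y c))
  where
  open CommutativeRing A
  open LinearCombination A
  open import Relation.Binary.Reasoning.Setoid setoid

  geom-cong : ∀ {Y Y′ f g} → Y ≈ Y′ → (∀ l → f l ≈ g l) → ∀ l → geom Y f l ≈ geom Y′ g l
  geom-cong {Y} {Y′} {f} {g} e e′ = geom-unique Y′ g (geom Y f) λ l →
    trans (geom-rec Y f l) (+-cong (e′ l) (*-congˡ (*-congʳ e)))

  geom-suc : ∀ Y f l → geom Y f (suc l) ≈ geom Y (λ i → f (suc i)) l
  geom-suc Y f = geom-unique Y _ (λ l → geom Y f (suc l)) (λ l → geom-rec Y f (suc l))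

  geom-+ : ∀ Y f g l → geom Y (λ i → f i + g i) l ≈ geom Y f l + geom Y g l
  geom-+ Y f g l = sym (geom-unique Y _ (λ l → geom Y f l + geom Y g l) (λ l → begin
    geom Y f l + geom Y g l
      ≈⟨ +-cong (geom-rec Y f l) (geom-rec Y g l) ⟩
    (f l + t * (Y * geom Y f (suc l))) + (g l + t * (Y * geom Y g (suc l)))
      ≈⟨ solve 6 (λ a b t Y F G → (a :+ t :* (Y :* F)) :+ (b :+ t :* (Y :* G))
                               := (a :+ b) :+ t :* (Y :* (F :+ G))) refl (f l) (g l) t Y _ _ ⟩
    (f l + g l) + t * (Y * (geom Y f (suc l) + geom Y g (suc l))) ∎) l)

  geom-* : ∀ Y k f l → geom Y (λ i → k * f i) l ≈ k * geom Y f l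
  geom-* Y k f l = sym (geom-unique Y _ (λ l → k * geom Y f l) (λ l → begin
    k * geom Y f l
      ≈⟨ *-congˡ (geom-rec Y f l) ⟩
    k * (f l + t * (Y * geom Y f (suc l)))
      ≈⟨ solve 5 (λ k a t Y F → k :* (a :+ t :* (Y :* F)) := k :* a :+ t :* (Y :* (k :* F)))
           refl k (f l) t Y _ ⟩
    k * f l + t * (Y * (k * geom Y f (suc l))) ∎) l)

  geom-head : ∀ Y f → geom Y f 0 ≈ f 0 + t * (Y * geom Y (λ i → f (suc i)) 0)
  geom-head Y f = trans (geom-rec Y f 0) (+-congˡ (*-congˡ (*-congˡ (geom-suc Y f 0))))

  1/[1-t_] : Carrier → Carrier
  1/[1-t Y ] = geom Y (λ _ → 1#) 0

  1/[1-t]-inverse : ∀ Y → (1# - t * Y) * 1/[1-t Y ] ≈ 1#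
  1/[1-t]-inverse Y = 1# ×[ geom-head Y (λ _ → 1#) ]
    solve 3 (λ t Y I → (one :- t :* Y) :* I :+ one :* (one :+ t :* (Y :* I)) := one :+ one :* I)
      refl t Y 1/[1-t Y ]

  geom-const : ∀ Y k → geom Y (λ _ → k) 0 ≈ k * 1/[1-t Y ]
  geom-const Y k = trans (geom-cong refl (λ _ → sym (*-identityʳ k)) 0) (geom-* Y k (λ _ → 1#) 0)

  Unit : Carrier → Set _
  Unit d = ∃ λ d′ → d * d′ ≈ 1#

  unit-cong : ∀ {a b} → a ≈ b → Unit a → Unit b
  unit-cong e (a′ , i) = a′ , trans (*-congʳ (sym e)) i

  unit-* : ∀ {a b} → Unit a → Unit b → Unit (a * b)
  unit-* {a} {b} (a′ , i) (b′ , j) = a′ * b′ , (begin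
    (a * b) * (a′ * b′) ≈⟨ solve 4 (λ a b c d → (a :* b) :* (c :* d) := (a :* c) :* (b :* d)) refl a b a′ b′ ⟩
    (a * a′) * (b * b′) ≈⟨ *-cong i j ⟩
    1# * 1#             ≈⟨ *-identityˡ 1# ⟩
    1#                  ∎)

  unit-1-t* : ∀ Y → Unit (1# - t * Y)
  unit-1-t* Y = 1/[1-t Y ] , 1/[1-t]-inverse Y

  unit-cancel : ∀ {d a b} → Unit d → a * d ≈ b * d → a ≈ b
  unit-cancel {d} {a} {b} (d′ , dd′) e = begin
    a             ≈⟨ *-identityʳ a ⟨
    a * 1#        ≈⟨ *-congˡ dd′ ⟨
    a * (d * d′)  ≈⟨ *-assoc _ _ _ ⟨
    (a * d) * d′  ≈⟨ *-congʳ e ⟩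
    (b * d) * d′  ≈⟨ *-assoc _ _ _ ⟩
    b * (d * d′)  ≈⟨ *-congˡ dd′ ⟩
    b * 1#        ≈⟨ *-identityʳ b ⟩
    b             ∎

  module Weights (x u v : Carrier) where

    r : Carrier
    r = t * (x + u - x * u)

    P : Carrier → Carrier
    P y = 1# - r * y

    next : Carrier → Carrier
    next y = y + P y

    -- Once `T` is eliminated below, `W` is left with the coefficient (1 - r) `h y`. It also equals
    -- 1 - t (u - x u) y and is therefore a unit.
    h : Carrier → Carrier
    h y = P y + t * x * y

    -- At z = 0 the functional equation contains C on both sides. Clearing 1 - t u (`next y`) and
    -- collecting leaves `N y` as the additional coefficient, see `C-rec`.
    N : Carrier → Carrier
    N y = 1# - t * (u * y) - t * (u * v * P y)

    unit-h : ∀ y → Unit (h y)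
    unit-h y = unit-cong (solve 4 (λ t x u y → one :- t :* ((u :- x :* u) :* y)
      := (one :- t :* (x :+ u :- x :* u) :* y) :+ t :* x :* y) refl t x u y) (unit-1-t* ((u - x * u) * y))

    unit-N : ∀ y → Unit (N y)
    unit-N y = unit-cong (solve 5 (λ t u y v P → one :- t :* (u :* y :+ u :* v :* P)
      := one :- t :* (u :* y) :- t :* (u :* v :* P)) refl t u y v (P y)) (unit-1-t* (u * y + u * v * P y))

    -- The functional equation between y and `next y`.

    module FunctionalEquation (z : Carrier) (X D : ℕ → ℕ → Carrier) (a° : ℕ → Carrier)
      (gap : ∀ i l → X (suc i) l ≈ X i (suc l) + t * ((x * X (suc i) l + (v - 1#) * (x * a° l))
                 - u * ((X (suc i) (suc l) - (1# - x) * X (suc i) l)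
                        + (v - 1#) * (a° (suc l) - (1# - x) * a° l))))
      (down-zero : ∀ l → D 0 l ≈ x * z * X 0 l)
      (down-suc : ∀ i l → D (suc i) l ≈ (x * X (suc i) l + (v - 1#) * (x * a° l)) + D i (suc l))
      (down : ∀ i → X i 0 ≈ 1# + t * D i 0)
      (a°-zero : a° 0 ≈ 1#)
      (y : Carrier)
      where

      B C : Carrier → Carrier
      B y = geom (u * y) (λ l → X 0 (suc l)) 0
      C y = geom (u * y) (λ l → a° (suc l)) 0

      private
        yp I p q : Carrier
        yp = next y
        I  = 1/[1-t u * yp ]
        p  = t * (u * yp)
        q  = t * (u * y)

        -- The promotion correction of the gap relation. It is the same for every i, so summing over
        -- i merely multiplies it by `I`.
        ε : ℕ → Carrier
        ε l = r * a° l - t * u * a° (suc l)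

        𝓔 A° : Carrier → Carrier
        𝓔 y = geom (u * y) ε 0
        A° y = geom (u * y) a° 0

        𝒱 : ℕ → Carrier
        𝒱 l = geom (u * yp) (λ i → X (suc i) l) 0

        -- The two unknowns of the elimination. `W-eq`, `T-eq` and `W-down` are three linear
        -- equations for them, and their compatibility is the functional equation.
        T W : Carrier
        T = geom (u * yp) 𝒱 0
        W = 𝒱 0

        A°-head : ∀ y → A° y ≈ 1# + t * (u * y * C y)
        A°-head y = trans (geom-head _ _) (+-congʳ a°-zero)

        𝓔-eval : ∀ y → 𝓔 y ≈ r * A° y - t * u * C y
        𝓔-eval y = begin
          𝓔 y ≈⟨ geom-cong refl (λ l → solve 4 (λ r a k b → r :* a :- k :* b := r :* a :+ (:- k) :* b)
                    refl r (a° l) (t * u) (a° (suc l))) 0 ⟩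
          geom (u * y) (λ l → r * a° l + (- (t * u)) * a° (suc l)) 0 ≈⟨ geom-+ _ _ _ 0 ⟩
          _ ≈⟨ +-cong (geom-* _ _ _ 0) (geom-* _ _ _ 0) ⟩
          r * A° y + (- (t * u)) * C y
            ≈⟨ solve 4 (λ r a k b → r :* a :+ (:- k) :* b := r :* a :- k :* b) refl r (A° y) (t * u) (C y) ⟩
          r * A° y - t * u * C y ∎

        gap′ : ∀ i l → (1# - r) * X (suc i) l + t * u * X (suc i) (suc l)
                     ≈ X i (suc l) + (v - 1#) * ε l
        gap′ i l = 1# ×[ gap i l ] solve 9 (λ t x u v a a₁ b c d →
            let r = t :* (x :+ u :- x :* u) in
            ((one :- r) :* b :+ t :* u :* c) :+ one :* (d :+ t :* ((x :* b :+ (v :- one) :* (x :* a))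
              :- u :* ((c :- (one :- x) :* b) :+ (v :- one) :* (a₁ :- (one :- x) :* a))))
            := (d :+ (v :- one) :* (r :* a :- t :* u :* a₁)) :+ one :* b)
          refl t x u v (a° l) (a° (suc l)) (X (suc i) l) (X (suc i) (suc l)) (X i (suc l))

        -- Splitting off i = 0 on the right of `gap′` produces t u `yp` `𝒱 (suc l)`, the left side
        -- already has t u `𝒱 (suc l)`. The difference carries `yp` - 1 = (1 - r) y, which is why
        -- the factor 1 - r is kept together with `𝒱`.
        𝒱-rec : ∀ l → (1# - r) * 𝒱 l ≈ (X 0 (suc l) + (v - 1#) * ε l * I) + t * (u * y * ((1# - r) * 𝒱 (suc l)))
        𝒱-rec l = 1# ×[ summed ] solve 9 (λ r V V₁ t u y a k I →
             let p = t :* (u :* (y :+ (one :- r :* y))) in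
             ((one :- r) :* V) :+ one :* ((a :+ t :* (u :* (y :+ (one :- r :* y)) :* V₁)) :+ k :* I)
             := ((a :+ k :* I) :+ t :* (u :* y :* ((one :- r) :* V₁))) :+ one :* ((one :- r) :* V :+ t :* u :* V₁))
             refl r (𝒱 l) (𝒱 (suc l)) t u y (X 0 (suc l)) ((v - 1#) * ε l) I
          where
          summed : (1# - r) * 𝒱 l + t * u * 𝒱 (suc l) ≈ (X 0 (suc l) + t * (u * yp * 𝒱 (suc l))) + (v - 1#) * ε l * I
          summed = begin
            (1# - r) * 𝒱 l + t * u * 𝒱 (suc l)  ≈⟨ +-cong (geom-* _ _ _ 0) (geom-* _ _ _ 0) ⟨
            _ ≈⟨ geom-+ _ _ _ 0 ⟨
            _ ≈⟨ geom-cong refl (λ i → gap′ i l) 0 ⟩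
            _ ≈⟨ geom-+ _ _ _ 0 ⟩
            _ ≈⟨ +-cong (geom-head _ _) (geom-const _ _) ⟩
            (X 0 (suc l) + t * (u * yp * 𝒱 (suc l))) + (v - 1#) * ε l * I ∎

        scaled : ∀ Y → geom Y (λ l → X 0 (suc l) + (v - 1#) * ε l * I) 0
                     ≈ geom Y (λ l → X 0 (suc l)) 0 + (v - 1#) * I * geom Y ε 0
        scaled Y = begin
          geom Y (λ l → X 0 (suc l) + (v - 1#) * ε l * I) 0
            ≈⟨ geom-cong refl (λ l → solve 4 (λ a k e I → a :+ k :* e :* I := a :+ k :* I :* e)
                 refl (X 0 (suc l)) (v - 1#) (ε l) I) 0 ⟩
          geom Y (λ l → X 0 (suc l) + (v - 1#) * I * ε l) 0
            ≈⟨ geom-+ _ _ _ 0 ⟩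
          geom Y (λ l → X 0 (suc l)) 0 + geom Y (λ l → (v - 1#) * I * ε l) 0
            ≈⟨ +-congˡ (geom-* _ _ _ 0) ⟩
          geom Y (λ l → X 0 (suc l)) 0 + (v - 1#) * I * geom Y ε 0 ∎

        W-eq : (1# - r) * W ≈ B y + (v - 1#) * I * 𝓔 y
        W-eq = trans (geom-unique (u * y) _ (λ l → (1# - r) * 𝒱 l) 𝒱-rec 0) (scaled (u * y))

        -- The tail `T₁` occurs with ratio t u y in the summed recursion and with ratio t u `yp` in
        -- the head expansion of `T`. Eliminating it leaves the factor `yp` - y = `P y`.
        T-eq : (1# - r) * P y * T ≈ yp * (B yp + (v - 1#) * I * 𝓔 yp) - (1# - r) * y * W
        T-eq = - ((1# - r) * y) ×[ geom-head _ _ ] yp ×[ summed ]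
            solve 8 (λ r y T t u T₁ W Ā →
              let P = one :- r :* y ; yp = y :+ P ; k = :- ((one :- r) :* y) in
              (((one :- r) :* P :* T) :+ k :* (W :+ t :* (u :* yp :* T₁)))
                :+ yp :* (Ā :+ t :* (u :* y :* ((one :- r) :* T₁)))
              := ((yp :* Ā :- (one :- r) :* y :* W) :+ k :* T) :+ yp :* ((one :- r) :* T))
              refl r y T t u T₁ W Ā
          where
          T₁ = geom (u * yp) (λ l → 𝒱 (suc l)) 0
          Ā = B yp + (v - 1#) * I * 𝓔 yp
          summed : (1# - r) * T ≈ Ā + t * (u * y * ((1# - r) * T₁))
          summed = begin
            (1# - r) * T ≈⟨ geom-* _ _ _ 0 ⟨
            _ ≈⟨ geom-cong refl 𝒱-rec 0 ⟩
            _ ≈⟨ geom-+ _ _ _ 0 ⟩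
            _ ≈⟨ +-cong (scaled (u * yp))
                   (trans (geom-cong refl (λ l → solve 5 (λ t u y k V → t :* (u :* y :* (k :* V)) := t :* u :* y :* k :* V)
                             refl t u y (1# - r) (𝒱 (suc l))) 0) (geom-* _ _ _ 0)) ⟩
            Ā + t * u * y * (1# - r) * T₁
              ≈⟨ solve 6 (λ a t u y k V → a :+ t :* u :* y :* k :* V := a :+ t :* (u :* y :* (k :* V)))
                   refl Ā t u y (1# - r) T₁ ⟩
            Ā + t * (u * y * ((1# - r) * T₁)) ∎

        -- With nothing above the last letter only letters up to it can follow, and `down-suc`
        -- unrolls `D (suc i) 0` along the antidiagonal. This is why `T` has the same ratio in both
        -- indices: the weight is constant on antidiagonals.
        W-down : W ≈ I + t * x * (T + z * B yp + (v - 1#) * I * A° yp)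
        W-down = begin
          W ≈⟨ geom-cong refl (λ i → down (suc i)) 0 ⟩
          _ ≈⟨ geom-+ _ _ _ 0 ⟩
          _ ≈⟨ +-congˡ (geom-* _ _ _ 0) ⟩
          I + t * 𝒟 0
            ≈⟨ +-congˡ (*-congˡ (geom-unique (u * yp) _ 𝒟 𝒟-rec 0)) ⟩
          _ ≈⟨ +-congˡ (*-congˡ (geom-+ _ _ _ 0)) ⟩
          _ ≈⟨ +-congˡ (*-congˡ (+-cong (trans (geom-+ _ _ _ 0) (+-cong (geom-* _ _ _ 0) (geom-* _ _ _ 0))) (geom-* _ _ _ 0))) ⟩
          I + t * ((x * T + x * z * B yp) + x * (v - 1#) * I * A° yp)
            ≈⟨ solve 8 (λ I t x T z B k A → I :+ t :* ((x :* T :+ x :* z :* B) :+ x :* k :* I :* A)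
                 := I :+ t :* x :* (T :+ z :* B :+ k :* I :* A)) refl I t x T z (B yp) (v - 1#) (A° yp) ⟩
          I + t * x * (T + z * B yp + (v - 1#) * I * A° yp) ∎
          where
          𝒟 : ℕ → Carrier
          𝒟 l = geom (u * yp) (λ i → D (suc i) l) 0
          𝒟-rec : ∀ l → 𝒟 l ≈ ((x * 𝒱 l + x * z * X 0 (suc l)) + x * (v - 1#) * I * a° l) + t * (u * yp * 𝒟 (suc l))
          𝒟-rec l = begin
            𝒟 l ≈⟨ geom-cong refl (λ i → down-suc i l) 0 ⟩
            _ ≈⟨ geom-+ _ _ _ 0 ⟩
            _ ≈⟨ +-cong (trans (geom-+ _ _ _ 0) (+-cong (geom-* _ _ _ 0) (geom-const _ _))) (geom-head _ _) ⟩
            (x * 𝒱 l + (v - 1#) * (x * a° l) * I) + (D 0 (suc l) + t * (u * yp * 𝒟 (suc l)))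
              ≈⟨ +-congˡ (+-congʳ (down-zero (suc l))) ⟩
            (x * 𝒱 l + (v - 1#) * (x * a° l) * I) + (x * z * X 0 (suc l) + t * (u * yp * 𝒟 (suc l)))
              ≈⟨ solve 7 (λ V k x a I d e → (V :+ k :* (x :* a) :* I) :+ (d :+ e) := ((V :+ d) :+ x :* k :* I :* a) :+ e)
                   refl (x * 𝒱 l) (v - 1#) x (a° l) I (x * z * X 0 (suc l)) (t * (u * yp * 𝒟 (suc l))) ⟩
            ((x * 𝒱 l + x * z * X 0 (suc l)) + x * (v - 1#) * I * a° l) + t * (u * yp * 𝒟 (suc l)) ∎

      functionalEquation :
        h y * B y ≈ ((1# - r) * P y * I + (v - 1#) * I * (t * u * P y * (h y * C y - (1# - x))))
                    + t * x * (yp + z * (1# - r) * P y) * B yp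
      functionalEquation =
        -- The multipliers t x and (1 - r) `P y` cancel `T`, and - `h y` then cancels `W`. In the
        -- next line the v-corrections are reduced to C; those at `yp` cancel altogether, since (1 -
        -- r) `P y` + r `yp` = 1.
        - h y ×[ W-eq ] t * x ×[ T-eq ] (1# - r) * P y ×[ W-down ]
        - (h y * (v - 1#) * I) ×[ 𝓔y ] (t * x * (v - 1#) * I * yp) ×[ 𝓔-eval yp ] (t * x * (v - 1#) * I) ×[ A°-head yp ]
        solve 16 (λ t x u v z y I W T By Bp Cy Cp Ey Ep Ap →
          let k  = v :- one
              r  = t :* (x :+ u :- x :* u)
              P  = one :- r :* y
              yp = y :+ P
              h  = P :+ t :* x :* y
          in
          ((((((h :* By
            :+ (:- h) :* (By :+ k :* I :* Ey))
            :+ t :* x :* (yp :* (Bp :+ k :* I :* Ep) :- (one :- r) :* y :* W))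
            :+ (one :- r) :* P :* (I :+ t :* x :* (T :+ z :* Bp :+ k :* I :* Ap)))
            :+ (:- (h :* k :* I)) :* (r :* (one :+ t :* (u :* y :* Cy)) :- t :* u :* Cy))
            :+ t :* x :* k :* I :* yp :* (r :* Ap :- t :* u :* Cp))
            :+ t :* x :* k :* I :* (one :+ t :* (u :* yp :* Cp)))
          :=
          (((((((one :- r) :* P :* I :+ k :* I :* (t :* u :* P :* (h :* Cy :- (one :- x)))
              :+ t :* x :* (yp :+ z :* (one :- r) :* P) :* Bp)
            :+ (:- h) :* ((one :- r) :* W))
            :+ t :* x :* ((one :- r) :* P :* T))
            :+ (one :- r) :* P :* W)
            :+ (:- (h :* k :* I)) :* Ey)
            :+ t :* x :* k :* I :* yp :* Ep)
            :+ t :* x :* k :* I :* Ap)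
          refl t x u v z y I W T (B y) (B yp) (C y) (C yp) (𝓔 y) (𝓔 yp) (A° yp)
        where
        𝓔y : 𝓔 y ≈ r * (1# + t * (u * y * C y)) - t * u * C y
        𝓔y = trans (𝓔-eval y) (+-congʳ (*-congˡ (A°-head y)))

    -- uL and s are the closed forms behind the inner and the outer sum, expressed by the values B, C of the two
    -- functional equations at y; the subscript p marks values at next y.
    module ClosedForms (z y B Bp C Cp : Carrier) where
      private
        yp I q p k x̄ : Carrier
        yp = next y
        I  = 1/[1-t u * yp ]
        q  = t * (u * y)
        p  = t * (u * yp)
        k  = v - 1#
        x̄  = 1# - x

      FE : Carrier → Carrier → Carrier → Set ℓ
      FE z B Bp = h y * B ≈ ((1# - r) * P y * I + (v - 1#) * I * (t * u * P y * (h y * C - (1# - x))))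
                    + t * x * (yp + z * (1# - r) * P y) * Bp

      uL : Carrier → Carrier → Carrier
      uL y C = t * y * ((1# - t * (u * y)) * C - 1#)

      s : Carrier → Carrier → Carrier → Carrier → Carrier → Carrier
      s a y B C J = (y + z * P y) * B - z * (1# - x) * a + y * ((v - 1#) * (t * (u * y)) * C - 1#) * J

      module _ (feC : FE 0# C Cp) where

        C-rec : N y * (h y * C) ≈ (1# - r) * P y - (v - 1#) * (1# - x) * (t * u * P y) + t * x * (1# - p) * yp * Cp
        C-rec =
          (1# - p) ×[ feC ] ((1# - r) * P y + (v - 1#) * (t * u * P y * (h y * C - (1# - x)))) ×[ 1/[1-t]-inverse (u * yp) ]
          solve 9 (λ r t x u v y C Cp I →
            let P = one :- r :* y ; yp = y :+ P ; h = P :+ t :* x :* y ; p = t :* (u :* yp) ; k = v :- one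
                N = one :- t :* (u :* y) :- t :* (u :* v :* P)
                j = (one :- r) :* P :+ k :* (t :* u :* P :* (h :* C :- (one :- x)))
            in
            ((N :* (h :* C))
               :+ (one :- p) :* (((one :- r) :* P :* I :+ k :* I :* (t :* u :* P :* (h :* C :- (one :- x))))
                  :+ t :* x :* (yp :+ nil :* (one :- r) :* P) :* Cp))
               :+ j :* one
            :=
            (((one :- r) :* P :- k :* (one :- x) :* (t :* u :* P) :+ t :* x :* (one :- p) :* yp :* Cp)
               :+ (one :- p) :* (h :* C))
               :+ j :* ((one :- p) :* I))
          refl r t x u v y C Cp I

        -- Here f is `factor2` and e is `inner`. Unrolled, the recursion shows that `uL` is u times
        -- the inner sum of the statement.
        uL-rec : ∀ f e → f * (h y * N y) ≈ x * t * y * (1# - q) → e * (1# - q) ≈ t * v * P y →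
                 uL y C ≈ f * (u * e + uL yp Cp)
        uL-rec f e f-eq e-eq = unit-cancel (unit-* (unit-h y) (unit-N y)) (
          t * y * (1# - q) ×[ C-rec ] - (u * e + uL yp Cp) ×[ f-eq ] - (x * t * y * u) ×[ e-eq ]
          solve 9 (λ t x u v y C Cp f e →
            let r = t :* (x :+ u :- x :* u) ; P = one :- r :* y ; yp = y :+ P ; h = P :+ t :* x :* y ; p = t :* (u :* yp) ; k = v :- one
                q = t :* (u :* y)
                N = one :- q :- t :* (u :* v :* P)
                uL = t :* y :* ((one :- q) :* C :- one)
                uLp = t :* yp :* ((one :- p) :* Cp :- one)
            in
            ((uL :* (h :* N)
               :+ t :* y :* (one :- q) :* ((one :- r) :* P :- k :* (one :- x) :* (t :* u :* P) :+ t :* x :* (one :- p) :* yp :* Cp))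
               :+ (:- (u :* e :+ uLp)) :* (x :* t :* y :* (one :- q)))
               :+ (:- (x :* t :* y :* u)) :* (t :* v :* P)
            :=
            (((f :* (u :* e :+ uLp)) :* (h :* N)
               :+ t :* y :* (one :- q) :* (N :* (h :* C)))
               :+ (:- (u :* e :+ uLp)) :* (f :* (h :* N)))
               :+ (:- (x :* t :* y :* u)) :* (e :* (one :- q)))
          refl t x u v y C Cp f e)

        s-rec : ∀ a J Jp f c d →
          FE z B Bp →
          (1# - t * (x * z)) * a ≈ 1# →
          (1# - v * q) * J ≈ 1# →
          (1# - v * p) * Jp ≈ 1# →
          f * h y ≈ x * t * (y + z * P y) →
          c * ((1# - q) * (1# - v * p) * h y) ≈ x * P y * (v * q + z * (1# - v * q)) →
          d * ((1# - q) * (1# - v * p) * (1# - v * q)) ≈ u * (1# - v) * P y * (v * q + z * (1# - v * q)) →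
          s a y B C J ≈ c + d * uL y C + f * s a yp Bp Cp Jp
        s-rec a J Jp f c d feB a-eq J-eq Jp-eq f-eq c-eq d-eq =
          unit-cancel (unit-* (unit-h y) (unit-* (unit-1-t* (u * y)) (unit-* unit-vp unit-vq))) final
          where
          unit-vq : Unit (1# - v * q)
          unit-vq = J , J-eq
          unit-vp : Unit (1# - v * p)
          unit-vp = Jp , Jp-eq

          M RA : Carrier
          M = y + z * P y
          RA = M * (h y * C - t * x * yp * Cp) - z * x̄ * P y + y * h y * (k * q * C - 1#) * J
               - x * t * M * yp * (k * p * Cp - 1#) * Jp

          stepA : h y * s a y B C J ≈ h y * (f * s a yp Bp Cp Jp) + RA
          stepA =
            -- The difference of the two functional equations loses their common inhomogeneous part.
            -- The multiplier `M` reproduces itself: yp + z (1 - r) `P y` on the right is `M` taken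
            -- at `next y`.
            M ×[ feB ] - M ×[ feC ] - (s a yp Bp Cp Jp) ×[ f-eq ] - (z * x̄ * P y) ×[ a-eq ]
            solve 16 (λ r t x u v z y B Bp C Cp I a J Jp f →
              let P = one :- r :* y ; yp = y :+ P ; h = P :+ t :* x :* y ; p = t :* (u :* yp) ; k = v :- one
                  q = t :* (u :* y) ; x̄ = one :- x ; M = y :+ z :* P
                  Q = (one :- r) :* P :* I :+ k :* I :* (t :* u :* P :* (h :* C :- (one :- x)))
                  S = (y :+ z :* P) :* B :- z :* (one :- x) :* a :+ y :* (k :* q :* C :- one) :* J
                  Sp = (yp :+ z :* (one :- r :* yp)) :* Bp :- z :* (one :- x) :* a :+ yp :* (k :* p :* Cp :- one) :* Jp
                  RA = M :* (h :* C :- t :* x :* yp :* Cp) :- z :* x̄ :* P :+ y :* h :* (k :* q :* C :- one) :* J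
                       :- x :* t :* M :* yp :* (k :* p :* Cp :- one) :* Jp
              in
              (((h :* S
                 :+ M :* (Q :+ t :* x :* (yp :+ z :* (one :- r) :* P) :* Bp))
                 :+ (:- M) :* (Q :+ t :* x :* (yp :+ nil :* (one :- r) :* P) :* Cp))
                 :+ (:- Sp) :* (x :* t :* M))
                 :+ (:- (z :* x̄ :* P)) :* one
              :=
              ((((h :* (f :* Sp) :+ RA)
                 :+ M :* (h :* B))
                 :+ (:- M) :* (h :* C))
                 :+ (:- Sp) :* (f :* h))
                 :+ (:- (z :* x̄ :* P)) :* ((one :- t :* (x :* z)) :* a))
            refl r t x u v z y B Bp C Cp I a J Jp f

          final : s a y B C J * (h y * ((1# - q) * ((1# - v * p) * (1# - v * q))))
                ≈ (c + d * uL y C + f * s a yp Bp Cp Jp) * (h y * ((1# - q) * ((1# - v * p) * (1# - v * q))))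
          final =
            (1# - q) * (1# - v * p) * (1# - v * q) ×[ stepA ]
            - (1# - v * q) ×[ c-eq ]
            - (h y * uL y C) ×[ d-eq ]
            y * h y * (k * q * C - 1#) * (1# - q) * (1# - v * p) ×[ J-eq ]
            - (x * t * M * yp * (k * p * Cp - 1#) * (1# - q) * (1# - v * q)) ×[ Jp-eq ]
            M * (1# - q) * (1# - v * q) ×[ C-rec ]
            solve 15 (λ t x u v z y C Cp S Sp J Jp f c d →
              let r = t :* (x :+ u :- x :* u)
                  P = one :- r :* y ; yp = y :+ P ; h = P :+ t :* x :* y ; p = t :* (u :* yp) ; k = v :- one
                  q = t :* (u :* y) ; x̄ = one :- x ; M = y :+ z :* P
                  N = one :- q :- t :* (u :* v :* P)
                  q′ = one :- q ; vp = one :- v :* p ; vq = one :- v :* q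
                  Δ = h :* (q′ :* (vp :* vq))
                  br = v :* q :+ z :* (one :- v :* q)
                  uL = t :* y :* (q′ :* C :- one)
                  RA = M :* (h :* C :- t :* x :* yp :* Cp) :- z :* x̄ :* P :+ y :* h :* (k :* q :* C :- one) :* J
                       :- x :* t :* M :* yp :* (k :* p :* Cp :- one) :* Jp
                  kJ = y :* h :* (k :* q :* C :- one) :* q′ :* vp
                  kJp = :- (x :* t :* M :* yp :* (k :* p :* Cp :- one) :* q′ :* vq)
              in
              (((((S :* Δ
                :+ q′ :* vp :* vq :* (h :* (f :* Sp) :+ RA))
                :+ (:- vq) :* (x :* P :* br))
                :+ (:- (h :* uL)) :* (u :* (one :- v) :* P :* br))
                :+ kJ :* one)
                :+ kJp :* one)
                :+ M :* q′ :* vq :* ((one :- r) :* P :- k :* x̄ :* (t :* u :* P) :+ t :* x :* (one :- p) :* yp :* Cp)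
              :=
              ((((((c :+ d :* uL :+ f :* Sp) :* Δ
                :+ q′ :* vp :* vq :* (h :* S))
                :+ (:- vq) :* (c :* (q′ :* vp :* h)))
                :+ (:- (h :* uL)) :* (d :* (q′ :* vp :* vq)))
                :+ kJ :* (vq :* J))
                :+ kJp :* (vp :* Jp))
                :+ M :* q′ :* vq :* (N :* (h :* C)))
            refl t x u v z y C Cp (s a y B C J) (s a yp Bp Cp Jp) J Jp f c d

    -- The sum over the length of the initial run.

    module Runs (z : Carrier) (a a° Up Up° Θ E pw : ℕ → Carrier)
       (a-rec : ∀ m → a m ≈ 1# + t * (x * z * a m + u * Up m))
       (a°-rec : ∀ m → a° m ≈ 1# + t * (u * Up° m))
       (Up-zero : Up 0 ≈ 0#)
       (Up°-zero : Up° 0 ≈ 0#)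
       (Θ-zero : Θ 0 ≈ 0#)
       (Θ-suc : ∀ m → Θ (suc m) ≈ v * Θ m + (v - 1#) * Up° m)
       (pw-zero : pw 0 ≈ 1#)
       (pw-suc : ∀ m → pw (suc m) ≈ v * pw m)
       (E-eq : ∀ m → E m ≈ pw m + t * (z * (a (suc m) - (1# - x) * a m) + Up m + Θ m))
       where

       a-zero : (1# - t * (x * z)) * a 0 ≈ 1#
       a-zero = 1# ×[ a-rec 0 ] t * u ×[ Up-zero ]
         solve 6 (λ t x z a u U → ((one :- t :* (x :* z)) :* a :+ one :* (one :+ t :* (x :* z :* a :+ u :* U))) :+ t :* u :* nil
           := (one :+ one :* a) :+ t :* u :* U) refl t x z (a 0) u (Up 0)

       a°-zero : a° 0 ≈ 1#
       a°-zero = 1# ×[ a°-rec 0 ] t * u ×[ Up°-zero ]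
         solve 4 (λ t a u U → (a :+ one :* (one :+ t :* (u :* U))) :+ t :* u :* nil
           := (one :+ one :* a) :+ t :* u :* U) refl t (a° 0) u (Up° 0)

       private
         -- As t u `Up°` m = `a°` m - 1, the upward sums inside `Θ` can be traded for `a°`; κ is `Θ`
         -- after this exchange, up to powers of v.
         κ : ℕ → Carrier
         κ zero    = 0#
         κ (suc m) = v * κ m + a° m

         κ-eq : ∀ m → t * u * Θ m ≈ (v - 1#) * κ m - (pw m - 1#)
         κ-eq zero = t * u ×[ Θ-zero ] 1# ×[ pw-zero ]
           solve 5 (λ t u Θ v w → (t :* u :* Θ :+ t :* u :* nil) :+ one :* one
             := (((v :- one) :* nil :- (w :- one)) :+ t :* u :* Θ) :+ one :* w) refl t u (Θ 0) v (pw 0)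
         κ-eq (suc m) =
           t * u ×[ Θ-suc m ] v ×[ κ-eq m ] - (v - 1#) ×[ a°-rec m ] 1# ×[ pw-suc m ]
           solve 10 (λ t u v Θ Θ₁ U κ a w w₁ →
             let k = v :- one in
             (((t :* u :* Θ₁ :+ t :* u :* (v :* Θ :+ k :* U))
               :+ v :* (k :* κ :- (w :- one)))
               :+ (:- k) :* (one :+ t :* (u :* U)))
               :+ one :* (v :* w)
             := ((((k :* (v :* κ :+ a) :- (w₁ :- one)) :+ t :* u :* Θ₁)
               :+ v :* (t :* u :* Θ))
               :+ (:- k) :* a)
               :+ one :* w₁)
             refl t u v (Θ m) (Θ (suc m)) (Up° m) (κ m) (a° m) (pw m) (pw (suc m))

         -- The factor u is needed because `a-rec` and `κ-eq` determine `Up` and `Θ` only after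
         -- multiplication by t u.
         uE : ∀ m → u * E m ≈ ((1# - r * z) * a m + t * u * z * a (suc m)) + ((u - 1#) * pw m + (v - 1#) * κ m)
         uE m =
           u ×[ E-eq m ] 1# ×[ κ-eq m ] - 1# ×[ a-rec m ]
           solve 12 (λ t x u v z E w a a₁ U Θ κ →
             let k = v :- one ; r = t :* (x :+ u :- x :* u) in
             ((u :* E :+ u :* (w :+ t :* (z :* (a₁ :- (one :- x) :* a) :+ U :+ Θ)))
               :+ one :* (k :* κ :- (w :- one)))
               :+ (:- one) :* (one :+ t :* (x :* z :* a :+ u :* U))
             := (((((one :- r :* z) :* a :+ t :* u :* z :* a₁) :+ ((u :- one) :* w :+ k :* κ)) :+ u :* E)
               :+ one :* (t :* u :* Θ))
               :+ (:- one) :* a)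
             refl t x u v z (E m) (pw m) (a m) (a (suc m)) (Up m) (Θ m) (κ m)

       module _ (y : Carrier) where
         private
           q B C A° K K₁ B₂ : Carrier
           q = t * (u * y)
           B = geom (u * y) (λ l → a (suc l)) 0
           B₂ = geom (u * y) (λ l → a (suc (suc l))) 0
           C = geom (u * y) (λ l → a° (suc l)) 0
           A° = geom (u * y) a° 0
           K = geom (u * y) κ 0
           K₁ = geom (u * y) (λ l → κ (suc l)) 0

         J : Carrier
         J = geom (u * y) pw 0

         private
           pw-suc-sum : geom (u * y) (λ l → pw (suc l)) 0 ≈ v * J
           pw-suc-sum = trans (geom-cong refl pw-suc 0) (geom-* _ _ _ 0)

         J-eq : (1# - v * q) * J ≈ 1#
         J-eq = 1# ×[ geom-head (u * y) pw ] q ×[ pw-suc-sum ] 1# ×[ pw-zero ]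
           solve 7 (λ t u y v J J₁ w → let q = t :* (u :* y) in
             (((one :- v :* q) :* J :+ one :* (w :+ t :* (u :* y :* J₁))) :+ q :* (v :* J)) :+ one :* one
             := ((one :+ one :* J) :+ q :* J₁) :+ one :* w)
             refl t u y v J _ (pw 0)

         private
           K₁-eq : K₁ ≈ v * K + A°
           K₁-eq = trans (geom-+ _ _ _ 0) (+-congʳ (geom-* _ _ _ 0))

           -- κ is the convolution of the powers of v with `a°`, so its generating function is the
           -- product of theirs.
           K₁-closed : K₁ ≈ (1# + t * (u * y * C)) * J
           K₁-closed =
             J ×[ K₁-eq ] - K₁ ×[ J-eq ] v * J ×[ geom-head (u * y) κ ] J ×[ geom-head (u * y) a° ] J ×[ a°-zero ]
             solve 10 (λ t u y v J K₁ K A° C a° →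
               let q = t :* (u :* y) in
               ((((K₁ :+ J :* (v :* K :+ A°))
                 :+ (:- K₁) :* one)
                 :+ v :* J :* (nil :+ t :* (u :* y :* K₁)))
                 :+ J :* (a° :+ t :* (u :* y :* C)))
                 :+ J :* one
               := (((((one :+ t :* (u :* y :* C)) :* J :+ J :* K₁)
                 :+ (:- K₁) :* ((one :- v :* q) :* J))
                 :+ v :* J :* K)
                 :+ J :* A°)
                 :+ J :* a°)
               refl t u y v J K₁ K A° C (a° 0)

           E-tail : u * geom (u * y) (λ l → E (suc l)) 0
                  ≈ ((1# - r * z) * B + t * u * z * B₂) + ((u - 1#) * (v * J) + (v - 1#) * K₁)
           E-tail = begin
             u * geom (u * y) (λ l → E (suc l)) 0 ≈⟨ geom-* _ _ _ 0 ⟨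
             _ ≈⟨ geom-cong refl (λ l → uE (suc l)) 0 ⟩
             _ ≈⟨ geom-+ _ _ _ 0 ⟩
             _ ≈⟨ +-cong (trans (geom-+ _ _ _ 0) (+-cong (geom-* _ _ _ 0) (geom-* _ _ _ 0)))
                         (trans (geom-+ _ _ _ 0) (+-cong (trans (geom-* _ _ _ 0) (*-congˡ pw-suc-sum)) (geom-* _ _ _ 0))) ⟩
             ((1# - r * z) * B + t * u * z * B₂) + ((u - 1#) * (v * J) + (v - 1#) * K₁) ∎

         -- The origin of `s`: `J` belongs to the sequences 0 1 2 ... themselves, which make up the
         -- first fraction of the statement, and t times `s` to all sequences that leave their run.
         run-sum : geom (u * y) E 0 ≈ J + t * ((y + z * P y) * B - z * (1# - x) * a 0 + y * ((v - 1#) * (t * (u * y)) * C - 1#) * J)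
         run-sum =
           1# ×[ geom-head (u * y) E ] t * y ×[ E-tail ] 1# ×[ E-eq 0 ] 1# ×[ pw-zero ] t ×[ Up-zero ] t ×[ Θ-zero ]
           - (t * z) ×[ geom-head (u * y) (λ l → a (suc l)) ] t * y * (v - 1#) ×[ K₁-closed ] - 1# ×[ J-eq ]
           solve 19 (λ t x u v z y J B B₂ C K₁ g E₀ Eₛ w U Θ a₀ a₁ →
             let r = t :* (x :+ u :- x :* u) ; P = one :- r :* y ; k = v :- one ; q = t :* (u :* y) in
             ((((((((g
               :+ one :* (E₀ :+ t :* (u :* y :* Eₛ)))
               :+ t :* y :* (((one :- r :* z) :* B :+ t :* u :* z :* B₂) :+ ((u :- one) :* (v :* J) :+ k :* K₁)))
               :+ one :* (w :+ t :* (z :* (a₁ :- (one :- x) :* a₀) :+ U :+ Θ)))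
               :+ one :* one)
               :+ t :* nil)
               :+ t :* nil)
               :+ (:- (t :* z)) :* (a₁ :+ t :* (u :* y :* B₂)))
               :+ t :* y :* k :* ((one :+ t :* (u :* y :* C)) :* J))
               :+ (:- one) :* one
             :=
             (((((((((J :+ t :* ((y :+ z :* P) :* B :- z :* (one :- x) :* a₀ :+ y :* (k :* q :* C :- one) :* J))
               :+ one :* g)
               :+ t :* y :* (u :* Eₛ))
               :+ one :* E₀)
               :+ one :* w)
               :+ t :* U)
               :+ t :* Θ)
               :+ (:- (t :* z)) :* B)
               :+ t :* y :* k :* K₁)
               :+ (:- one) :* ((one :- v :* q) :* J))
             refl t x u v z y J B B₂ C K₁ (geom (u * y) E 0) (E 0) (geom (u * y) (λ l → E (suc l)) 0) (pw 0) (Up 0) (Θ 0) (a 0) (a 1)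

    -- The fractions of the statement, rewritten in terms of y.

    module Quotients (z : Carrier) where

     σ : Carrier
     σ = x + u - x * u

     q br : Carrier → Carrier
     q y  = t * (u * y)
     br y = v * q y + z * (1# - v * q y)

     P-next : ∀ y → P (next y) ≈ P y * (1# - r)
     P-next y = solve 2 (λ r y → one :- r :* (y :+ (one :- r :* y)) := (one :- r :* y) :* (one :- r)) refl r y

     -- In terms of y the factors of the denominators in the sums become `σ`, possibly times t,
     -- times a series with constant term 1. This accounts for the powers of t and of the inverse of
     -- `σ` in the quotients.
     E-form : ∀ y → (x - x * u) + u * P y ≈ σ * (1# - q y)
     E-form y = solve 4 (λ t x u y → let σ = x :+ u :- x :* u in
       (x :- x :* u) :+ u :* (one :- t :* σ :* y) := σ :* (one :- t :* (u :* y))) refl t x u y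

     F-form : ∀ y → (r - t * (u * v)) + t * (u * v) * P y ≈ t * (σ * (1# - v * q y))
     F-form y = solve 5 (λ t x u v y → let σ = x :+ u :- x :* u in
       (t :* σ :- t :* (u :* v)) :+ t :* (u :* v) :* (one :- t :* σ :* y) := t :* (σ :* (one :- v :* (t :* (u :* y)))))
       refl t x u v y

     H-form : ∀ y → x - u * (x - 1#) * P y ≈ σ * h y
     H-form y = solve 4 (λ t x u y → let σ = x :+ u :- x :* u in
       x :- u :* (x :- one) :* (one :- t :* σ :* y) := σ :* ((one :- t :* σ :* y) :+ t :* x :* y)) refl t x u y

     B-form : ∀ y → (t * (u * v) + z * (r - t * (u * v))) - t * (u * v) * (1# - z) * P y ≈ t * (σ * br y)
     B-form y = solve 6 (λ t x u v z y → let σ = x :+ u :- x :* u ; vq = v :* (t :* (u :* y)) in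
       (t :* (u :* v) :+ z :* (t :* σ :- t :* (u :* v))) :- t :* (u :* v) :* (one :- z) :* (one :- t :* σ :* y)
       := t :* (σ :* (vq :+ z :* (one :- vq)))) refl t x u v z y

     factor1-numerator : ∀ y → x - x * (1# - r * z) * P y ≈ σ * (x * t * (y + z * P y))
     factor1-numerator y = solve 5 (λ t x u z y → let σ = x :+ u :- x :* u ; P = one :- t :* σ :* y in
       x :- x :* (one :- t :* σ :* z) :* P := σ :* (x :* t :* (y :+ z :* P))) refl t x u z y

     factor2-numerator : ∀ y → x * (1# - P y) * (σ * (1# - q y)) ≈ (σ * σ) * (x * t * y * (1# - q y))
     factor2-numerator y = solve 5 (λ t x u σ y → let q = t :* (u :* y) in
       x :* (one :- (one :- t :* σ :* y)) :* (σ :* (one :- q)) := (σ :* σ) :* (x :* t :* y :* (one :- q))) refl t x u σ y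

     factor2-denominator : ∀ y → (x - x * u) + u * (1# - r * v) * P y ≈ σ * N y
     factor2-denominator y = solve 5 (λ t x u v y → let σ = x :+ u :- x :* u ; P = one :- t :* σ :* y in
       (x :- x :* u) :+ u :* (one :- t :* σ :* v) :* P := σ :* (one :- t :* (u :* y) :- t :* (u :* v :* P))) refl t x u v y

     inner-numerator : ∀ y → r * v * P y ≈ σ * (t * v * P y)
     inner-numerator y = solve 4 (λ t σ v P → t :* σ :* v :* P := σ :* (t :* v :* P)) refl t σ v (P y)

     -- r^2 and the bracket together carry t^3 `σ`^3. The three `σ` and one t cancel against the
     -- denominator, and the remaining t^2 belongs to the prefactor common to both sums.
     term1-numerator : ∀ y₀ y → y₀ * (1# * r * r) * v * x * z * (t * (σ * br y)) * P y
                     ≈ t * ((σ * σ * σ) * (t * t * (y₀ * z * v) * (x * P y * br y)))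
     term1-numerator y₀ y = solve 8 (λ t σ x v z y₀ b P →
       y₀ :* (one :* (t :* σ) :* (t :* σ)) :* v :* x :* z :* (t :* (σ :* b)) :* P
       := t :* ((σ :* σ :* σ) :* (t :* t :* (y₀ :* z :* v) :* (x :* P :* b)))) refl t σ x v z y₀ (br y) (P y)

     term1-denominator : ∀ a b c → a * (t * b) * c ≈ t * (a * b * c)
     term1-denominator a b c = solve 4 (λ t a b c → a :* (t :* b) :* c := t :* (a :* b :* c)) refl t a b c

     term2-numerator : ∀ y₀ y → y₀ * (1# * r * r) * (1# * u * u) * v * t * z * (1# - v) * (t * (σ * br y)) * P y
                     ≈ t * (t * ((σ * σ * σ) * (t * t * (y₀ * z * v) * (u * (u * (1# - v) * P y * br y)))))
     term2-numerator y₀ y = solve 8 (λ t σ u v z y₀ b P →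
       y₀ :* (one :* (t :* σ) :* (t :* σ)) :* (one :* u :* u) :* v :* t :* z :* (one :- v) :* (t :* (σ :* b)) :* P
       := t :* (t :* ((σ :* σ :* σ) :* (t :* t :* (y₀ :* z :* v) :* (u :* (u :* (one :- v) :* P :* b))))))
       refl t σ u v z y₀ (br y) (P y)

     term2-denominator : ∀ a b c → a * (t * b) * (t * c) ≈ t * (t * (a * b * c))
     term2-denominator a b c = solve 4 (λ t a b c → a :* (t :* b) :* (t :* c) := t :* (t :* (a :* b :* c))) refl t a b c

     module Cancel (unit-σ : Unit σ) where

       cancel₁ : ∀ {f a b} → f * (σ * a) ≈ σ * b → f * a ≈ b
       cancel₁ {f} {a} {b} e = unit-cancel unit-σ
         (trans (solve 3 (λ f a σ → f :* a :* σ := f :* (σ :* a)) refl f a σ) (trans e (*-comm σ b)))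

       cancel₂ : ∀ {f a b m} → f * (σ * a * (σ * b)) ≈ σ * σ * m → f * (a * b) ≈ m
       cancel₂ {f} {a} {b} {m} e = unit-cancel (unit-* unit-σ unit-σ)
         (trans (solve 4 (λ f a b σ → f :* (a :* b) :* (σ :* σ) := f :* (σ :* a :* (σ :* b))) refl f a b σ)
           (trans e (*-comm (σ * σ) m)))

       cancel₃ : ∀ {f a b c m} → f * (σ * a * (σ * b) * (σ * c)) ≈ σ * σ * σ * m → f * (a * b * c) ≈ m
       cancel₃ {f} {a} {b} {c} {m} e = unit-cancel (unit-* (unit-* unit-σ unit-σ) unit-σ)
         (trans (solve 5 (λ f a b c σ → f :* (a :* b :* c) :* (σ :* σ :* σ) := f :* (σ :* a :* (σ :* b) :* (σ :* c))) refl f a b c σ)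
           (trans e (*-comm (σ * σ * σ) m)))

     _÷_ : Carrier → ∀ {d} → Unit d → Carrier
     m ÷ (d′ , _) = m * d′

     ÷-eq : ∀ m {d} (i : Unit d) → (m ÷ i) * d ≈ m
     ÷-eq m {d} (d′ , e) = trans (*-assoc m d′ d) (trans (*-congˡ (trans (*-comm d′ d) e)) (*-identityʳ m))

     ÷-unique : ∀ {f T m d} (i : Unit d) → f * d ≈ T * m → f ≈ T * (m ÷ i)
     ÷-unique {f} {T} {m} {d} i e = unit-cancel i (trans e (trans (*-congˡ (sym (÷-eq m i))) (sym (*-assoc T (m ÷ i) d))))

     ÷-unique′ : ∀ {f T b m d} (i : Unit d) → f * d ≈ T * (b * m) → f ≈ T * (b * (m ÷ i))
     ÷-unique′ {f} {T} {b} {m} {d} i@(d′ , _) e = trans (÷-unique i e) (*-congˡ (*-assoc b m d′))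

     unit-1-vq : ∀ y → Unit (1# - v * q y)
     unit-1-vq y = unit-cong (solve 4 (λ t u v y → one :- t :* (v :* (u :* y)) := one :- v :* (t :* (u :* y))) refl t u v y)
       (unit-1-t* (v * (u * y)))

     outer-step : ∀ Π k d f L s s′ →
       s ≈ k + d * L + f * s′ → Π * s ≈ Π * (k + d * L) + (Π * f) * s′
     outer-step Π k d f L s s′ e = Π ×[ e ] solve 7 (λ Π k d f L s s′ →
       Π :* s :+ Π :* (k :+ d :* L :+ f :* s′) := (Π :* (k :+ d :* L) :+ Π :* f :* s′) :+ Π :* s) refl Π k d f L s s′

     inner-step : ∀ L L′ f e Σ Π L″ → L ≈ f * (u * e + L′) → L′ ≈ u * Σ + Π * L″ →
       L ≈ u * (e * (f * 1#) + f * Σ) + (f * Π) * L″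
     inner-step L L′ f e Σ Π L″ e₁ e₂ = 1# ×[ e₁ ] f ×[ e₂ ] solve 8 (λ u L L′ f e Σ Π L″ →
       (L :+ one :* (f :* (u :* e :+ L′))) :+ f :* (u :* Σ :+ Π :* L″)
       := ((u :* (e :* (f :* one) :+ f :* Σ) :+ f :* Π :* L″) :+ one :* L) :+ f :* L′) refl u L L′ f e Σ Π L″

     collect : ∀ T Π c d L Σ Π′ L″ Q₁ Q₂ → Q₁ ≈ T * c → Q₂ ≈ T * (u * d) → L ≈ u * Σ + Π′ * L″ →
       T * (Π * (c + d * L)) ≈ (Q₁ * Π + Q₂ * Σ * Π) + T * (Π * (d * (Π′ * L″)))
     collect T Π c d L Σ Π′ L″ Q₁ Q₂ e₁ e₂ e₃ =
       - Π ×[ e₁ ] - (Σ * Π) ×[ e₂ ] T * Π * d ×[ e₃ ]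
       solve 11 (λ u T Π c d L Σ Π′ L″ Q₁ Q₂ →
         ((T :* (Π :* (c :+ d :* L)) :+ (:- Π) :* (T :* c)) :+ (:- (Σ :* Π)) :* (T :* (u :* d))) :+ T :* Π :* d :* (u :* Σ :+ Π′ :* L″)
         := ((((Q₁ :* Π :+ Q₂ :* Σ :* Π) :+ T :* (Π :* (d :* (Π′ :* L″)))) :+ (:- Π) :* Q₁) :+ (:- (Σ :* Π)) :* Q₂) :+ T :* Π :* d :* L)
         refl u T Π c d L Σ Π′ L″ Q₁ Q₂

     term0-form : ∀ y J f → (1# - v * q y) * J ≈ 1# → f * (1# - v * q y) ≈ v * y * t * z → f ≈ t * (y * z * v * J)
     term0-form y J f e₁ e₂ = unit-cancel (unit-1-vq y) (1# ×[ e₂ ] - (t * (y * z * v)) ×[ e₁ ]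
       solve 7 (λ t u v z y J f → let d = one :- v :* (t :* (u :* y)) ; k = :- (t :* (y :* z :* v)) in
         (f :* d :+ one :* (v :* y :* t :* z)) :+ k :* one
         := (t :* (y :* z :* v :* J) :* d :+ one :* (f :* d)) :+ k :* (d :* J)) refl t u v z y J f)

     total-form : ∀ y J s → t * (y * z * v * (J + t * s)) ≈ t * (y * z * v * J) + t * t * (y * z * v) * s
     total-form y J s = solve 6 (λ t v z y J s → t :* (y :* z :* v :* (J :+ t :* s))
       := t :* (y :* z :* v :* J) :+ t :* t :* (y :* z :* v) :* s) refl t v z y J s

     term0-denominator : ∀ y → 1# - v * y * t * u ≈ 1# - v * q y
     term0-denominator y = solve 4 (λ t u v y → one :- v :* y :* t :* u := one :- v :* (t :* (u :* y))) refl t u v y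

     no-zeros : ∀ x a b → 1# + t * (x * 0# * a + b) ≈ 1# + t * b
     no-zeros x a b = solve 4 (λ t x a b → one :+ t :* (x :* nil :* a :+ b) := one :+ t :* b) refl t x a b

-- The values 1, …, asc + 1 of a prefix: not yet occurring (new), occurring (used), or occurring as a current
-- right-to-left minimum (rec).
data Entry : Set where
  used new rec : Entry

demote : Entry → Entry
demote used = used
demote new  = new
demote rec  = used

recs : List Entry → ℕ
recs []         = 0
recs (rec ∷ B)  = suc (recs B)
recs (used ∷ B) = recs B
recs (new ∷ B)  = recs B

-- The letter process: deletion and promotion of values.

module Process {c ℓ} (R : CommutativeRing c ℓ) (x u v : CommutativeRing.Carrier R) where
  open CommutativeRing R
  open Series R using (_^ᶜ_)
  open LinearCombination R
  open import Relation.Binary.Reasoning.Setoid setoid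

  wt : Entry → Carrier
  wt used = x
  wt new  = 1#
  wt rec  = x

  -- A word of values cut at the last letter: φ B A, where B lists the values below the cut downwards from the last
  -- letter and A those above it upwards.  The value 0 always occurs and always is a minimum; it is kept implicit at the
  -- bottom of B, and its factor v is left out.
  State : Set c
  State = List Entry → List Entry → Carrier

  module _ (z : Carrier) where
    -- A value passed on the way down is handed over to `A` demoted, because the smaller letter that
    -- follows ends its role as a minimum. The base case is the letter 0: always a repetition, hence
    -- x, and counted by z.
    downΣ : State → State
    downΣ φ []      A = x * z * φ [] A
    downΣ φ (e ∷ B) A = wt e * φ (rec ∷ B) A + downΣ φ B (demote e ∷ A)

  upΣ : State → State
  upΣ φ B []      = 0#
  upΣ φ B (e ∷ A) = wt e * φ (rec ∷ B) (A ++ new ∷ []) + upΣ φ (demote e ∷ B) A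

  -- Weight of all continuations by n letters: u marks ascents, x repeated letters, z the letter 0 and v the minima.
  -- An ascent makes one more value available on top, whence the appended new in upΣ.
  Φ : Carrier → ℕ → State
  Φ z zero    B A = v ^ᶜ recs B
  Φ z (suc n) B A = downΣ z (Φ z n) B A + u * upΣ (Φ z n) B A

  record Deletion (φ : State) : Set ℓ where
    field
      below : ∀ B B′ A → φ (B ++ used ∷ B′) A ≈ x * φ (B ++ new ∷ B′) A + (1# - x) * φ (B ++ B′) A
      above : ∀ B A A′ → φ B (A ++ used ∷ A′) ≈ x * φ B (A ++ new ∷ A′) + (1# - x) * φ B (A ++ A′)

  private
    mix : ∀ k {p q r a b d} → a ≈ x * b + (1# - x) * d → p ≈ x * q + (1# - x) * r →
          k * a + p ≈ x * (k * b + q) + (1# - x) * (k * d + r)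
    mix k {p} {q} {r} {a} {b} {d} e e′ = k ×[ e ] 1# ×[ e′ ]
      solve 8 (λ x k p q r a b d →
        ((k :* a :+ p) :+ k :* (x :* b :+ (one :- x) :* d)) :+ one :* (x :* q :+ (one :- x) :* r)
        := ((x :* (k :* b :+ q) :+ (one :- x) :* (k :* d :+ r)) :+ k :* a) :+ one :* p)
        refl x k p q r a b d

    mix0 : ∀ k {a b d} → a ≈ x * b + (1# - x) * d → k * a ≈ x * (k * b) + (1# - x) * (k * d)
    mix0 k {a} {b} {d} e = k ×[ e ]
      solve 5 (λ x k a b d → k :* a :+ k :* (x :* b :+ (one :- x) :* d)
        := (x :* (k :* b) :+ (one :- x) :* (k :* d)) :+ k :* a) refl x k a b d

    -- The case in which the next letter is the marked value itself: it weighs x if used and 1 if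
    -- new, becomes `rec` either way, and has no counterpart once the value is deleted.
    mix₁ : ∀ {p q r h} → p ≈ x * q + (1# - x) * r →
           x * h + p ≈ x * (1# * h + q) + (1# - x) * r
    mix₁ {p} {q} {r} {h} e = 1# ×[ e ]
      solve 5 (λ x p q r h → (x :* h :+ p) :+ one :* (x :* q :+ (one :- x) :* r)
        := (x :* (one :* h :+ q) :+ (one :- x) :* r) :+ one :* p) refl x p q r h

  module DeletionSums (z : Carrier) {φ : State} (D : Deletion φ) where
    open Deletion D

    downΣ-above : ∀ B A A′ → downΣ z φ B (A ++ used ∷ A′)
                  ≈ x * downΣ z φ B (A ++ new ∷ A′) + (1# - x) * downΣ z φ B (A ++ A′)
    downΣ-above []      A A′ = mix0 (x * z) (above [] A A′)
    downΣ-above (e ∷ B) A A′ = mix (wt e) (above (rec ∷ B) A A′) (downΣ-above B (demote e ∷ A) A′)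

    downΣ-below : ∀ B B′ A → downΣ z φ (B ++ used ∷ B′) A
                  ≈ x * downΣ z φ (B ++ new ∷ B′) A + (1# - x) * downΣ z φ (B ++ B′) A
    downΣ-below []      B′ A = mix₁ (downΣ-above B′ [] A)
    downΣ-below (e ∷ B) B′ A = mix (wt e) (below (rec ∷ B) B′ A) (downΣ-below B B′ (demote e ∷ A))

    upΣ-below : ∀ B B′ A → upΣ φ (B ++ used ∷ B′) A
                ≈ x * upΣ φ (B ++ new ∷ B′) A + (1# - x) * upΣ φ (B ++ B′) A
    upΣ-below B B′ []      = solve 1 (λ x → nil := x :* nil :+ (one :- x) :* nil) refl x
    upΣ-below B B′ (e ∷ A) = mix (wt e) (below (rec ∷ B) B′ (A ++ new ∷ [])) (upΣ-below (demote e ∷ B) B′ A)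

    upΣ-above : ∀ B A A′ → upΣ φ B (A ++ used ∷ A′)
                ≈ x * upΣ φ B (A ++ new ∷ A′) + (1# - x) * upΣ φ B (A ++ A′)
    upΣ-above B []      A′ = mix₁ (upΣ-below [] B A′)
    upΣ-above B (e ∷ A) A′ = mix (wt e) above′ (upΣ-above (demote e ∷ B) A A′)
      where
      shift′ : ∀ A″ → φ (rec ∷ B) ((A ++ A″) ++ new ∷ []) ≡ φ (rec ∷ B) (A ++ (A″ ++ new ∷ []))
      shift′ A″ = ≡.cong (φ (rec ∷ B)) (Listₚ.++-assoc A A″ (new ∷ []))
      above′ : φ (rec ∷ B) ((A ++ used ∷ A′) ++ new ∷ [])
               ≈ x * φ (rec ∷ B) ((A ++ new ∷ A′) ++ new ∷ []) + (1# - x) * φ (rec ∷ B) ((A ++ A′) ++ new ∷ [])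
      above′ rewrite shift′ (used ∷ A′) | shift′ (new ∷ A′) | shift′ A′ = above (rec ∷ B) A (A′ ++ new ∷ [])

  -- A letter that is not yet used counts as used except in the continuations that never visit it.
  deletion : ∀ z n → Deletion (Φ z n)
  deletion z zero = record
    { below = λ B B′ A → trans (reflexive (≡.cong (v ^ᶜ_) (recs-used B B′)))
        (trans (split _) (+-congʳ (*-congˡ (reflexive (≡.cong (v ^ᶜ_) (≡.sym (recs-new B B′)))))))
    ; above = λ B A A′ → split _ }
    where
    split : ∀ a → a ≈ x * a + (1# - x) * a
    split = solve 2 (λ x a → a := x :* a :+ (one :- x) :* a) refl x
    recs-used : ∀ B B′ → recs (B ++ used ∷ B′) ≡ recs (B ++ B′)
    recs-used []         B′ = ≡.refl
    recs-used (used ∷ B) B′ = recs-used B B′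
    recs-used (new ∷ B)  B′ = recs-used B B′
    recs-used (rec ∷ B)  B′ = ≡.cong suc (recs-used B B′)
    recs-new : ∀ B B′ → recs (B ++ new ∷ B′) ≡ recs (B ++ B′)
    recs-new []         B′ = ≡.refl
    recs-new (used ∷ B) B′ = recs-new B B′
    recs-new (new ∷ B)  B′ = recs-new B B′
    recs-new (rec ∷ B)  B′ = ≡.cong suc (recs-new B B′)
  deletion z (suc n) = record
    { below = λ B B′ A → combine (downΣ-below B B′ A) (upΣ-below B B′ A)
    ; above = λ B A A′ → combine (downΣ-above B A A′) (upΣ-above B A A′) }
    where
    open DeletionSums z (deletion z n)
    combine : ∀ {p q r a b d} → p ≈ x * q + (1# - x) * r → a ≈ x * b + (1# - x) * d →
              p + u * a ≈ x * (q + u * b) + (1# - x) * (r + u * d)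
    combine e e′ = trans (+-comm _ _) (trans (mix u e′ e) (+-cong (*-congˡ (+-comm _ _)) (*-congˡ (+-comm _ _))))

  private
    extend : ∀ k m {a b d p q r} → a ≈ b + m * d → p ≈ q + m * r → k * a + p ≈ (k * b + q) + m * (k * d + r)
    extend k m {a} {b} {d} {p} {q} {r} e e′ = k ×[ e ] 1# ×[ e′ ]
      solve 8 (λ k m a b d p q r → ((k :* a :+ p) :+ k :* (b :+ m :* d)) :+ one :* (q :+ m :* r)
        := (((k :* b :+ q) :+ m :* (k :* d :+ r)) :+ k :* a) :+ one :* p) refl k m a b d p q r

  -- In the continuations that feel the difference, everything up to the marked value is frozen. So
  -- `B′` contributes only v for each of its minima, and the marked value serves as the implicit
  -- value 0 of `φ°`.
  Promotion : (B′ : List Entry) → State → State → Set ℓ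
  Promotion B′ φ φ° = ∀ B A → φ (B ++ rec ∷ B′) A ≈ φ (B ++ used ∷ B′) A + (v - 1#) * (v ^ᶜ recs B′) * φ° B A

  module PromotionSums (z : Carrier) {B′ φ φ°} (L : Promotion B′ φ φ°) where
    private m = (v - 1#) * (v ^ᶜ recs B′)

    downΣ-promotion : Promotion B′ (downΣ z φ) (downΣ 0# φ°)
    -- From here on the letter is the marked value or lies below it, which erases the difference
    -- between `rec` and `used`; correspondingly z = 0 removes the letter 0 of `φ°`.
    downΣ-promotion []      A = solve 4 (λ a m x b → a := a :+ m :* (x :* nil :* b)) refl _ m x (φ° [] A)
    downΣ-promotion (e ∷ B) A = extend (wt e) m (L (rec ∷ B) A) (downΣ-promotion B (demote e ∷ A))

    upΣ-promotion : Promotion B′ (upΣ φ) (upΣ φ°)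
    upΣ-promotion B []      = solve 1 (λ m → nil := nil :+ m :* nil) refl m
    upΣ-promotion B (e ∷ A) = extend (wt e) m (L (rec ∷ B) (A ++ new ∷ [])) (upΣ-promotion (demote e ∷ B) A)

  -- A current right-to-left minimum is lost exactly when the continuation goes down to it or below; otherwise the
  -- letters up to it are never visited again, which is the process with z = 0.
  promotion : ∀ z B′ n → Promotion B′ (Φ z n) (Φ 0# n)
  promotion z B′ zero B A = go B
    where
    go : ∀ B → v ^ᶜ recs (B ++ rec ∷ B′) ≈ v ^ᶜ recs (B ++ used ∷ B′) + (v - 1#) * (v ^ᶜ recs B′) * v ^ᶜ recs B
    go []         = solve 2 (λ v w → w :* v := w :+ (v :- one) :* w :* one) refl v (v ^ᶜ recs B′)
    go (used ∷ B) = go B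
    go (new ∷ B)  = go B
    go (rec ∷ B)  = v ×[ go B ] solve 5 (λ v a b w d → a :* v :+ v :* (b :+ (v :- one) :* w :* d)
      := (b :* v :+ (v :- one) :* w :* (d :* v)) :+ v :* a) refl v _ _ (v ^ᶜ recs B′) _
  promotion z B′ (suc n) B A = u ×[ upΣ-promotion B A ] 1# ×[ downΣ-promotion B A ]
    solve 8 (λ u m a b d p q r → ((a :+ u :* p) :+ u :* (q :+ m :* r)) :+ one :* (b :+ m :* d)
      := (((b :+ u :* q) :+ m :* (d :+ u :* r)) :+ u :* p) :+ one :* a)
      refl u ((v - 1#) * (v ^ᶜ recs B′)) _ _ _ _ _ _
    where open PromotionSums z {B′} {Φ z n} {Φ 0# n} (promotion z B′ n)

-- The generating series of the process and their relations.

module ProcessSeries {c ℓ} (R : CommutativeRing c ℓ) (x u v : CommutativeRing.Carrier R) where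
  open CommutativeRing R
  open Series R
  open PowerSeries R
  open Process R x u v
  open LinearCombination R
  open import Relation.Binary.Reasoning.Setoid setoid
  private module S = CommutativeRing seriesRing

  recs-used : ∀ i → recs (replicate i used) ≡ 0
  recs-used zero    = ≡.refl
  recs-used (suc i) = recs-used i

  replicate-∷ʳ : ∀ l (e : Entry) → replicate l e ++ e ∷ [] ≡ replicate (suc l) e
  replicate-∷ʳ zero    e = ≡.refl
  replicate-∷ʳ (suc l) e = ≡.cong (e ∷_) (replicate-∷ʳ l e)

  recs-rec : ∀ i → recs (replicate i rec) ≡ i
  recs-rec zero    = ≡.refl
  recs-rec (suc i) = ≡.cong suc (recs-rec i)

  t-step : ∀ {f g k : PS} → f 0 ≈ g 0 → (∀ n → f (suc n) ≈ g (suc n) + k n) → f ≋ (g ⊕ tt ⊗ k)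
  t-step {k = k} e e′ .at zero    = trans e (trans (sym (+-identityʳ _)) (+-congˡ (sym (tt-zero k))))
  t-step {k = k} e e′ .at (suc n) = trans (e′ n) (+-congˡ (sym (tt-suc k n)))

  ĉ-difference : ∀ a b → (ĉ a ⊖ ĉ b) ≋ ĉ (a - b)
  ĉ-difference a b .at zero    = refl
  ĉ-difference a b .at (suc n) = -‿inverseʳ 0#

  ĉ-⊖-⊗ : ∀ a b f n → ((ĉ a ⊖ ĉ b) ⊗ f) n ≈ (a - b) * f n
  ĉ-⊖-⊗ a b f n = trans (at (⊗-cong {g = f} (ĉ-difference a b) S.refl) n) (ĉ-⊗ (a - b) f n)

  ĉ-* : ∀ a b → ĉ (a * b) ≋ (ĉ a ⊗ ĉ b)
  ĉ-* a b .at zero    = sym (ĉ-⊗ a (ĉ b) 0)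
  ĉ-* a b .at (suc n) = sym (trans (ĉ-⊗ a (ĉ b) (suc n)) (zeroʳ a))

  ĉ-ĉ-⊗ : ∀ a b f n → (ĉ a ⊗ ĉ b ⊗ f) n ≈ a * b * f n
  ĉ-ĉ-⊗ a b f n = trans (at (⊗-cong {g = f} (S.sym (ĉ-* a b)) S.refl) n) (ĉ-⊗ (a * b) f n)

  module Family (z : Carrier) where
    X D : ℕ → ℕ → PS
    X i l n = Φ z n (replicate i used) (replicate l used)
    D i l n = downΣ z (Φ z n) (replicate i used) (replicate l used)

    a Up : ℕ → PS
    a = X 0
    Up m n = upΣ (Φ z n) [] (replicate m used)

    -- Deletion at the top of the word. It trades the new value appended by an ascent for used ones,
    -- which keeps the two-index family closed under upward moves.
    append-new : ∀ n B l → x * Φ z n B (replicate l used ++ new ∷ [])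
                         ≈ Φ z n B (replicate (suc l) used) - (1# - x) * Φ z n B (replicate l used)
    append-new n B l = - 1# ×[ deleted ]
      solve 4 (λ x a b c → x :* a :+ (:- one) :* (x :* a :+ (one :- x) :* c)
         := (b :- (one :- x) :* c) :+ (:- one) :* b) refl x _ _ _
      where
      deleted : Φ z n B (replicate (suc l) used)
              ≈ x * Φ z n B (replicate l used ++ new ∷ []) + (1# - x) * Φ z n B (replicate l used)
      deleted = begin
        Φ z n B (replicate (suc l) used)         ≡⟨ ≡.cong (Φ z n B) (replicate-∷ʳ l used) ⟨
        Φ z n B (replicate l used ++ used ∷ [])  ≈⟨ Deletion.above (deletion z n) B (replicate l used) [] ⟩
        x * Φ z n B (replicate l used ++ new ∷ []) + (1# - x) * Φ z n B (replicate l used ++ [])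
          ≡⟨ ≡.cong (λ A → x * Φ z n B (replicate l used ++ new ∷ []) + (1# - x) * Φ z n B A)
               (Listₚ.++-identityʳ (replicate l used)) ⟩
        x * Φ z n B (replicate l used ++ new ∷ []) + (1# - x) * Φ z n B (replicate l used) ∎

    -- The values below are used and not minima, so the power of v in the promotion rule is 1 and
    -- the correction is independent of i.
    promoted : ∀ n i A → Φ z n (rec ∷ replicate i used) A
                       ≈ Φ z n (used ∷ replicate i used) A + (v - 1#) * Φ 0# n [] A
    promoted n i A = trans (promotion z (replicate i used) n [] A)
      (+-congˡ (*-congʳ (trans (*-congˡ (reflexive (≡.cong (v ^ᶜ_) (recs-used i)))) (*-identityʳ _))))

    a-rec : ∀ m → a m S.≈ ĉ 1# S.+ tt S.* (ĉ x S.* ĉ z S.* a m S.+ ĉ u S.* Up m)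
    a-rec m = t-step refl λ n → trans (+-cong (sym (ĉ-ĉ-⊗ x z (a m) n)) (sym (ĉ-⊗ u (Up m) n))) (sym (+-identityˡ _))

    Up-zero : Up 0 S.≈ S.0#
    Up-zero .at n = sym (ĉ0≈0 n)

    down-zero : ∀ l → D 0 l S.≈ ĉ x S.* ĉ z S.* X 0 l
    down-zero l .at n = sym (ĉ-ĉ-⊗ x z (a l) n)

    down : ∀ i → X i 0 S.≈ ĉ 1# S.+ tt S.* D i 0
    down i = t-step (reflexive (≡.cong (v ^ᶜ_) (recs-used i))) λ n →
      trans (+-congˡ (zeroʳ u)) (trans (+-identityʳ _) (sym (+-identityˡ _)))

  open Family public using (X; D; a; Up)

  a° : ℕ → PS
  a° = a 0#

  module _ (z : Carrier) where
    open Family z using (append-new; promoted)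

    down-suc : ∀ i l → D z (suc i) l S.≈ (ĉ x S.* X z (suc i) l S.+ (ĉ v S.- ĉ 1#) S.* (ĉ x S.* a° l)) S.+ D z i (suc l)
    down-suc i l .at n = +-congʳ (begin
      x * Φ z n (rec ∷ replicate i used) (replicate l used)
        ≈⟨ *-congˡ (promoted n i (replicate l used)) ⟩
      x * (X z (suc i) l n + (v - 1#) * a° l n)
        ≈⟨ solve 4 (λ x a k b → x :* (a :+ k :* b) := x :* a :+ k :* (x :* b)) refl x _ (v - 1#) _ ⟩
      x * X z (suc i) l n + (v - 1#) * (x * a° l n)
        ≈⟨ +-cong (ĉ-⊗ x (X z (suc i) l) n) (trans (ĉ-⊖-⊗ v 1# (ĉ x ⊗ a° l) n) (*-congˡ (ĉ-⊗ x (a° l) n))) ⟨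
      (ĉ x ⊗ X z (suc i) l) n + ((ĉ v ⊖ ĉ 1#) ⊗ (ĉ x ⊗ a° l)) n ∎)

    -- Both words admit the same next letters with the same outcome, except for the crossed value:
    -- reached from (i + 1, l) it is no ascent, reached from (i, l + 1) it is one and appends a new
    -- value on top. The bracket is the difference of these two moves, brought back into the family
    -- by promotion and deletion.
    gap : ∀ i l → X z (suc i) l S.≈ X z i (suc l) S.+ tt S.*
           ((ĉ x S.* X z (suc i) l S.+ (ĉ v S.- ĉ 1#) S.* (ĉ x S.* a° l))
             S.- ĉ u S.* ((X z (suc i) (suc l) S.- (ĉ 1# S.- ĉ x) S.* X z (suc i) l)
                        S.+ (ĉ v S.- ĉ 1#) S.* (a° (suc l) S.- (ĉ 1# S.- ĉ x) S.* a° l)))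
    gap i l = t-step refl λ n →
      let φ = Φ z n ; B = replicate i used ; A = replicate l used
          dn = downΣ z φ B (used ∷ A) ; U = upΣ φ (used ∷ B) A
          h = φ (rec ∷ B) A ; h′ = φ (rec ∷ B) (A ++ new ∷ [])
      in begin
      (x * h + dn) + u * U
        ≈⟨ solve 6 (λ x u h d U h′ → (x :* h :+ d) :+ u :* U
              := (d :+ u :* (x :* h′ :+ U)) :+ (x :* h :- u :* (x :* h′))) refl x u h dn U h′ ⟩
      (dn + u * (x * h′ + U)) + (x * h - u * (x * h′))
        ≈⟨ +-congˡ (+-cong (hook n i l) (-‿cong (*-congˡ (hook′ n i l)))) ⟩
      (dn + u * (x * h′ + U)) + ((x * X z (suc i) l n + (v - 1#) * (x * a° l n))
          - u * ((X z (suc i) (suc l) n - (1# - x) * X z (suc i) l n) + (v - 1#) * (a° (suc l) n - (1# - x) * a° l n)))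
        ≈⟨ +-congˡ (+-cong (+-cong (ĉ-⊗ x (X z (suc i) l) n) (trans (ĉ-⊖-⊗ v 1# (ĉ x ⊗ a° l) n) (*-congˡ (ĉ-⊗ x (a° l) n))))
             (-‿cong (trans (ĉ-⊗ u (difference (X z (suc i)) S.+ (ĉ v S.- ĉ 1#) S.* difference a°) n)
               (*-congˡ (+-cong (+-congˡ (-‿cong (ĉ-⊖-⊗ 1# x (X z (suc i) l) n)))
               (trans (ĉ-⊖-⊗ v 1# (difference a°) n) (*-congˡ (+-congˡ (-‿cong (ĉ-⊖-⊗ 1# x (a° l) n)))))))))) ⟨
      _ ∎
      where
      difference : (ℕ → PS) → PS
      difference f = f (suc l) S.- (ĉ 1# S.- ĉ x) S.* f l
      hook : ∀ n i l → x * Φ z n (rec ∷ replicate i used) (replicate l used)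
                     ≈ x * X z (suc i) l n + (v - 1#) * (x * a° l n)
      hook n i l = trans (*-congˡ (promoted n i (replicate l used)))
        (solve 4 (λ x a k b → x :* (a :+ k :* b) := x :* a :+ k :* (x :* b)) refl x _ (v - 1#) _)
      hook′ : ∀ n i l → x * Φ z n (rec ∷ replicate i used) (replicate l used ++ new ∷ [])
                      ≈ (X z (suc i) (suc l) n - (1# - x) * X z (suc i) l n)
                        + (v - 1#) * (a° (suc l) n - (1# - x) * a° l n)
      hook′ n i l = begin
        x * Φ z n (rec ∷ replicate i used) (replicate l used ++ new ∷ [])
          ≈⟨ *-congˡ (promoted n i _) ⟩
        x * (Φ z n (replicate (suc i) used) (replicate l used ++ new ∷ []) + (v - 1#) * Φ 0# n [] (replicate l used ++ new ∷ []))
          ≈⟨ solve 4 (λ x a k b → x :* (a :+ k :* b) := x :* a :+ k :* (x :* b)) refl x _ (v - 1#) _ ⟩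
        x * Φ z n (replicate (suc i) used) (replicate l used ++ new ∷ []) + (v - 1#) * (x * Φ 0# n [] (replicate l used ++ new ∷ []))
          ≈⟨ +-cong (append-new n _ l) (*-congˡ (Family.append-new 0# n [] l)) ⟩
        (X z (suc i) (suc l) n - (1# - x) * X z (suc i) l n) + (v - 1#) * (a° (suc l) n - (1# - x) * a° l n) ∎

    -- Accumulates the promotion corrections that arise because the values below the current letter
    -- are minima in a run, whereas an upward move from 0 leaves them merely used.
    Θ : ℕ → PS
    Θ zero    n = 0#
    Θ (suc m) n = v * Θ m n + (v - 1#) * Up 0# m n

    Θ-zero : Θ 0 S.≈ S.0#
    Θ-zero .at n = sym (ĉ0≈0 n)

    Θ-suc : ∀ m → Θ (suc m) S.≈ ĉ v S.* Θ m S.+ (ĉ v S.- ĉ 1#) S.* Up 0# m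
    Θ-suc m .at n = sym (+-cong (ĉ-⊗ v (Θ m) n) (ĉ-⊖-⊗ v 1# (Up 0# m) n))

    -- After the run 0 1 ... j the sequence stops or leaves the run by a letter at most j. The only
    -- larger admissible letter is j + 1, which is the single `new`.
    E : ℕ → PS
    E j zero    = v ^ᶜ j
    E j (suc n) = downΣ z (Φ z n) (replicate j rec) (new ∷ [])

    pw : ℕ → PS
    pw m = ĉ (v ^ᶜ m)

    pw-suc : ∀ m → pw (suc m) S.≈ ĉ v S.* pw m
    pw-suc m = S.trans (ĉ-* (v ^ᶜ m) v) (⊗-comm (pw m) (ĉ v))

    private
      module _ (n : ℕ) where
        φ : State
        φ = Φ z n

        -- Falling from a run onto a value c and rising to c from the letter 0 give the same word
        -- above c: the value on top of the run plays the part of the `new` appended by the ascent.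
        -- Only below c do they differ, where the run leaves minima.
        ascending : ℕ → ℕ → Carrier
        ascending i zero    = 0#
        ascending i (suc l) = x * φ (replicate (suc i) rec) (replicate l used ++ new ∷ []) + ascending (suc i) l

        descending : ∀ i l → downΣ z φ (replicate i rec) (replicate l used ++ new ∷ []) + ascending i l
                   ≈ x * z * φ [] (replicate (i ℕ.+ l) used ++ new ∷ []) + ascending 0 (i ℕ.+ l)
        descending zero    l = refl
        descending (suc i) l = begin
          (x * h + dn) + ascending (suc i) l ≈⟨ solve 3 (λ h d a → (h :+ d) :+ a := d :+ (h :+ a)) refl _ _ _ ⟩
          dn + ascending i (suc l)           ≈⟨ descending i (suc l) ⟩
          x * z * φ [] (replicate (i ℕ.+ suc l) used ++ new ∷ []) + ascending 0 (i ℕ.+ suc l)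
            ≡⟨ ≡.cong (λ k → x * z * φ [] (replicate k used ++ new ∷ []) + ascending 0 k) (ℕₚ.+-suc i l) ⟩
          x * z * φ [] (replicate (suc i ℕ.+ l) used ++ new ∷ []) + ascending 0 (suc i ℕ.+ l) ∎
          where h = φ (replicate (suc i) rec) (replicate l used ++ new ∷ [])
                dn = downΣ z φ (replicate i rec) (replicate (suc l) used ++ new ∷ [])

        -- Each value passed costs one promotion from `used` to `rec`, above i values that are
        -- minima already; the corrections add up by the recursion of `Θ`, scaled by v^i.
        ascending-eq : ∀ i l → ascending i l ≈ upΣ φ (replicate i rec) (replicate l used) + v ^ᶜ i * Θ l n
        ascending-eq i zero    = solve 1 (λ w → nil := nil :+ w :* nil) refl (v ^ᶜ i)
        ascending-eq i (suc l) = 1# ×[ ascending-eq (suc i) l ] 1# ×[ promotedUp ]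
          solve 9 (λ h a b c w v Θ U a′ →
            let k = v :- one in
            ((h :+ a) :+ one :* (b :+ w :* v :* Θ)) :+ one :* (c :+ k :* w :* U)
            := (((h :+ c) :+ w :* (v :* Θ :+ k :* U)) :+ one :* a) :+ one :* b)
            refl (x * φ (replicate (suc i) rec) (replicate l used ++ new ∷ []))
                 (ascending (suc i) l) (upΣ φ (replicate (suc i) rec) (replicate l used))
                 (upΣ φ (used ∷ replicate i rec) (replicate l used)) (v ^ᶜ i) v (Θ l n) (Up 0# l n) 0#
          where
          promotedUp : upΣ φ (replicate (suc i) rec) (replicate l used)
                     ≈ upΣ φ (used ∷ replicate i rec) (replicate l used) + (v - 1#) * v ^ᶜ i * Up 0# l n
          promotedUp = trans
            (PromotionSums.upΣ-promotion z {replicate i rec} {φ} {Φ 0# n} (promotion z (replicate i rec) n) [] (replicate l used))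
            (+-congˡ (*-congʳ (*-congˡ (reflexive (≡.cong (v ^ᶜ_) (recs-rec i))))))

    E-eq : ∀ m → E m S.≈ pw m S.+ tt S.* (ĉ z S.* (a z (suc m) S.- (ĉ 1# S.- ĉ x) S.* a z m) S.+ Up z m S.+ Θ m)
    E-eq m = t-step refl λ n → begin
      downΣ z (Φ z n) (replicate m rec) (new ∷ [])
        ≈⟨ +-identityʳ _ ⟨
      downΣ z (Φ z n) (replicate m rec) (new ∷ []) + 0#
        ≈⟨ descending n m 0 ⟩
      x * z * Φ z n [] (replicate (m ℕ.+ 0) used ++ new ∷ []) + ascending n 0 (m ℕ.+ 0)
        ≡⟨ ≡.cong (λ k → x * z * Φ z n [] (replicate k used ++ new ∷ []) + ascending n 0 k) (ℕₚ.+-identityʳ m) ⟩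
      x * z * Φ z n [] (replicate m used ++ new ∷ []) + ascending n 0 m
        ≈⟨ +-cong (solve 3 (λ x z a → x :* z :* a := z :* (x :* a)) refl x z _) (ascending-eq n 0 m) ⟩
      z * (x * Φ z n [] (replicate m used ++ new ∷ [])) + (Up z m n + 1# * Θ m n)
        ≈⟨ +-congʳ (*-congˡ (append-new n [] m)) ⟩
      z * (a z (suc m) n - (1# - x) * a z m n) + (Up z m n + 1# * Θ m n)
        ≈⟨ solve 3 (λ p q r → p :+ (q :+ one :* r) := nil :+ ((p :+ q) :+ r)) refl _ _ _ ⟩
      0# + ((z * (a z (suc m) n - (1# - x) * a z m n) + Up z m n) + Θ m n)
        ≈⟨ +-congˡ (+-congʳ (+-congʳ (trans (ĉ-⊗ z (a z (suc m) S.- (ĉ 1# S.- ĉ x) S.* a z m) n)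
             (*-congˡ (+-congˡ (-‿cong (ĉ-⊖-⊗ 1# x (a z m) n))))))) ⟨
      _ ∎

    run : Carrier → ℕ → PS
    run y j zero    = v ^ᶜ j
    run y j (suc n) = E j (suc n) + y * u * run y (suc j) n

    run-rec : ∀ y j → run y j S.≈ E j S.+ tt S.* (ĉ u S.* ĉ y S.* run y (suc j))
    run-rec y j = t-step refl λ n → +-congˡ (sym (begin
      (ĉ u ⊗ ĉ y ⊗ run y (suc j)) n    ≈⟨ ĉ-ĉ-⊗ u y (run y (suc j)) n ⟩
      u * y * run y (suc j) n          ≈⟨ *-congʳ (*-comm u y) ⟩
      y * u * run y (suc j) n          ∎))

-- The statistics under appending a letter.

module Statistics where
  open import Data.Bool.Base using (not; _∨_; T)
  open import Data.Empty using (⊥-elim)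
  open import Data.List.Base using (filter; deduplicate; take)
  open import Data.Nat.Base using (_+_)
  open import Data.Unit.Base using (tt)
  open import Relation.Binary.Definitions using (tri<; tri≈; tri>)
  open import Relation.Binary.PropositionalEquality using (refl; sym; trans; cong; cong₂; subst; module ≡-Reasoning)
  open import Relation.Nullary using (¬?)

  indicator : Bool → ℕ
  indicator b = if b then 1 else 0

  ≡ᵇ-refl : ∀ n → (n ≡ᵇ n) ≡ true
  ≡ᵇ-refl zero    = refl
  ≡ᵇ-refl (suc n) = ≡ᵇ-refl n

  <ᵇ-true : ∀ {m n} → m < n → (m <ᵇ n) ≡ true
  <ᵇ-true {m} {n} m<n with m <ᵇ n | ℕₚ.<⇒<ᵇ m<n
  ... | true | _ = refl

  <ᵇ-false : ∀ {m n} → n ≤ m → (m <ᵇ n) ≡ false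
  <ᵇ-false {m} {n} n≤m with m <ᵇ n | ℕₚ.<ᵇ⇒< m n
  ... | true  | f = ⊥-elim (ℕₚ.<⇒≱ (f tt) n≤m)
  ... | false | _ = refl

  ≤ᵇ-true : ∀ {m n} → m ≤ n → (m ≤ᵇ n) ≡ true
  ≤ᵇ-true {zero}  _   = refl
  ≤ᵇ-true {suc m} m<n = <ᵇ-true m<n

  ≤ᵇ-false : ∀ {m n} → n < m → (m ≤ᵇ n) ≡ false
  ≤ᵇ-false {suc m} (s≤s n≤m) = <ᵇ-false n≤m

  ≡ᵇ-false : ∀ {m n} → m < n → (m ≡ᵇ n) ≡ false
  ≡ᵇ-false {zero}  {suc n} _       = refl
  ≡ᵇ-false {suc m} {suc n} (s≤s p) = ≡ᵇ-false p

  filterᵇ-∷ʳ : ∀ {ℓ} {A : Set ℓ} (p : A → Bool) l a → filterᵇ p (l ∷ʳ a) ≡ filterᵇ p l ++ (if p a then [ a ] else [])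
  filterᵇ-∷ʳ p [] a with p a
  ... | true  = refl
  ... | false = refl
  filterᵇ-∷ʳ p (b ∷ l) a with p b
  ... | true  = cong (b ∷_) (filterᵇ-∷ʳ p l a)
  ... | false = filterᵇ-∷ʳ p l a

  filterᵇ-accept : ∀ (p : ℕ → Bool) a l → p a ≡ true → filterᵇ p (a ∷ l) ≡ a ∷ filterᵇ p l
  filterᵇ-accept p a l e rewrite e = refl

  filterᵇ-reject : ∀ (p : ℕ → Bool) a l → p a ≡ false → filterᵇ p (a ∷ l) ≡ filterᵇ p l
  filterᵇ-reject p a l e rewrite e = refl

  filterᵇ-≗ : ∀ {p q : ℕ → Bool} → (∀ n → p n ≡ q n) → ∀ l → filterᵇ p l ≡ filterᵇ q l
  filterᵇ-≗ e [] = refl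
  filterᵇ-≗ {p} {q} e (a ∷ l) rewrite e a with q a
  ... | true  = cong (a ∷_) (filterᵇ-≗ e l)
  ... | false = filterᵇ-≗ e l

  filterᵇ-filterᵇ : ∀ (p q : ℕ → Bool) l → filterᵇ p (filterᵇ q l) ≡ filterᵇ (λ n → q n ∧ p n) l
  filterᵇ-filterᵇ p q [] = refl
  filterᵇ-filterᵇ p q (a ∷ l) with q a
  ... | false = filterᵇ-filterᵇ p q l
  ... | true with p a
  ...   | true  = cong (a ∷_) (filterᵇ-filterᵇ p q l)
  ...   | false = filterᵇ-filterᵇ p q l

  map-filterᵇ : ∀ (p : ℕ → Bool) (f : ℕ → ℕ) l → map f (filterᵇ (p ∘ f) l) ≡ filterᵇ p (map f l)
  map-filterᵇ p f [] = refl
  map-filterᵇ p f (a ∷ l) with p (f a)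
  ... | true  = cong (f a ∷_) (map-filterᵇ p f l)
  ... | false = map-filterᵇ p f l

  upTo-suc : ∀ n → upTo (suc n) ≡ upTo n ∷ʳ n
  upTo-suc n = sym (Listₚ.upTo-∷ʳ n)

  filterᵇ-upTo : ∀ (p : ℕ → Bool) n → filterᵇ p (upTo (suc n)) ≡ filterᵇ p (upTo n) ++ (if p n then [ n ] else [])
  filterᵇ-upTo p n = trans (cong (filterᵇ p) (upTo-suc n)) (filterᵇ-∷ʳ p (upTo n) n)

  filterᵇ-upTo-cong : ∀ (p q : ℕ → Bool) n → (∀ i → i < n → p i ≡ q i) → filterᵇ p (upTo n) ≡ filterᵇ q (upTo n)
  filterᵇ-upTo-cong p q zero    e = refl
  filterᵇ-upTo-cong p q (suc n) e = trans (filterᵇ-upTo p n) (trans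
    (cong₂ (λ l b → l ++ (if b then [ n ] else []))
      (filterᵇ-upTo-cong p q n (λ i i<n → e i (ℕₚ.m<n⇒m<1+n i<n))) (e n (ℕₚ.n<1+n n)))
    (sym (filterᵇ-upTo q n)))

  filterᵇ-upTo-suc : ∀ (p q : ℕ → Bool) n → (∀ i → i < n → p i ≡ q i) →
                     filterᵇ p (upTo (suc n)) ≡ filterᵇ q (upTo n) ++ (if p n then [ n ] else [])
  filterᵇ-upTo-suc p q n e =
    trans (filterᵇ-upTo p n) (cong (_++ (if p n then [ n ] else [])) (filterᵇ-upTo-cong p q n e))

  filterᵇ-bounded : ∀ (p : ℕ → Bool) {f g : ℕ → ℕ} n → (∀ i → i < n → f i ≡ g i) →
                    map f (filterᵇ p (upTo n)) ≡ map g (filterᵇ p (upTo n))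
  filterᵇ-bounded p zero    e = refl
  filterᵇ-bounded p {f} {g} (suc n) e = begin
    map f (filterᵇ p (upTo (suc n)))     ≡⟨ cong (map f) (filterᵇ-upTo p n) ⟩
    map f (filterᵇ p (upTo n) ++ end)    ≡⟨ Listₚ.map-++ f (filterᵇ p (upTo n)) end ⟩
    map f (filterᵇ p (upTo n)) ++ map f end
      ≡⟨ cong₂ _++_ (filterᵇ-bounded p n (λ i i<n → e i (ℕₚ.m<n⇒m<1+n i<n))) last ⟩
    map g (filterᵇ p (upTo n)) ++ map g end ≡⟨ Listₚ.map-++ g (filterᵇ p (upTo n)) end ⟨
    map g (filterᵇ p (upTo n) ++ end)    ≡⟨ cong (map g) (filterᵇ-upTo p n) ⟨
    map g (filterᵇ p (upTo (suc n)))     ∎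
    where
    open ≡-Reasoning
    end = if p n then [ n ] else []
    last : map f end ≡ map g end
    last with p n
    ... | true  = cong [_] (e n (ℕₚ.n<1+n n))
    ... | false = refl

  allB-∷ʳ : ∀ (p : ℕ → Bool) l a → allB p (l ∷ʳ a) ≡ allB p l ∧ p a
  allB-∷ʳ p [] a with p a
  ... | true  = refl
  ... | false = refl
  allB-∷ʳ p (b ∷ l) a with p b
  ... | true  = allB-∷ʳ p l a
  ... | false = refl

  allB-upTo : ∀ p n → allB p (upTo (suc n)) ≡ allB p (upTo n) ∧ p n
  allB-upTo p n = trans (cong (allB p) (upTo-suc n)) (allB-∷ʳ p (upTo n) n)

  allB-upTo-cong : ∀ (p q : ℕ → Bool) n → (∀ i → i < n → p i ≡ q i) → allB p (upTo n) ≡ allB q (upTo n)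
  allB-upTo-cong p q zero    e = refl
  allB-upTo-cong p q (suc n) e = trans (allB-upTo p n) (trans
    (cong₂ _∧_ (allB-upTo-cong p q n (λ i i<n → e i (ℕₚ.m<n⇒m<1+n i<n))) (e n (ℕₚ.n<1+n n)))
    (sym (allB-upTo q n)))

  allB-upTo-true : ∀ n → allB (λ _ → true) (upTo n) ≡ true
  allB-upTo-true zero    = refl
  allB-upTo-true (suc n) = trans (allB-upTo (λ _ → true) n) (cong (_∧ true) (allB-upTo-true n))

  length-∷ʳ : ∀ (s : List ℕ) a → length (s ∷ʳ a) ≡ suc (length s)
  length-∷ʳ s a = trans (Listₚ.length-++ s) (ℕₚ.+-comm (length s) 1)

  nth-∷ʳ-< : ∀ s a p → p < length s → nth (s ∷ʳ a) p ≡ nth s p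
  nth-∷ʳ-< (b ∷ s) a zero    _       = refl
  nth-∷ʳ-< (b ∷ s) a (suc p) (s≤s q) = nth-∷ʳ-< s a p q

  nth-∷ʳ-end : ∀ s a → nth (s ∷ʳ a) (length s) ≡ a
  nth-∷ʳ-end []      a = refl
  nth-∷ʳ-end (b ∷ s) a = nth-∷ʳ-end s a

  take-∷ʳ-≤ : ∀ s (a : ℕ) p → p ≤ length s → take p (s ∷ʳ a) ≡ take p s
  take-∷ʳ-≤ s       a zero    _       = refl
  take-∷ʳ-≤ (b ∷ s) a (suc p) (s≤s q) = cong (b ∷_) (take-∷ʳ-≤ s a p q)

  elem : ℕ → List ℕ → Bool
  elem a []      = false
  elem a (b ∷ l) = (b ≡ᵇ a) ∨ elem a l

  elem-∷ʳ : ∀ c l a → elem c (l ∷ʳ a) ≡ elem c l ∨ (a ≡ᵇ c)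
  elem-∷ʳ c []      a = Boolₚ.∨-identityʳ (a ≡ᵇ c)
  elem-∷ʳ c (b ∷ l) a = trans (cong ((b ≡ᵇ c) ∨_) (elem-∷ʳ c l a)) (sym (Boolₚ.∨-assoc (b ≡ᵇ c) (elem c l) (a ≡ᵇ c)))

  dedup : List ℕ → List ℕ
  dedup = deduplicate ℕₚ._≟_

  filter-≢ : ∀ a l → filter (λ b → ¬? (a ℕₚ.≟ b)) l ≡ filterᵇ (λ b → not (a ≡ᵇ b)) l
  filter-≢ a [] = refl
  filter-≢ a (b ∷ l) with a ≡ᵇ b
  ... | true  = filter-≢ a l
  ... | false = cong (b ∷_) (filter-≢ a l)

  dedup-∷ : ∀ a l → dedup (a ∷ l) ≡ a ∷ filterᵇ (λ b → not (a ≡ᵇ b)) (dedup l)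
  dedup-∷ a l = cong (a ∷_) (filter-≢ a (dedup l))

  -- `deduplicate` keeps first occurrences, so a letter at the end never disturbs the earlier ones.
  dedup-∷ʳ : ∀ l a → dedup (l ∷ʳ a) ≡ dedup l ++ (if elem a l then [] else [ a ])
  dedup-∷ʳ [] a = refl
  dedup-∷ʳ (b ∷ l) a = begin
    dedup (b ∷ l ∷ʳ a)                    ≡⟨ dedup-∷ b (l ∷ʳ a) ⟩
    b ∷ others (dedup (l ∷ʳ a))           ≡⟨ cong (λ d → b ∷ others d) (dedup-∷ʳ l a) ⟩
    b ∷ others (dedup l ++ end)           ≡⟨ cong (b ∷_) (Listₚ.filter-++ _ (dedup l) end) ⟩
    (b ∷ others (dedup l)) ++ others end  ≡⟨ cong₂ _++_ (sym (dedup-∷ b l)) others-end ⟩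
    dedup (b ∷ l) ++ (if elem a (b ∷ l) then [] else [ a ]) ∎
    where
    open ≡-Reasoning
    others : List ℕ → List ℕ
    others = filterᵇ (λ c → not (b ≡ᵇ c))
    end = if elem a l then [] else [ a ]
    others-end : others end ≡ (if elem a (b ∷ l) then [] else [ a ])
    others-end with elem a l | b ≡ᵇ a in e
    ... | true  | true  = refl
    ... | true  | false = refl
    ... | false | true  rewrite e = refl
    ... | false | false rewrite e = refl

  ≡ᵇ-true : ∀ a b → (a ≡ᵇ b) ≡ true → a ≡ b
  ≡ᵇ-true a b e = ℕₚ.≡ᵇ⇒≡ a b (≡.subst T (sym e) tt)

  -- p depends on the value alone and so keeps or drops all copies of a letter together; for a
  -- dropped letter the removal of its copies is absorbed by p.
  dedup-filterᵇ : ∀ (p : ℕ → Bool) l → dedup (filterᵇ p l) ≡ filterᵇ p (dedup l)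
  dedup-filterᵇ p [] = refl
  dedup-filterᵇ p (a ∷ l) = trans (step (p a) refl) (cong (filterᵇ p) (sym (dedup-∷ a l)))
    where
    open ≡-Reasoning
    others : List ℕ → List ℕ
    others = filterᵇ (λ b → not (a ≡ᵇ b))

    absorb : p a ≡ false → ∀ b → not (a ≡ᵇ b) ∧ p b ≡ p b
    absorb pa b with a ≡ᵇ b in a≡b
    ... | false = refl
    ... | true  = sym (trans (cong p (sym (≡ᵇ-true a b a≡b))) pa)

    commute : others (filterᵇ p (dedup l)) ≡ filterᵇ p (others (dedup l))
    commute = begin
      others (filterᵇ p (dedup l))                       ≡⟨ filterᵇ-filterᵇ _ p (dedup l) ⟩
      filterᵇ (λ b → p b ∧ not (a ≡ᵇ b)) (dedup l)       ≡⟨ filterᵇ-≗ (λ b → Boolₚ.∧-comm (p b) _) (dedup l) ⟩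
      filterᵇ (λ b → not (a ≡ᵇ b) ∧ p b) (dedup l)       ≡⟨ filterᵇ-filterᵇ p _ (dedup l) ⟨
      filterᵇ p (others (dedup l))                       ∎

    step : ∀ b → p a ≡ b → dedup (filterᵇ p (a ∷ l)) ≡ filterᵇ p (a ∷ others (dedup l))
    step true pa = begin
      dedup (filterᵇ p (a ∷ l))              ≡⟨ cong dedup (filterᵇ-accept p a l pa) ⟩
      dedup (a ∷ filterᵇ p l)                ≡⟨ dedup-∷ a (filterᵇ p l) ⟩
      a ∷ others (dedup (filterᵇ p l))       ≡⟨ cong (λ d → a ∷ others d) (dedup-filterᵇ p l) ⟩
      a ∷ others (filterᵇ p (dedup l))       ≡⟨ cong (a ∷_) commute ⟩
      a ∷ filterᵇ p (others (dedup l))       ≡⟨ filterᵇ-accept p a _ pa ⟨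
      filterᵇ p (a ∷ others (dedup l))       ∎
    step false pa = begin
      dedup (filterᵇ p (a ∷ l))                       ≡⟨ cong dedup (filterᵇ-reject p a l pa) ⟩
      dedup (filterᵇ p l)                             ≡⟨ dedup-filterᵇ p l ⟩
      filterᵇ p (dedup l)                             ≡⟨ filterᵇ-≗ (absorb pa) (dedup l) ⟨
      filterᵇ (λ b → not (a ≡ᵇ b) ∧ p b) (dedup l)    ≡⟨ filterᵇ-filterᵇ p _ (dedup l) ⟨
      filterᵇ p (others (dedup l))                    ≡⟨ filterᵇ-reject p a _ pa ⟨
      filterᵇ p (a ∷ others (dedup l))                ∎

  elem-filterᵇ : ∀ a (p : ℕ → Bool) l → p a ≡ false → elem a (filterᵇ p l) ≡ false
  elem-filterᵇ a p [] e = refl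
  elem-filterᵇ a p (b ∷ l) e with p b in eq
  ... | false = elem-filterᵇ a p l e
  ... | true with b ≡ᵇ a in b≡a
  ...   | false = elem-filterᵇ a p l e
  ...   | true  with trans (sym eq) (trans (cong p (≡ᵇ-true b a b≡a)) e)
  ...     | ()

  rep-∷ʳ : ∀ s a → rep (s ∷ʳ a) ≡ rep s + indicator (elem a s)
  rep-∷ʳ s a = trans (cong₂ _∸_ (length-∷ʳ s a) (cong length (dedup-∷ʳ s a))) (step (elem a s))
    where
    step : ∀ b → suc (length s) ∸ length (dedup s ++ (if b then [] else [ a ])) ≡ rep s + indicator b
    step true  = trans (cong (λ l → suc (length s) ∸ length l) (Listₚ.++-identityʳ (dedup s)))
      (trans (ℕₚ.+-∸-assoc 1 (Listₚ.length-deduplicate ℕₚ._≟_ s)) (ℕₚ.+-comm 1 _))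
    step false = trans (cong (suc (length s) ∸_) (length-∷ʳ (dedup s) a)) (sym (ℕₚ.+-identityʳ _))

  zeroStat-∷ʳ : ∀ s a → zeroStat (s ∷ʳ a) ≡ zeroStat s + indicator (a ≡ᵇ 0)
  zeroStat-∷ʳ s a = trans (cong length (filterᵇ-∷ʳ (_≡ᵇ 0) s a))
    (trans (Listₚ.length-++ (filterᵇ (_≡ᵇ 0) s)) (cong (zeroStat s +_) (step (a ≡ᵇ 0))))
    where
    step : ∀ b → length (if b then [ a ] else []) ≡ indicator b
    step true  = refl
    step false = refl

  maxStat-∷ʳ : ∀ s a → maxStat (s ∷ʳ a) ≡ maxStat s + indicator (a ≡ᵇ length s)
  maxStat-∷ʳ s a = begin
    length (filterᵇ p′ (upTo (length (s ∷ʳ a))))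
      ≡⟨ cong (λ m → length (filterᵇ p′ (upTo m))) (length-∷ʳ s a) ⟩
    length (filterᵇ p′ (upTo (suc n)))
      ≡⟨ cong length (filterᵇ-upTo-suc p′ p n (λ i i<n → cong (_≡ᵇ i) (nth-∷ʳ-< s a i i<n))) ⟩
    length (filterᵇ p (upTo n) ++ (if p′ n then [ n ] else []))
      ≡⟨ Listₚ.length-++ (filterᵇ p (upTo n)) ⟩
    maxStat s + length (if p′ n then [ n ] else [])
      ≡⟨ cong (maxStat s +_) (trans (cong (λ m → length (if m ≡ᵇ n then [ n ] else [])) (nth-∷ʳ-end s a)) last) ⟩
    maxStat s + indicator (a ≡ᵇ n) ∎
    where
    open ≡-Reasoning
    n = length s
    p p′ : ℕ → Bool
    p  i = nth s i ≡ᵇ i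
    p′ i = nth (s ∷ʳ a) i ≡ᵇ i
    last : length (if a ≡ᵇ n then [ n ] else []) ≡ indicator (a ≡ᵇ n)
    last with a ≡ᵇ n
    ... | true  = refl
    ... | false = refl

  lastOr : ℕ → List ℕ → ℕ
  lastOr b []      = b
  lastOr b (a ∷ s) = lastOr a s

  lastOr-∷ʳ : ∀ b s a → lastOr b (s ∷ʳ a) ≡ a
  lastOr-∷ʳ b []      a = refl
  lastOr-∷ʳ b (c ∷ s) a = lastOr-∷ʳ c s a

  asc-∷ʳ : ∀ b s a → asc ((b ∷ s) ∷ʳ a) ≡ asc (b ∷ s) + indicator (lastOr b s <ᵇ a)
  asc-∷ʳ b []      a = ℕₚ.+-identityʳ _
  asc-∷ʳ b (c ∷ s) a = trans (cong (indicator (b <ᵇ c) +_) (asc-∷ʳ c s a)) (sym (ℕₚ.+-assoc (indicator (b <ᵇ c)) _ _))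

  minima : List ℕ → List ℕ
  minima s = dedup (map (nth s)
    (filterᵇ (λ p → allB (λ q → if p <ᵇ q then nth s p <ᵇ nth s q else true) (positions s)) (positions s)))

  -- The test at an old position gains one conjunct, the comparison with a, and at the last position
  -- it is vacuous. The comparison is strict, so a is not among the survivors and deduplication
  -- keeps the appended copy.
  minima-∷ʳ : ∀ s a → minima (s ∷ʳ a) ≡ filterᵇ (_<ᵇ a) (minima s) ∷ʳ a
  minima-∷ʳ s a = begin
    dedup (map (nth s′) (filterᵇ c′ (upTo (length s′))))
      ≡⟨ cong (λ n → dedup (map (nth s′) (filterᵇ (λ p → allB (test s′ p) (upTo n)) (upTo n)))) (length-∷ʳ s a) ⟩
    dedup (map (nth s′) (filterᵇ c″ (upTo (suc n))))
      ≡⟨ cong (dedup ∘ map (nth s′)) (filterᵇ-upTo-suc c″ (λ p → c p ∧ (nth s p <ᵇ a)) n old) ⟩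
    dedup (map (nth s′) (filterᵇ (λ p → c p ∧ (nth s p <ᵇ a)) (upTo n) ++ (if c″ n then [ n ] else [])))
      ≡⟨ cong (λ b → dedup (map (nth s′) (filterᵇ (λ p → c p ∧ (nth s p <ᵇ a)) (upTo n) ++ (if b then [ n ] else [])))) end ⟩
    dedup (map (nth s′) (filterᵇ (λ p → c p ∧ (nth s p <ᵇ a)) (upTo n) ∷ʳ n))
      ≡⟨ cong dedup (Listₚ.map-++ (nth s′) (filterᵇ (λ p → c p ∧ (nth s p <ᵇ a)) (upTo n)) [ n ]) ⟩
    dedup (map (nth s′) (filterᵇ (λ p → c p ∧ (nth s p <ᵇ a)) (upTo n)) ∷ʳ nth s′ n)
      ≡⟨ cong₂ (λ l b → dedup (l ∷ʳ b))
           (trans (filterᵇ-bounded (λ p → c p ∧ (nth s p <ᵇ a)) n (nth-∷ʳ-< s a)) split)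
           (nth-∷ʳ-end s a) ⟩
    dedup (filterᵇ (_<ᵇ a) L ∷ʳ a)
      ≡⟨ dedup-∷ʳ (filterᵇ (_<ᵇ a) L) a ⟩
    dedup (filterᵇ (_<ᵇ a) L) ++ (if elem a (filterᵇ (_<ᵇ a) L) then [] else [ a ])
      ≡⟨ cong₂ (λ l b → l ++ (if b then [] else [ a ])) (dedup-filterᵇ (_<ᵇ a) L)
           (elem-filterᵇ a (_<ᵇ a) L (<ᵇ-false {a} ℕₚ.≤-refl)) ⟩
    filterᵇ (_<ᵇ a) (dedup L) ∷ʳ a ∎
    where
    open ≡-Reasoning
    s′ = s ∷ʳ a
    n  = length s
    test : List ℕ → ℕ → ℕ → Bool
    test s p q = if p <ᵇ q then nth s p <ᵇ nth s q else true
    c c′ c″ : ℕ → Bool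
    c  p = allB (test s p) (upTo n)
    c′ p = allB (test s′ p) (upTo (length s′))
    c″ p = allB (test s′ p) (upTo (suc n))
    L = map (nth s) (filterᵇ c (upTo n))

    old : ∀ p → p < n → c″ p ≡ c p ∧ (nth s p <ᵇ a)
    old p p<n = trans (allB-upTo (test s′ p) n) (cong₂ _∧_
      (allB-upTo-cong (test s′ p) (test s p) n λ q q<n →
        cong₂ (λ m k → if p <ᵇ q then m <ᵇ k else true) (nth-∷ʳ-< s a p p<n) (nth-∷ʳ-< s a q q<n))
      (trans (cong (λ b → if b then nth s′ p <ᵇ nth s′ n else true) (<ᵇ-true p<n))
             (cong₂ _<ᵇ_ (nth-∷ʳ-< s a p p<n) (nth-∷ʳ-end s a))))

    end : c″ n ≡ true
    end = trans (allB-upTo (test s′ n) n) (cong₂ _∧_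
      (trans (allB-upTo-cong (test s′ n) (λ _ → true) n λ q q<n → vacuous q (ℕₚ.<⇒≤ q<n)) (allB-upTo-true n))
      (vacuous n ℕₚ.≤-refl))
      where
      vacuous : ∀ q → q ≤ n → test s′ n q ≡ true
      vacuous q q≤n = cong (λ b → if b then nth s′ n <ᵇ nth s′ q else true) (<ᵇ-false q≤n)

    split : map (nth s) (filterᵇ (λ p → c p ∧ (nth s p <ᵇ a)) (upTo n)) ≡ filterᵇ (_<ᵇ a) L
    split = trans (cong (map (nth s)) (sym (filterᵇ-filterᵇ (λ p → nth s p <ᵇ a) c (upTo n))))
                  (map-filterᵇ (_<ᵇ a) (nth s) (filterᵇ c (upTo n)))

  isAscent-∷ʳ : ∀ b s a → isAscent ((b ∷ s) ∷ʳ a) ≡ isAscent (b ∷ s) ∧ (a ≤ᵇ asc (b ∷ s) + 1)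
  isAscent-∷ʳ b s a = begin
    allB (test s₁) (upTo (length s₁))
      ≡⟨ cong (λ n → allB (test s₁) (upTo n)) (length-∷ʳ (b ∷ s) a) ⟩
    allB (test s₁) (upTo (suc n))
      ≡⟨ cong (allB (test s₁)) (upTo-suc n) ⟩
    allB (test s₁) (upTo n ∷ʳ n)
      ≡⟨ allB-∷ʳ (test s₁) (upTo n) n ⟩
    allB (test s₁) (upTo n) ∧ test s₁ n
      ≡⟨ cong₂ _∧_ (allB-upTo-cong (test s₁) (test s₀) n λ p p<n →
           cong₂ (λ m l → if p ≡ᵇ 0 then true else (m ≤ᵇ asc l + 1)) (nth-∷ʳ-< s₀ a p p<n) (take-∷ʳ-≤ s₀ a p (ℕₚ.<⇒≤ p<n)))
         (cong₂ (λ m l → m ≤ᵇ asc l + 1) (nth-∷ʳ-end s₀ a)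
           (trans (take-∷ʳ-≤ s₀ a n ℕₚ.≤-refl) (Listₚ.take-all n s₀ ℕₚ.≤-refl))) ⟩
    isAscent s₀ ∧ (a ≤ᵇ asc s₀ + 1) ∎
    where
    open ≡-Reasoning
    s₀ = b ∷ s
    s₁ = s₀ ∷ʳ a
    n  = length s₀
    test : List ℕ → ℕ → Bool
    test s p = if p ≡ᵇ 0 then true else (nth s p ≤ᵇ asc (take p s) + 1)

  isUsed : Entry → Bool
  isUsed used = true
  isUsed rec  = true
  isUsed new  = false

  below : (ℕ → Entry) → ℕ → List Entry
  below τ zero    = []
  below τ (suc l) = τ (suc l) ∷ below τ l

  above : (ℕ → Entry) → ℕ → ℕ → List Entry
  above τ l zero    = []
  above τ l (suc m) = τ (suc l) ∷ above τ (suc l) m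

  visit : (ℕ → Entry) → ℕ → ℕ → Entry
  visit τ a c = if c <ᵇ a then τ c else if c ≡ᵇ a then rec else demote (τ c)

  visit-< : ∀ τ {a c} → c < a → visit τ a c ≡ τ c
  visit-< τ c<a rewrite <ᵇ-true c<a = refl

  visit-≡ : ∀ τ a → visit τ a a ≡ rec
  visit-≡ τ a rewrite <ᵇ-false {a} ℕₚ.≤-refl | ≡ᵇ-refl a = refl

  visit-> : ∀ τ {a c} → a < c → visit τ a c ≡ demote (τ c)
  visit-> τ {a} {c} a<c rewrite <ᵇ-false (ℕₚ.<⇒≤ a<c) with c ≡ᵇ a in e
  ... | false = refl
  ... | true with refl ← ≡ᵇ-true c a e with () ← ℕₚ.<-irrefl refl a<c

  below-cong : ∀ {σ τ} l → (∀ c → c ≤ l → σ c ≡ τ c) → below σ l ≡ below τ l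
  below-cong zero    e = refl
  below-cong (suc l) e = cong₂ _∷_ (e (suc l) ℕₚ.≤-refl) (below-cong l λ c c≤l → e c (ℕₚ.m≤n⇒m≤1+n c≤l))

  above-cong : ∀ {σ τ} l m → (∀ c → l < c → σ c ≡ τ c) → above σ l m ≡ above τ l m
  above-cong l zero    e = refl
  above-cong l (suc m) e = cong₂ _∷_ (e (suc l) ℕₚ.≤-refl) (above-cong (suc l) m λ c l<c → e c (ℕₚ.<-trans (ℕₚ.n<1+n l) l<c))

  above-++ : ∀ τ l k m → above τ l (k + m) ≡ above τ l k ++ above τ (l + k) m
  above-++ τ l zero    m = cong (λ n → above τ n m) (sym (ℕₚ.+-identityʳ l))
  above-++ τ l (suc k) m = cong (τ (suc l) ∷_) (trans (above-++ τ (suc l) k m)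
    (cong (λ n → above τ (suc l) k ++ above τ n m) (sym (ℕₚ.+-suc l k))))

  above-∷ʳ : ∀ τ l k → above τ l (suc k) ≡ above τ l k ∷ʳ τ (suc (l + k))
  above-∷ʳ τ l k = trans (cong (above τ l) (ℕₚ.+-comm 1 k)) (above-++ τ l k 1)

  below-visit-< : ∀ τ {a} j → j < a → below (visit τ a) j ≡ below τ j
  below-visit-< τ j j<a = below-cong j λ c c≤j → visit-< τ (ℕₚ.≤-<-trans c≤j j<a)

  below-visit : ∀ τ a → below (visit τ (suc a)) (suc a) ≡ rec ∷ below τ a
  below-visit τ a = cong₂ _∷_ (visit-≡ τ (suc a)) (below-visit-< τ a (ℕₚ.n<1+n a))

  above-visit : ∀ τ a m → above (visit τ a) a m ≡ above (demote ∘ τ) a m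
  above-visit τ a m = above-cong a m λ c a<c → visit-> τ a<c

  recs-demote : ∀ e B → recs (demote e ∷ B) ≡ recs B
  recs-demote used B = refl
  recs-demote new  B = refl
  recs-demote rec  B = refl

  recs-visit : ∀ τ a j → a ≤ j → recs (below (visit τ a) j) ≡ recs (below (visit τ a) a)
  recs-visit τ a j a≤j = go (ℕₚ.≤⇒≤′ a≤j)
    where
    go : ∀ {j} → a ℕ.≤′ j → recs (below (visit τ a) j) ≡ recs (below (visit τ a) a)
    go (ℕ.≤′-reflexive refl) = refl
    go (ℕ.≤′-step {n} a≤′n) = trans
      (cong (λ e → recs (e ∷ below (visit τ a) n)) (visit-> τ (s≤s (ℕₚ.≤′⇒≤ a≤′n))))
      (trans (recs-demote (τ (suc n)) _) (go a≤′n))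

  -- The state of the process after the letters 0 ∷ w: τ classifies the values (in the sequence or not, current
  -- right-to-left minimum or not), l is the last letter, and the letters above l available next are l + 1, …, l + m.
  record Config (w : List ℕ) (l m : ℕ) (τ : ℕ → Entry) : Set where
    field
      last    : lastOr 0 w ≡ l
      ascents : suc (asc (0 ∷ w)) ≡ l + m
      room    : 0 < m
      member  : ∀ c → elem c (0 ∷ w) ≡ isUsed (τ c)
      noRecs  : ∀ c → l < c → demote (τ c) ≡ τ c
      -- The bound l + m = asc + 1 is included: the largest admissible letter has never occurred.
      fresh   : ∀ c → l + m ≤ c → τ c ≡ new
      -- Needed at every height j, since the next letter may cut off the minima anywhere. The
      -- successor counts the value 0, which `below` omits.
      prefix  : ∀ j → length (filterᵇ (_<ᵇ suc j) (minima (0 ∷ w))) ≡ suc (recs (below τ j))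
      whole   : length (minima (0 ∷ w)) ≡ suc (recs (below τ l))

  isUsed-demote : ∀ e → isUsed (demote e) ≡ isUsed e
  isUsed-demote used = refl
  isUsed-demote new  = refl
  isUsed-demote rec  = refl

  demote-demote : ∀ e → demote (demote e) ≡ demote e
  demote-demote used = refl
  demote-demote new  = refl
  demote-demote rec  = refl

  filterᵇ-none : ∀ l → filterᵇ (_<ᵇ 0) l ≡ []
  filterᵇ-none []          = refl
  filterᵇ-none (zero ∷ l)  = filterᵇ-none l
  filterᵇ-none (suc _ ∷ l) = filterᵇ-none l

  <ᵇ-absorb : ∀ {a b} → a ≤ b → ∀ n → (n <ᵇ a) ∧ (n <ᵇ b) ≡ (n <ᵇ a)
  <ᵇ-absorb {a} {b} a≤b n with n <ᵇ a in e
  ... | false = refl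
  ... | true  = <ᵇ-true (ℕₚ.<-≤-trans (ℕₚ.<ᵇ⇒< n a (subst T (sym e) _)) a≤b)

  module Visit {w l m τ} (C : Config w l m τ) (a m′ : ℕ)
    (ascents′ : suc (asc (0 ∷ w) + indicator (l <ᵇ a)) ≡ a + m′)
    (room′ : 0 < m′) (l+m≤a+m′ : l + m ≤ a + m′) where
    open Config C

    private
      M = minima (0 ∷ w)

      smaller : ∀ a → suc (length (filterᵇ (_<ᵇ a) M)) ≡ suc (recs (below (visit τ a) a))
      smaller zero    = cong (suc ∘ length) (filterᵇ-none M)
      smaller (suc a) = cong suc (trans (prefix a) (cong recs (sym (below-visit τ a))))

      minima′ : minima (0 ∷ (w ∷ʳ a)) ≡ filterᵇ (_<ᵇ a) M ∷ʳ a
      minima′ = minima-∷ʳ (0 ∷ w) a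

      prefix′ : ∀ j → length (filterᵇ (_<ᵇ suc j) (minima (0 ∷ (w ∷ʳ a)))) ≡ suc (recs (below (visit τ a) j))
      prefix′ j = begin
        length (filterᵇ (_<ᵇ suc j) (minima (0 ∷ (w ∷ʳ a))))
          ≡⟨ cong (length ∘ filterᵇ (_<ᵇ suc j)) minima′ ⟩
        length (filterᵇ (_<ᵇ suc j) (filterᵇ (_<ᵇ a) M ∷ʳ a))
          ≡⟨ cong length (filterᵇ-∷ʳ (_<ᵇ suc j) (filterᵇ (_<ᵇ a) M) a) ⟩
        length (filterᵇ (_<ᵇ suc j) (filterᵇ (_<ᵇ a) M) ++ (if a <ᵇ suc j then [ a ] else []))
          ≡⟨ cong (λ k → length (k ++ (if a <ᵇ suc j then [ a ] else []))) (filterᵇ-filterᵇ (_<ᵇ suc j) (_<ᵇ a) M) ⟩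
        length (filterᵇ (λ n → (n <ᵇ a) ∧ (n <ᵇ suc j)) M ++ (if a <ᵇ suc j then [ a ] else []))
          ≡⟨ split ⟩
        suc (recs (below (visit τ a) j)) ∎
        where
        open ≡-Reasoning
        both : ℕ → Bool
        both n = (n <ᵇ a) ∧ (n <ᵇ suc j)
        split : length (filterᵇ both M ++ (if a <ᵇ suc j then [ a ] else [])) ≡ suc (recs (below (visit τ a) j))
        split with ℕₚ.≤-<-connex a j
        ... | inj₁ a≤j = begin
          length (filterᵇ both M ++ (if a <ᵇ suc j then [ a ] else []))
            ≡⟨ cong (λ b → length (filterᵇ both M ++ (if b then [ a ] else []))) (<ᵇ-true (s≤s a≤j)) ⟩
          length (filterᵇ both M ∷ʳ a)          ≡⟨ length-∷ʳ (filterᵇ both M) a ⟩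
          suc (length (filterᵇ both M))         ≡⟨ cong (suc ∘ length) (filterᵇ-≗ (<ᵇ-absorb (ℕₚ.m≤n⇒m≤1+n a≤j)) M) ⟩
          suc (length (filterᵇ (_<ᵇ a) M))      ≡⟨ smaller a ⟩
          suc (recs (below (visit τ a) a))      ≡⟨ cong suc (recs-visit τ a j a≤j) ⟨
          suc (recs (below (visit τ a) j))      ∎
        ... | inj₂ j<a = begin
          length (filterᵇ both M ++ (if a <ᵇ suc j then [ a ] else []))
            ≡⟨ cong (λ b → length (filterᵇ both M ++ (if b then [ a ] else []))) (<ᵇ-false j<a) ⟩
          length (filterᵇ both M ++ [])         ≡⟨ cong length (Listₚ.++-identityʳ (filterᵇ both M)) ⟩
          length (filterᵇ both M)
            ≡⟨ cong length (filterᵇ-≗ (λ n → trans (Boolₚ.∧-comm (n <ᵇ a) _) (<ᵇ-absorb j<a n)) M) ⟩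
          length (filterᵇ (_<ᵇ suc j) M)        ≡⟨ prefix j ⟩
          suc (recs (below τ j))                ≡⟨ cong (suc ∘ recs) (below-visit-< τ j j<a) ⟨
          suc (recs (below (visit τ a) j))      ∎

      member′ : ∀ c → elem c (0 ∷ (w ∷ʳ a)) ≡ isUsed (visit τ a c)
      member′ c = trans (elem-∷ʳ c (0 ∷ w) a) (trans (cong (_∨ (a ≡ᵇ c)) (member c)) cases)
        where
        ≡ᵇ-false′ : ∀ {a c} → c < a → (a ≡ᵇ c) ≡ false
        ≡ᵇ-false′ {suc a} {zero}  _       = refl
        ≡ᵇ-false′ {suc a} {suc c} (s≤s p) = ≡ᵇ-false′ p
        cases : isUsed (τ c) ∨ (a ≡ᵇ c) ≡ isUsed (visit τ a c)
        cases with ℕₚ.<-cmp c a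
        ... | tri< c<a _ _ = trans (cong (isUsed (τ c) ∨_) (≡ᵇ-false′ c<a))
                               (trans (Boolₚ.∨-identityʳ _) (cong isUsed (sym (visit-< τ c<a))))
        ... | tri≈ _ refl _ = trans (cong (isUsed (τ c) ∨_) (≡ᵇ-refl c))
                                (trans (Boolₚ.∨-zeroʳ _) (cong isUsed (sym (visit-≡ τ c))))
        ... | tri> _ _ a<c = trans (cong (isUsed (τ c) ∨_) (≡ᵇ-false a<c))
                               (trans (Boolₚ.∨-identityʳ _)
                                 (trans (sym (isUsed-demote (τ c))) (cong isUsed (sym (visit-> τ a<c)))))

    config : Config (w ∷ʳ a) a m′ (visit τ a)
    config = record
      { last    = lastOr-∷ʳ 0 w a
      ; ascents = trans (cong suc (trans (asc-∷ʳ 0 w a) (cong (λ b → asc (0 ∷ w) + indicator (b <ᵇ a)) last))) ascents′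
      ; room    = room′
      ; member  = member′
      ; noRecs  = λ c a<c → trans (cong demote (visit-> τ a<c)) (trans (demote-demote (τ c)) (sym (visit-> τ a<c)))
      ; fresh   = λ c a+m′≤c → trans
          (visit-> τ (ℕₚ.<-≤-trans (ℕₚ.m<m+n a room′) a+m′≤c))
          (cong demote (fresh c (ℕₚ.≤-trans l+m≤a+m′ a+m′≤c)))
      ; prefix  = prefix′
      ; whole   = trans (cong length minima′) (trans (length-∷ʳ (filterᵇ (_<ᵇ a) M) a) (smaller a))
      }

  visit-down : ∀ {w l m τ} → Config w l m τ → ∀ a → a ≤ l → Config (w ∷ʳ a) a (l ∸ a + m) (visit τ a)
  visit-down {w} {l} {m} C a a≤l = Visit.config C a (l ∸ a + m)
    (trans (cong (λ b → suc (asc (0 ∷ w) + indicator b)) (<ᵇ-false a≤l))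
      (trans (cong suc (ℕₚ.+-identityʳ _)) (trans ascents (sym eq))))
    (ℕₚ.<-≤-trans room (ℕₚ.m≤n+m m (l ∸ a)))
    (ℕₚ.≤-reflexive (sym eq))
    where
    open Config C
    eq : a + (l ∸ a + m) ≡ l + m
    eq = trans (sym (ℕₚ.+-assoc a (l ∸ a) m)) (cong (_+ m) (ℕₚ.m+[n∸m]≡n a≤l))

  -- The ascent raises the largest admissible letter by one, hence m ∸ i values above instead of m ∸
  -- suc i; the additional one is the `new` that `upΣ` appends.
  visit-up : ∀ {w l m τ} → Config w l m τ → ∀ i → i < m → Config (w ∷ʳ suc (l + i)) (suc (l + i)) (m ∸ i) (visit τ (suc (l + i)))
  visit-up {w} {l} {m} C i i<m = Visit.config C (suc (l + i)) (m ∸ i)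
    (trans (cong (λ b → suc (asc (0 ∷ w) + indicator b)) (<ᵇ-true (s≤s (ℕₚ.m≤m+n l i))))
      (trans (cong suc (ℕₚ.+-comm _ 1)) (trans (cong suc ascents) (sym eq))))
    (ℕₚ.m<n⇒0<n∸m i<m)
    (ℕₚ.≤-trans (ℕₚ.n≤1+n (l + m)) (ℕₚ.≤-reflexive (sym eq)))
    where
    open Config C
    eq : suc (l + i) + (m ∸ i) ≡ suc (l + m)
    eq = cong suc (trans (ℕₚ.+-assoc l i (m ∸ i)) (cong (l +_) (ℕₚ.m+[n∸m]≡n (ℕₚ.<⇒≤ i<m))))

  start : ℕ → Entry
  start zero    = rec
  start (suc _) = new

  config-start : Config [] 0 1 start
  config-start = record
    { last = refl ; ascents = refl ; room = s≤s z≤n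
    ; member = λ { zero → refl ; (suc c) → refl }
    ; noRecs = λ { (suc c) _ → refl }
    ; fresh = λ { (suc c) _ → refl }
    ; prefix = λ j → cong suc (sym (no-recs j))
    ; whole = refl }
    where
    no-recs : ∀ j → recs (below start j) ≡ 0
    no-recs zero    = refl
    no-recs (suc j) = no-recs j

open Statistics

-- Ascent sequences enumerated by the process.

module Enumeration {c ℓ} (R : CommutativeRing c ℓ) (x y u z v : CommutativeRing.Carrier R) where
  open CommutativeRing R
  open Series R
  open PowerSeries R using (sumR-cong; sumR-0; sumR-*ˡ; sumR-head)
  open Process R x u v
  open ProcessSeries R x u v using (E; run)
  open LinearCombination R
  open import Relation.Binary.Reasoning.Setoid setoid

  sumR-split : ∀ m n f → sumR (m ℕ.+ n) f ≈ sumR m f + sumR n (λ i → f (m ℕ.+ i))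
  sumR-split m zero f = trans (reflexive (≡.cong (λ k → sumR k f) (ℕₚ.+-identityʳ m))) (sym (+-identityʳ _))
  sumR-split m (suc n) f = begin
    sumR (m ℕ.+ suc n) f                                      ≡⟨ ≡.cong (λ k → sumR k f) (ℕₚ.+-suc m n) ⟩
    sumR (m ℕ.+ n) f + f (m ℕ.+ n)                            ≈⟨ +-congʳ (sumR-split m n f) ⟩
    (sumR m f + sumR n (λ i → f (m ℕ.+ i))) + f (m ℕ.+ n)     ≈⟨ +-assoc _ _ _ ⟩
    sumR m f + sumR (suc n) (λ i → f (m ℕ.+ i))               ∎

  sumList-++ : ∀ k l → sumList (k ++ l) ≈ sumList k + sumList l
  sumList-++ []      l = sym (+-identityˡ _)
  sumList-++ (a ∷ k) l = trans (+-congˡ (sumList-++ k l)) (sym (+-assoc _ _ _))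

  -- The letters are 0, ..., asc + 1. The bound for inversion sequences does not appear because it
  -- follows: the number of ascents of 0 ∷ w is at most the length of w.
  extensions : ℕ → (List ℕ → Carrier) → List ℕ → Carrier
  extensions zero    F w = F (0 ∷ w)
  extensions (suc k) F w = sumR (suc (suc (asc (0 ∷ w)))) (λ a → extensions k F (w ∷ʳ a))

  private
    Shape : ℕ → List ℕ → Set
    Shape n s = ∃₂ λ b w → s ≡ b ∷ w Product.× length w ≡ n

    invSeqs-shape : ∀ n → All (Shape n) (invSeqs (suc n))
    invSeqs-shape zero    = (0 , [] , ≡.refl , ≡.refl) ∷ []
    invSeqs-shape (suc n) = Allₚ.concat⁺ (Allₚ.map⁺ (All.map extend (invSeqs-shape n)))
      where
      extend : ∀ {s} → Shape n s → All (Shape (suc n)) (map (λ a → s ++ [ a ]) (upTo (suc (suc n))))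
      extend (b , w , ≡.refl , ≡.refl) = Allₚ.map⁺ (All.universal (λ a → b , w ∷ʳ a , ≡.refl , length-∷ʳ w a) _)

    asc≤ : ∀ b w → asc (b ∷ w) ≤ length w
    asc≤ b []      = z≤n
    asc≤ b (a ∷ w) = ℕₚ.+-mono-≤ (indicator≤1 (b <ᵇ a)) (asc≤ a w)
      where
      indicator≤1 : ∀ c → indicator c ≤ 1
      indicator≤1 true  = s≤s z≤n
      indicator≤1 false = z≤n

    children : (List ℕ → Carrier) → List ℕ → Carrier
    children F s = sumR (suc (suc (asc s))) (λ a → F (s ∷ʳ a))

    guarded : Bool → Carrier → Carrier
    guarded b a = if b then a else 0#

    filtered-children : ∀ F s n → sumList (map F (filterᵇ isAscent (map (s ∷ʳ_) (upTo n))))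
                                ≈ sumR n (λ a → guarded (isAscent (s ∷ʳ a)) (F (s ∷ʳ a)))
    filtered-children F s zero    = refl
    filtered-children F s (suc n) = begin
      sumList (map F (filterᵇ isAscent (map (s ∷ʳ_) (upTo (suc n)))))
        ≡⟨ ≡.cong (λ l → sumList (map F (filterᵇ isAscent l)))
             (≡.trans (≡.cong (map (s ∷ʳ_)) (upTo-suc n)) (Listₚ.map-++ (s ∷ʳ_) (upTo n) [ n ])) ⟩
      sumList (map F (filterᵇ isAscent (map (s ∷ʳ_) (upTo n) ∷ʳ (s ∷ʳ n))))
        ≡⟨ ≡.cong (λ l → sumList (map F l)) (filterᵇ-∷ʳ isAscent (map (s ∷ʳ_) (upTo n)) (s ∷ʳ n)) ⟩
      sumList (map F (filterᵇ isAscent (map (s ∷ʳ_) (upTo n)) ++ end))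
        ≡⟨ ≡.cong sumList (Listₚ.map-++ F (filterᵇ isAscent (map (s ∷ʳ_) (upTo n))) end) ⟩
      sumList (map F (filterᵇ isAscent (map (s ∷ʳ_) (upTo n))) ++ map F end)
        ≈⟨ sumList-++ (map F (filterᵇ isAscent (map (s ∷ʳ_) (upTo n)))) (map F end) ⟩
      sumList (map F (filterᵇ isAscent (map (s ∷ʳ_) (upTo n)))) + sumList (map F end)
        ≈⟨ +-cong (filtered-children F s n) (last (isAscent (s ∷ʳ n))) ⟩
      sumR (suc n) (λ a → guarded (isAscent (s ∷ʳ a)) (F (s ∷ʳ a))) ∎
      where
      end = if isAscent (s ∷ʳ n) then [ s ∷ʳ n ] else []
      last : ∀ b → sumList (map F (if b then [ s ∷ʳ n ] else [])) ≈ guarded b (F (s ∷ʳ n))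
      last true  = +-identityʳ _
      last false = refl

    ascent-children : ∀ F n s → Shape n s → sumR (suc (suc n)) (λ a → guarded (isAscent (s ∷ʳ a)) (F (s ∷ʳ a)))
                                          ≈ guarded (isAscent s) (children F s)
    ascent-children F n s (b , w , ≡.refl , ≡.refl) = trans
      (sumR-cong (suc (suc n)) λ a _ → reflexive (≡.cong (λ c → guarded c (F (s ∷ʳ a))) (isAscent-∷ʳ b w a)))
      (cases (isAscent s))
      where
      A = asc s
      extra = n ∸ A
      total : suc (suc n) ≡ suc (suc A) ℕ.+ extra
      total = ≡.cong (λ k → suc (suc k)) (≡.sym (ℕₚ.m+[n∸m]≡n (asc≤ b w)))
      cases : ∀ c → sumR (suc (suc n)) (λ a → guarded (c ∧ (a ≤ᵇ A ℕ.+ 1)) (F (s ∷ʳ a))) ≈ guarded c (children F s)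
      cases false = sumR-0 (suc (suc n))
      cases true  = begin
        sumR (suc (suc n)) f                             ≡⟨ ≡.cong (λ k → sumR k f) total ⟩
        sumR (suc (suc A) ℕ.+ extra) f                   ≈⟨ sumR-split (suc (suc A)) extra f ⟩
        sumR (suc (suc A)) f + sumR extra (λ i → f (suc (suc A) ℕ.+ i))
          ≈⟨ +-cong (sumR-cong (suc (suc A)) λ a a<A+2 → reflexive (≡.cong (λ c → guarded c (F (s ∷ʳ a)))
                       (≤ᵇ-true (ℕₚ.≤-trans (ℕₚ.≤-pred a<A+2) (ℕₚ.≤-reflexive (ℕₚ.+-comm 1 A))))))
                    (trans (sumR-cong extra λ i _ → reflexive (≡.cong (λ c → guarded c (F (s ∷ʳ (suc (suc A) ℕ.+ i))))
                       (≤ᵇ-false (ℕₚ.≤-trans (ℕₚ.≤-reflexive (≡.cong suc (ℕₚ.+-comm A 1))) (ℕₚ.m≤m+n (suc (suc A)) i)))))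
                       (sumR-0 extra)) ⟩
        children F s + 0#                                ≈⟨ +-identityʳ _ ⟩
        children F s                                     ∎
        where
        f : ℕ → Carrier
        f a = guarded (a ≤ᵇ A ℕ.+ 1) (F (s ∷ʳ a))

    sum-children : ∀ F n {L} → All (Shape n) L →
      sumList (map F (filterᵇ isAscent (concatMap (λ s → map (s ∷ʳ_) (upTo (suc (suc n)))) L)))
      ≈ sumList (map (children F) (filterᵇ isAscent L))
    sum-children F n [] = refl
    sum-children F n {s ∷ L} (sh ∷ shs) = begin
      sumList (map F (filterᵇ isAscent (C ++ Cs)))
        ≡⟨ ≡.cong (λ l → sumList (map F l)) (Listₚ.filter-++ (Boolₚ.T? ∘ isAscent) C Cs) ⟩
      sumList (map F (filterᵇ isAscent C ++ filterᵇ isAscent Cs))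
        ≡⟨ ≡.cong sumList (Listₚ.map-++ F (filterᵇ isAscent C) _) ⟩
      sumList (map F (filterᵇ isAscent C) ++ map F (filterᵇ isAscent Cs))
        ≈⟨ sumList-++ (map F (filterᵇ isAscent C)) _ ⟩
      sumList (map F (filterᵇ isAscent C)) + sumList (map F (filterᵇ isAscent Cs))
        ≈⟨ +-cong (trans (filtered-children F s (suc (suc n))) (ascent-children F n s sh)) (sum-children F n shs) ⟩
      guarded (isAscent s) (children F s) + sumList (map (children F) (filterᵇ isAscent L))
        ≈⟨ join ⟩
      sumList (map (children F) (filterᵇ isAscent (s ∷ L))) ∎
      where
      C = map (s ∷ʳ_) (upTo (suc (suc n)))
      Cs = concatMap (λ s → map (s ∷ʳ_) (upTo (suc (suc n)))) L
      join : guarded (isAscent s) (children F s) + sumList (map (children F) (filterᵇ isAscent L))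
             ≈ sumList (map (children F) (filterᵇ isAscent (s ∷ L)))
      join with isAscent s
      ... | true  = refl
      ... | false = +-identityˡ _

    -- `invSeqs` builds up by the last letter, `extensions` chooses the earliest letter first.
    -- Summing F over the last letter inside reconciles the two orders.
    extensions-children : ∀ n F w → extensions n (children F) w ≈ extensions (suc n) F w
    extensions-children zero    F w = refl
    extensions-children (suc n) F w = sumR-cong (suc (suc (asc (0 ∷ w)))) λ a _ → extensions-children n F (w ∷ʳ a)

  sum-ascentSeqs : ∀ n F → sumList (map F (ascentSeqs (suc n))) ≈ extensions n F []
  sum-ascentSeqs zero    F = +-identityʳ _
  sum-ascentSeqs (suc n) F = trans (sum-children F n (invSeqs-shape n))
    (trans (sum-ascentSeqs n (children F)) (extensions-children n F []))

  pick : Carrier → Bool → Carrier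
  pick a b = if b then a else 1#

  weight : List ℕ → Carrier
  weight s = (x ^ᶜ rep s) * (y ^ᶜ maxStat s) * (u ^ᶜ asc s) * (z ^ᶜ zeroStat s)

  ^ᶜ-indicator : ∀ a n b → a ^ᶜ (n ℕ.+ indicator b) ≈ a ^ᶜ n * pick a b
  ^ᶜ-indicator a n true  = reflexive (≡.cong (a ^ᶜ_) (ℕₚ.+-comm n 1))
  ^ᶜ-indicator a n false = trans (reflexive (≡.cong (a ^ᶜ_) (ℕₚ.+-identityʳ n))) (sym (*-identityʳ _))

  weight-∷ʳ : ∀ w a {b₁ b₂ b₃ b₄} → elem a (0 ∷ w) ≡ b₁ → (a ≡ᵇ suc (length w)) ≡ b₂ →
              (lastOr 0 w <ᵇ a) ≡ b₃ → (a ≡ᵇ 0) ≡ b₄ →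
              weight (0 ∷ (w ∷ʳ a)) ≈ weight (0 ∷ w) * (pick x b₁ * pick y b₂ * pick u b₃ * pick z b₄)
  weight-∷ʳ w a ≡.refl ≡.refl ≡.refl ≡.refl = begin
    weight (s ∷ʳ a)
      ≈⟨ *-cong (*-cong (*-cong (power x (rep-∷ʳ s a)) (power y (maxStat-∷ʳ s a)))
                        (power u (asc-∷ʳ 0 w a)))
                (power z (zeroStat-∷ʳ s a)) ⟩
    _ ≈⟨ solve 8 (λ a b c d e f g h → (a :* e) :* (b :* f) :* (c :* g) :* (d :* h)
           := (a :* b :* c :* d) :* (e :* f :* g :* h)) refl _ _ _ _ _ _ _ _ ⟩
    weight s * (pick x (elem a s) * pick y (a ≡ᵇ suc (length w)) * pick u (lastOr 0 w <ᵇ a) * pick z (a ≡ᵇ 0)) ∎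
    where
    s = 0 ∷ w
    power : ∀ b {m n c} → m ≡ n ℕ.+ indicator c → b ^ᶜ m ≈ b ^ᶜ n * pick b c
    power b {n = n} {c} ≡.refl = ^ᶜ-indicator b n c

  private
    letterWeight : (ℕ → Entry) → ℕ → Carrier
    letterWeight τ zero    = x * z
    letterWeight τ (suc a) = wt (τ (suc a))

    wt-isUsed : ∀ e → pick x (isUsed e) ≈ wt e
    wt-isUsed used = refl
    wt-isUsed new  = refl
    wt-isUsed rec  = refl

    -- `downΣ` runs through the letters downwards and piles up the values it passes; for the letter
    -- a this pile is the demoted stretch from a + 1 to l.
    downΣ-below : ∀ φ τ l A → downΣ z φ (below τ l) A
                ≈ sumR (suc l) (λ a → letterWeight τ a * φ (below (visit τ a) a) (above (demote ∘ τ) a (l ∸ a) ++ A))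
    downΣ-below φ τ zero    A = sym (+-identityˡ _)
    downΣ-below φ τ (suc l) A = begin
      wt (τ (suc l)) * φ (rec ∷ below τ l) A + downΣ z φ (below τ l) (demote (τ (suc l)) ∷ A)
        ≈⟨ +-comm _ _ ⟩
      downΣ z φ (below τ l) (demote (τ (suc l)) ∷ A) + wt (τ (suc l)) * φ (rec ∷ below τ l) A
        ≈⟨ +-cong (trans (downΣ-below φ τ l (demote (τ (suc l)) ∷ A))
                         (sumR-cong (suc l) λ a a≤l → reflexive (≡.cong (λ A′ → letterWeight τ a * φ (below (visit τ a) a) A′) (shift′ a (ℕₚ.≤-pred a≤l)))))
                  (reflexive (≡.cong₂ (λ B A′ → wt (τ (suc l)) * φ B A′) (≡.sym (below-visit τ l))
                     (≡.cong (λ k → above (demote ∘ τ) (suc l) k ++ A) (≡.sym (ℕₚ.n∸n≡0 l))))) ⟩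
      sumR (suc (suc l)) (λ a → letterWeight τ a * φ (below (visit τ a) a) (above (demote ∘ τ) a (suc l ∸ a) ++ A)) ∎
      where
      shift′ : ∀ a → a ≤ l → above (demote ∘ τ) a (l ∸ a) ++ demote (τ (suc l)) ∷ A ≡ above (demote ∘ τ) a (suc l ∸ a) ++ A
      shift′ a a≤l = ≡.trans (≡.sym (Listₚ.++-assoc (above (demote ∘ τ) a (l ∸ a)) [ demote (τ (suc l)) ] A))
        (≡.cong (_++ A) (≡.trans
          (≡.cong (λ k → above (demote ∘ τ) a (l ∸ a) ∷ʳ demote (τ (suc k))) (≡.sym (ℕₚ.m+[n∸m]≡n a≤l)))
          (≡.trans (≡.sym (above-∷ʳ (demote ∘ τ) a (l ∸ a)))
            (≡.cong (above (demote ∘ τ) a) (≡.sym (ℕₚ.+-∸-assoc 1 a≤l))))))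

    upΣ-above : ∀ φ τ l m → (∀ c → l < c → demote (τ c) ≡ τ c) →
                upΣ φ (below τ l) (above τ l m)
                ≈ sumR m (λ i → wt (τ (suc (l ℕ.+ i))) * φ (rec ∷ below τ (l ℕ.+ i)) (above τ (suc (l ℕ.+ i)) (m ∸ suc i) ∷ʳ new))
    upΣ-above φ τ l zero    e = refl
    upΣ-above φ τ l (suc m) e = begin
      wt (τ (suc l)) * φ (rec ∷ below τ l) (above τ (suc l) m ∷ʳ new) + upΣ φ (demote (τ (suc l)) ∷ below τ l) (above τ (suc l) m)
        ≈⟨ +-cong (reflexive (≡.cong (λ k → wt (τ (suc k)) * φ (rec ∷ below τ k) (above τ (suc k) m ∷ʳ new)) (≡.sym (ℕₚ.+-identityʳ l))))
                  (reflexive (≡.cong (λ e → upΣ φ (e ∷ below τ l) (above τ (suc l) m)) (e (suc l) ℕₚ.≤-refl))) ⟩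
      f 0 + upΣ φ (below τ (suc l)) (above τ (suc l) m)
        ≈⟨ +-congˡ (upΣ-above φ τ (suc l) m λ c l<c → e c (ℕₚ.<-trans (ℕₚ.n<1+n l) l<c)) ⟩
      f 0 + sumR m (λ i → wt (τ (suc (suc l ℕ.+ i))) * φ (rec ∷ below τ (suc l ℕ.+ i)) (above τ (suc (suc l ℕ.+ i)) (m ∸ suc i) ∷ʳ new))
        ≈⟨ +-congˡ (sumR-cong m λ i _ → reflexive (≡.cong (λ k → wt (τ (suc k)) * φ (rec ∷ below τ k) (above τ (suc k) (m ∸ suc i) ∷ʳ new))
             (≡.sym (ℕₚ.+-suc l i)))) ⟩
      f 0 + sumR m (λ i → f (suc i))
        ≈⟨ sumR-head m f ⟨
      sumR (suc m) f ∎
      where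
      f : ℕ → Carrier
      f i = wt (τ (suc (l ℕ.+ i))) * φ (rec ∷ below τ (l ℕ.+ i)) (above τ (suc (l ℕ.+ i)) (suc m ∸ suc i) ∷ʳ new)

  module Sums {w l m τ} (C : Config w l m τ) (φ : State) where
    open Config C

    down-term up-term : ℕ → Carrier
    down-term a = letterWeight τ a * φ (below (visit τ a) a) (above (visit τ a) a (l ∸ a ℕ.+ m))
    up-term i = wt (τ (suc (l ℕ.+ i))) * φ (below (visit τ (suc (l ℕ.+ i))) (suc (l ℕ.+ i)))
                                           (above (visit τ (suc (l ℕ.+ i))) (suc (l ℕ.+ i)) (m ∸ i))

    down-sum : downΣ z φ (below τ l) (above τ l m) ≈ sumR (suc l) down-term
    down-sum = trans (downΣ-below φ τ l (above τ l m)) (sumR-cong (suc l) λ a a≤l →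
      reflexive (≡.cong (λ A → letterWeight τ a * φ (below (visit τ a) a) A) (rearrange a (ℕₚ.≤-pred a≤l))))
      where
      rearrange : ∀ a → a ≤ l → above (demote ∘ τ) a (l ∸ a) ++ above τ l m ≡ above (visit τ a) a (l ∸ a ℕ.+ m)
      rearrange a a≤l = ≡.sym (≡.trans (above-visit τ a (l ∸ a ℕ.+ m)) (≡.trans (above-++ (demote ∘ τ) a (l ∸ a) m)
        (≡.cong (above (demote ∘ τ) a (l ∸ a) ++_)
          (≡.trans (≡.cong (λ k → above (demote ∘ τ) k m) (ℕₚ.m+[n∸m]≡n a≤l)) (above-cong l m noRecs)))))

    up-sum : upΣ φ (below τ l) (above τ l m) ≈ sumR m up-term
    up-sum = trans (upΣ-above φ τ l m noRecs) (sumR-cong m λ i i<m →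
      reflexive (≡.cong₂ (λ B A → wt (τ (suc (l ℕ.+ i))) * φ B A) (≡.sym (below-visit τ (l ℕ.+ i))) (rearrange i i<m)))
      where
      rearrange : ∀ i → i < m → let a = suc (l ℕ.+ i) in above τ a (m ∸ suc i) ∷ʳ new ≡ above (visit τ a) a (m ∸ i)
      rearrange i i<m = ≡.sym (≡.trans (above-visit τ a (m ∸ i)) (≡.trans
        (above-cong a (m ∸ i) λ c a<c → noRecs c (ℕₚ.<-trans (s≤s (ℕₚ.m≤m+n l i)) a<c)) (≡.trans
        (≡.cong (above τ a) (ℕₚ.+-∸-assoc 1 i<m)) (≡.trans
        (above-∷ʳ τ a (m ∸ suc i))
        (≡.cong (above τ a (m ∸ suc i) ∷ʳ_) (fresh _ (ℕₚ.≤-trans (ℕₚ.≤-reflexive (≡.sym total)) (ℕₚ.n≤1+n _))))))))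
        where
        a = suc (l ℕ.+ i)
        total : a ℕ.+ (m ∸ suc i) ≡ l ℕ.+ m
        total = ≡.trans (≡.cong (ℕ._+ (m ∸ suc i)) (≡.sym (ℕₚ.+-suc l i)))
          (≡.trans (ℕₚ.+-assoc l (suc i) (m ∸ suc i)) (≡.cong (l ℕ.+_) (ℕₚ.m+[n∸m]≡n i<m)))

  module _ {w l m τ} (C : Config w l m τ) where
    open Config C

    private
      W = weight (0 ∷ w)

      letters : ℕ
      letters = suc (suc (asc (0 ∷ w)))

      letters-eq : letters ≡ suc l ℕ.+ m
      letters-eq = ≡.cong suc ascents

    down-weight : ∀ a → a ≤ l → a < suc (length w) → weight (0 ∷ (w ∷ʳ a)) ≈ W * letterWeight τ a
    down-weight a a≤l a<n = trans
      (weight-∷ʳ w a (member a) (≡ᵇ-false a<n)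
        (≡.trans (≡.cong (_<ᵇ a) last) (<ᵇ-false a≤l)) ≡.refl)
      (*-congˡ (factor a))
      where
      factor : ∀ a → pick x (isUsed (τ a)) * pick y false * pick u false * pick z (a ≡ᵇ 0) ≈ letterWeight τ a
      factor zero    = trans (*-congʳ (*-congʳ (*-congʳ (reflexive (≡.cong (pick x) (≡.sym (member 0)))))))
        (solve 2 (λ x z → x :* one :* one :* z := x :* z) refl x z)
      factor (suc a) = trans (solve 1 (λ x → x :* one :* one :* one := x) refl _) (wt-isUsed (τ (suc a)))

    up-weight : ∀ i b → (suc (l ℕ.+ i) ≡ᵇ suc (length w)) ≡ b →
                weight (0 ∷ (w ∷ʳ suc (l ℕ.+ i))) ≈ W * (pick y b * (u * wt (τ (suc (l ℕ.+ i)))))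
    up-weight i b e = trans
      (weight-∷ʳ w (suc (l ℕ.+ i)) (member _) e (≡.trans (≡.cong (_<ᵇ suc (l ℕ.+ i)) last) (<ᵇ-true (s≤s (ℕₚ.m≤m+n l i)))) ≡.refl)
      (*-congˡ (trans (solve 3 (λ x y u → x :* y :* u :* one := y :* (u :* x)) refl _ (pick y b) u)
        (*-congˡ (*-congˡ (wt-isUsed (τ (suc (l ℕ.+ i))))))))

    letter-sum : ∀ F → sumR letters F ≈ sumR (suc l) F + sumR m (λ i → F (suc (l ℕ.+ i)))
    letter-sum F = trans (reflexive (≡.cong (λ k → sumR k F) letters-eq)) (sumR-split (suc l) m F)

  private
    mono : List ℕ → Carrier
    mono = monomial x y u z v

  -- The inequality says that the initial run has been left. Every admissible letter then lies below
  -- the next index, so no further y can arise, and the inequality persists. The separate v is the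
  -- minimum 0, which `recs` does not count.
  extensions-Φ : ∀ k {w l m τ} → Config w l m τ → asc (0 ∷ w) < length w →
                 extensions k mono w ≈ weight (0 ∷ w) * v * Φ z k (below τ l) (above τ l m)
  extensions-Φ zero {w} {l} {m} {τ} C _ = trans
    (*-congˡ (reflexive (≡.cong (v ^ᶜ_) (Config.whole C))))
    (solve 3 (λ a b c → a :* (c :* b) := a :* b :* c) refl _ v _)
  extensions-Φ (suc k) {w} {l} {m} {τ} C asc<n = begin
    sumR (suc (suc (asc (0 ∷ w)))) F
      ≈⟨ letter-sum C F ⟩
    sumR (suc l) F + sumR m (λ i → F (suc (l ℕ.+ i)))
      ≈⟨ +-cong (sumR-cong (suc l) λ a a≤l → down a (ℕₚ.≤-pred a≤l)) (sumR-cong m up) ⟩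
    sumR (suc l) (λ a → Wv * down-term a) + sumR m (λ i → Wv * (u * up-term i))
      ≈⟨ +-cong (sumR-*ˡ (suc l) Wv down-term) (trans (sumR-*ˡ m Wv (λ i → u * up-term i)) (*-congˡ (sumR-*ˡ m u up-term))) ⟩
    Wv * sumR (suc l) down-term + Wv * (u * sumR m up-term)
      ≈⟨ distribˡ _ _ _ ⟨
    Wv * (sumR (suc l) down-term + u * sumR m up-term)
      ≈⟨ *-congˡ (+-cong down-sum (*-congˡ up-sum)) ⟨
    Wv * Φ z (suc k) (below τ l) (above τ l m) ∎
    where
    open Sums C (Φ z k)
    open Config C
    Wv = weight (0 ∷ w) * v
    F : ℕ → Carrier
    F a = extensions k mono (w ∷ʳ a)
    bound : ∀ {a} → a < l ℕ.+ m → suc a ≤ length w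
    bound a<l+m = ℕₚ.≤-trans (ℕₚ.≤-trans a<l+m (ℕₚ.≤-reflexive (≡.sym ascents))) asc<n
    l≤l+m : l < l ℕ.+ m
    l≤l+m = ℕₚ.m<m+n l room
    shuffle : ∀ a b c d → a * b * c * d ≈ a * c * (b * d)
    shuffle = solve 4 (λ a b c d → a :* b :* c :* d := a :* c :* (b :* d)) refl
    down : ∀ a → a ≤ l → F a ≈ Wv * down-term a
    down a a≤l = begin
      F a
        ≈⟨ extensions-Φ k (visit-down C a a≤l) grow ⟩
      weight (0 ∷ (w ∷ʳ a)) * v * φ
        ≈⟨ *-congʳ (*-congʳ (down-weight C a a≤l (ℕₚ.≤-trans (bound (ℕₚ.≤-<-trans a≤l l≤l+m)) (ℕₚ.n≤1+n _)))) ⟩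
      weight (0 ∷ w) * letterWeight τ a * v * φ
        ≈⟨ shuffle _ _ _ _ ⟩
      Wv * down-term a ∎
      where
      φ = Φ z k (below (visit τ a) a) (above (visit τ a) a (l ∸ a ℕ.+ m))
      grow : asc (0 ∷ (w ∷ʳ a)) < length (w ∷ʳ a)
      grow = ≡.subst₂ _<_
        (≡.sym (≡.trans (asc-∷ʳ 0 w a) (≡.trans (≡.cong (λ b → asc (0 ∷ w) ℕ.+ indicator b)
          (≡.trans (≡.cong (_<ᵇ a) last) (<ᵇ-false a≤l))) (ℕₚ.+-identityʳ _))))
        (≡.sym (length-∷ʳ w a)) (ℕₚ.m<n⇒m<1+n asc<n)
    up : ∀ i → i < m → F (suc (l ℕ.+ i)) ≈ Wv * (u * up-term i)
    up i i<m = begin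
      F a
        ≈⟨ extensions-Φ k (visit-up C i i<m) grow ⟩
      weight (0 ∷ (w ∷ʳ a)) * v * φ
        ≈⟨ *-congʳ (*-congʳ (up-weight C i false (≡ᵇ-false (bound (ℕₚ.+-monoʳ-< l i<m))))) ⟩
      weight (0 ∷ w) * (1# * (u * wt (τ a))) * v * φ
        ≈⟨ solve 5 (λ a u e v φ → a :* (one :* (u :* e)) :* v :* φ := a :* v :* (u :* (e :* φ))) refl _ u (wt (τ a)) v φ ⟩
      Wv * (u * up-term i) ∎
      where
      a = suc (l ℕ.+ i)
      φ = Φ z k (below (visit τ a) a) (above (visit τ a) a (m ∸ i))
      grow : asc (0 ∷ (w ∷ʳ a)) < length (w ∷ʳ a)
      grow = ≡.subst₂ _<_
        (≡.sym (≡.trans (asc-∷ʳ 0 w a) (≡.trans (≡.cong (λ b → asc (0 ∷ w) ℕ.+ indicator b)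
          (≡.trans (≡.cong (_<ᵇ a) last) (<ᵇ-true (s≤s (ℕₚ.m≤m+n l i))))) (ℕₚ.+-comm _ 1))))
        (≡.sym (length-∷ʳ w a)) (s≤s asc<n)

  -- Here 0 ∷ w is the initial run 0 1 … j.
  extensions-run : ∀ k {w j τ} → Config w j 1 τ → length w ≡ j → below τ j ≡ replicate j rec →
                   extensions k mono w ≈ weight (0 ∷ w) * v * run z y j k
  extensions-run zero {w} {j} {τ} C len runs = trans
    (*-congˡ (reflexive (≡.cong (v ^ᶜ_) (≡.trans (Config.whole C)
      (≡.cong suc (≡.trans (≡.cong recs runs) (ProcessSeries.recs-rec R x u v j)))))))
    (solve 3 (λ a b c → a :* (c :* b) := a :* b :* c) refl _ v _)
  extensions-run (suc k) {w} {j} {τ} C len runs = begin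
    sumR (suc (suc (asc (0 ∷ w)))) F
      ≈⟨ letter-sum C F ⟩
    sumR (suc j) F + sumR 1 (λ i → F (suc (j ℕ.+ i)))
      ≈⟨ +-cong (sumR-cong (suc j) λ a a≤j → down a (ℕₚ.≤-pred a≤j))
                (trans (+-identityˡ _) (trans (reflexive (≡.cong (λ i → F (suc i)) (ℕₚ.+-identityʳ j))) up)) ⟩
    sumR (suc j) (λ a → Wv * down-term a) + Wv * (y * u * run z y (suc j) k)
      ≈⟨ +-congʳ (trans (sumR-*ˡ (suc j) Wv down-term) (*-congˡ (sym down-sum))) ⟩
    Wv * downΣ z (Φ z k) (below τ j) (above τ j 1) + Wv * (y * u * run z y (suc j) k)
      ≈⟨ distribˡ _ _ _ ⟨
    Wv * (downΣ z (Φ z k) (below τ j) (above τ j 1) + y * u * run z y (suc j) k)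
      ≈⟨ *-congˡ (+-congʳ (reflexive (≡.cong₂ (downΣ z (Φ z k)) runs
           (≡.cong [_] (fresh (suc j) (ℕₚ.≤-reflexive (ℕₚ.+-comm j 1))))))) ⟩
    Wv * run z y j (suc k) ∎
    where
    open Sums C (Φ z k)
    open Config C
    Wv = weight (0 ∷ w) * v
    F : ℕ → Carrier
    F a = extensions k mono (w ∷ʳ a)
    asc≡ : asc (0 ∷ w) ≡ j
    asc≡ = ℕₚ.suc-injective (≡.trans ascents (ℕₚ.+-comm j 1))
    down : ∀ a → a ≤ j → F a ≈ Wv * down-term a
    down a a≤j = begin
      F a
        ≈⟨ extensions-Φ k (visit-down C a a≤j) grow ⟩
      weight (0 ∷ (w ∷ʳ a)) * v * φ
        ≈⟨ *-congʳ (*-congʳ (down-weight C a a≤j (s≤s (ℕₚ.≤-trans a≤j (ℕₚ.≤-reflexive (≡.sym len)))))) ⟩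
      weight (0 ∷ w) * letterWeight τ a * v * φ
        ≈⟨ solve 4 (λ a b c d → a :* b :* c :* d := a :* c :* (b :* d)) refl _ _ v φ ⟩
      Wv * down-term a ∎
      where
      φ = Φ z k (below (visit τ a) a) (above (visit τ a) a (j ∸ a ℕ.+ 1))
      grow : asc (0 ∷ (w ∷ʳ a)) < length (w ∷ʳ a)
      grow = ≡.subst₂ _<_
        (≡.sym (≡.trans (asc-∷ʳ 0 w a) (≡.trans (≡.cong (λ b → asc (0 ∷ w) ℕ.+ indicator b)
          (≡.trans (≡.cong (_<ᵇ a) last) (<ᵇ-false a≤j))) (ℕₚ.+-identityʳ _))))
        (≡.sym (length-∷ʳ w a)) (s≤s (ℕₚ.≤-reflexive (≡.trans asc≡ (≡.sym len))))
    next : Config (w ∷ʳ suc j) (suc j) 1 (visit τ (suc j))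
    next = ≡.subst (λ i → Config (w ∷ʳ suc i) (suc i) 1 (visit τ (suc i))) (ℕₚ.+-identityʳ j) (visit-up C 0 (s≤s z≤n))
    up : F (suc j) ≈ Wv * (y * u * run z y (suc j) k)
    up = begin
      F (suc j)
        ≈⟨ extensions-run k next (≡.trans (length-∷ʳ w (suc j)) (≡.cong suc len))
             (≡.trans (below-visit τ j) (≡.cong (rec ∷_) runs)) ⟩
      weight (0 ∷ (w ∷ʳ suc j)) * v * run z y (suc j) k
        ≈⟨ *-congʳ (*-congʳ (trans (reflexive (≡.cong (λ i → weight (0 ∷ (w ∷ʳ suc i))) (≡.sym (ℕₚ.+-identityʳ j))))
             (trans (up-weight C 0 true is-max) (*-congˡ (*-congˡ (*-congˡ (reflexive (≡.cong wt is-new)))))))) ⟩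
      weight (0 ∷ w) * (y * (u * 1#)) * v * run z y (suc j) k
        ≈⟨ solve 5 (λ a y u v φ → a :* (y :* (u :* one)) :* v :* φ := a :* v :* (y :* u :* φ)) refl _ y u v _ ⟩
      Wv * (y * u * run z y (suc j) k) ∎
      where
      is-new : τ (suc (j ℕ.+ 0)) ≡ new
      is-new = fresh _ (ℕₚ.≤-reflexive (≡.trans (ℕₚ.+-comm j 1) (≡.cong suc (≡.sym (ℕₚ.+-identityʳ j)))))
      is-max : (suc (j ℕ.+ 0) ≡ᵇ suc (length w)) ≡ true
      is-max = ≡.subst₂ (λ a b → (suc a ≡ᵇ suc b) ≡ true) (≡.sym (ℕₚ.+-identityʳ j)) (≡.sym len) (≡ᵇ-refl j)

  -- The prefactor is the first letter 0: it attains its bound, it is a zero, and the value 0 always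
  -- is a right-to-left minimum.
  G-run : ∀ n → G x y u z v (suc n) ≈ y * z * v * run z y 0 n
  G-run n = trans (sum-ascentSeqs n mono) (trans (extensions-run n config-start ≡.refl ≡.refl)
    (*-congʳ (*-congʳ (solve 2 (λ y z → (one :* (one :* y) :* one) :* (one :* z) := y :* z) refl y z))))

-- Quotients of power series and orders of vanishing.

module Division {c ℓ} (R : CommutativeRing c ℓ) where
  open CommutativeRing R
  open Series R
  open PowerSeries R
  open LinearCombination R using (solve; _:=_; _:+_; _:*_; :-_)
  open import Relation.Binary.Reasoning.Setoid setoid
  private module S = CommutativeRing seriesRing

  private
    -- The list lookup used by inv is private to Series; here it is recovered by unification.
    mutual
      lookup : List Carrier → ℕ → Carrier
      lookup = _

      inv-lookup : ∀ w D n → inv w D n ≡ lookup (invList w D (suc n)) n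
      inv-lookup w D n with invList w D (suc n)
      ... | l = ≡.refl

    lookup-∷ʳ-< : ∀ l a n → n < length l → lookup (l ++ [ a ]) n ≡ lookup l n
    lookup-∷ʳ-< (b ∷ l) a zero    _       = ≡.refl
    lookup-∷ʳ-< (b ∷ l) a (suc n) (s≤s p) = lookup-∷ʳ-< l a n p

    lookup-∷ʳ-end : ∀ l a → lookup (l ++ [ a ]) (length l) ≡ a
    lookup-∷ʳ-end []      a = ≡.refl
    lookup-∷ʳ-end (b ∷ l) a = lookup-∷ʳ-end l a

    length-invList : ∀ w D n → length (invList w D n) ≡ n
    length-invList w D zero    = ≡.refl
    length-invList w D (suc n) = ≡.trans (Listₚ.length-++ (invList w D n))
      (≡.trans (ℕₚ.+-comm _ 1) (≡.cong suc (length-invList w D n)))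

    entry : Carrier → PS → ℕ → Carrier
    entry w D n = if n ≡ᵇ 0 then w else - (w * sumR n (λ j → D (n ∸ j) * lookup (invList w D n) j))

    inv-entry : ∀ w D n → inv w D n ≡ entry w D n
    inv-entry w D n = ≡.trans (inv-lookup w D n)
      (≡.subst (λ k → lookup (invList w D n ++ [ entry w D n ]) k ≡ entry w D n) (length-invList w D n)
        (lookup-∷ʳ-end (invList w D n) (entry w D n)))

    lookup-inv : ∀ w D n j → j < n → lookup (invList w D n) j ≡ inv w D j
    lookup-inv w D (suc n) j (s≤s j≤n) with ℕₚ.m≤n⇒m<n∨m≡n j≤n
    ... | inj₁ j<n = ≡.trans
      (lookup-∷ʳ-< (invList w D n) (entry w D n) j (ℕₚ.<-≤-trans j<n (ℕₚ.≤-reflexive (≡.sym (length-invList w D n)))))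
      (lookup-inv w D n j j<n)
    ... | inj₂ ≡.refl = ≡.sym (inv-lookup w D n)

  inv-inverse : ∀ w D → w * D 0 ≈ 1# → (inv w D ⊗ D) ≋ ĉ 1#
  inv-inverse w D e .at zero = trans (⊗-zero (inv w D) D) (trans (*-congʳ (reflexive (inv-entry w D 0))) e)
  inv-inverse w D e .at (suc n) = begin
    Σ + inv w D (suc n) * D (n ∸ n)
      ≈⟨ +-congˡ (*-cong (reflexive (inv-entry w D (suc n))) (reflexive (≡.cong D (ℕₚ.n∸n≡0 n)))) ⟩
    Σ + - (w * Σ′) * D 0
      ≈⟨ +-congˡ (*-congʳ (-‿cong (*-congˡ (sumR-cong (suc n) λ j j≤n → trans (*-comm _ _)
           (*-congʳ (reflexive (lookup-inv w D (suc n) j j≤n))))))) ⟩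
    Σ + - (w * Σ) * D 0
      ≈⟨ solve 3 (λ s w d → s :+ (:- (w :* s)) :* d := s :+ (:- (s :* (w :* d)))) refl Σ w (D 0) ⟩
    Σ + - (Σ * (w * D 0))  ≈⟨ +-congˡ (-‿cong (trans (*-congˡ e) (*-identityʳ Σ))) ⟩
    Σ + - Σ                ≈⟨ -‿inverseʳ Σ ⟩
    0#                     ∎
    where
    Σ = sumR (suc n) (λ i → inv w D i * D (suc n ∸ i))
    Σ′ = sumR (suc n) (λ j → D (suc n ∸ j) * lookup (invList w D (suc n)) j)

  t^ : ℕ → PS → PS
  t^ zero    f = f
  t^ (suc a) f = tt ⊗ t^ a f

  shift-t^ : ∀ a f n → t^ a f (a ℕ.+ n) ≈ f n
  shift-t^ zero    f n = refl
  shift-t^ (suc a) f n = trans (tt-suc (t^ a f) (a ℕ.+ n)) (shift-t^ a f n)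

  -- All quotients of the statement are identified through this product; the list recursion behind
  -- `inv` is not looked at again.
  divBy-inverse : ∀ a w {N D N′ D′} → N ≋ t^ a N′ → D ≋ t^ a D′ → w * D′ 0 ≈ 1# →
                  (divBy a w N D ⊗ D′) ≋ N′
  divBy-inverse a w {N} {D} {N′} {D′} eN eD e = S.trans (⊗-assoc (shift a N) (inv w (shift a D)) D′) (S.trans
    (⊗-cong {f = shift a N} {g = inv w (shift a D) ⊗ D′} shiftN
      (S.trans (⊗-cong {f = inv w (shift a D)} S.refl (S.sym shiftD))
        (inv-inverse w (shift a D) (trans (*-congˡ (at shiftD 0)) e))))
    (S.*-identityʳ N′))
    where
    shiftN : shift a N ≋ N′
    shiftN .at n = trans (at eN (a ℕ.+ n)) (shift-t^ a N′ n)
    shiftD : shift a D ≋ D′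
    shiftD .at n = trans (at eD (a ℕ.+ n)) (shift-t^ a D′ n)

  Order : ℕ → PS → Set ℓ
  Order K f = ∀ n → n < K → f n ≈ 0#

  order-cong : ∀ {K f g} → f ≋ g → Order K f → Order K g
  order-cong e o n n<K = trans (sym (at e n)) (o n n<K)

  order-+ : ∀ {K f g} → Order K f → Order K g → Order K (f ⊕ g)
  order-+ o o′ n n<K = trans (+-cong (o n n<K) (o′ n n<K)) (+-identityˡ 0#)

  order-⊗ : ∀ {K L f g} → Order K f → Order L g → Order (K ℕ.+ L) (f ⊗ g)
  order-⊗ {K} {L} {f} {g} o o′ n n<K+L = trans (sumR-cong (suc n) term) (sumR-0 (suc n))
    where
    term : ∀ i → i < suc n → f i * g (n ∸ i) ≈ 0#
    term i i≤n with ℕₚ.<-≤-connex i K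
    ... | inj₁ i<K = trans (*-congʳ (o i i<K)) (zeroˡ _)
    ... | inj₂ K≤i = trans (*-congˡ (o′ (n ∸ i) n∸i<L)) (zeroʳ _)
      where
      n<i+L : n < i ℕ.+ L
      n<i+L = ℕₚ.<-≤-trans n<K+L (ℕₚ.+-monoˡ-≤ L K≤i)
      n∸i<L : n ∸ i < L
      n∸i<L = ℕₚ.+-cancelˡ-< i (n ∸ i) L (ℕₚ.≤-<-trans (ℕₚ.≤-reflexive (ℕₚ.m+[n∸m]≡n (ℕₚ.≤-pred i≤n))) n<i+L)

  order-0 : ∀ f → Order 0 f
  order-0 f n ()

  order-⊗ʳ : ∀ {K f} g → Order K f → Order K (g ⊗ f)
  order-⊗ʳ g o = order-⊗ {0} {f = g} (order-0 g) o

  order-prodFrom : ∀ K a f → (∀ i → f i 0 ≈ 0#) → Order K (prodFrom a K f)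
  order-prodFrom zero    a f e = order-0 _
  order-prodFrom (suc K) a f e = order-⊗ {1} {K} (λ { zero _ → e a ; (suc n) (s≤s ()) }) (order-prodFrom K (suc a) f e)

  order-sumFrom : ∀ {K} len a f → (∀ k → a ≤ k → k < a ℕ.+ len → Order K (f k)) → Order K (sumFrom a len f)
  order-sumFrom zero      a f o = λ n _ → ĉ0≈0 n
  order-sumFrom (suc len) a f o = order-+
    (o a ℕₚ.≤-refl (ℕₚ.m<m+n a (s≤s z≤n)))
    (order-sumFrom len (suc a) f λ k a<k k<a+len → o k (ℕₚ.<⇒≤ a<k) (ℕₚ.<-≤-trans k<a+len (ℕₚ.≤-reflexive (≡.sym (ℕₚ.+-suc a len)))))

Inverse : ∀ {c ℓ} (R : CommutativeRing c ℓ) (x u w : CommutativeRing.Carrier R) → Set ℓ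
Inverse R x u w = w * (x + u + - (x * u)) ≈ 1#
  where open CommutativeRing R

-- The expansion and its remainder.

module Expansion {c ℓ} (R : CommutativeRing c ℓ) (x y u z v w : CommutativeRing.Carrier R)
  (w-inverse : Inverse R x u w) where
  open CommutativeRing R
  open Series R
  open PowerSeries R
  open Division R
  open RHS x y u z v w using (term0; term1; term2; factor1; factor2; inner; partial)
  private
    module F = RHS x y u z v w
    module S = CommutativeRing seriesRing
    module PS = ProcessSeries R x u v
    x̂ = ĉ x
    ŷ = ĉ y
    û = ĉ u
    ẑ = ĉ z
    v̂ = ĉ v
  open Complete seriesRing tt geom geom-rec geom-unique
  open Weights x̂ û v̂
  open Quotients ẑ
  open import Relation.Binary.Reasoning.Setoid S.setoid

  ys : ℕ → PS
  ys zero    = ŷ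
  ys (suc k) = next (ys k)

  private
    r-eq : F.r S.≈ r
    r-eq = S.*-congˡ {tt} (S.+-congˡ {x̂ ⊕ û} (S.-‿cong (PS.ĉ-* x u)))

    P-eq : ∀ k → F.P k S.≈ P (ys k)
    P-eq zero = S.trans (S.*-identityʳ (ĉ 1# ⊖ ŷ ⊗ F.r)) (S.+-congˡ {ĉ 1#} (S.-‿cong (S.trans (S.*-comm ŷ F.r) (S.*-congʳ {ŷ} r-eq))))
    P-eq (suc k) = begin
      a₀ S.* (b₀ S.* c₀)       ≈⟨ S.*-assoc a₀ b₀ c₀ ⟨
      F.P k S.* c₀             ≈⟨ S.*-cong (P-eq k) (S.+-congˡ {ĉ 1#} (S.-‿cong r-eq)) ⟩
      P (ys k) S.* (S.1# S.- r)  ≈⟨ P-next (ys k) ⟨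
      P (ys (suc k))           ∎
      where
      a₀ = ĉ 1# ⊖ ŷ ⊗ F.r
      b₀ = (ĉ 1# ⊖ F.r) ^ₛ k
      c₀ = ĉ 1# ⊖ F.r

    xu-eq : (x̂ ⊖ ĉ (x * u)) S.≈ (x̂ S.- x̂ S.* û)
    xu-eq = S.+-congˡ (S.-‿cong (PS.ĉ-* x u))

    tuv-eq : F.tuv S.≈ (tt S.* (û S.* v̂))
    tuv-eq = S.*-congˡ {tt} (PS.ĉ-* u v)

    E-eq : ∀ k → F.E k S.≈ σ S.* (S.1# S.- q (ys k))
    E-eq k = S.trans (S.+-cong xu-eq (S.*-congˡ {û} (P-eq k))) (E-form (ys k))

    F-eq : ∀ k → F.F k S.≈ tt S.* (σ S.* (S.1# S.- v̂ S.* q (ys k)))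
    F-eq k = S.trans (S.+-cong (S.+-cong r-eq (S.-‿cong tuv-eq)) (S.*-cong tuv-eq (P-eq k))) (F-form (ys k))

    H-eq : ∀ k → F.H k S.≈ σ S.* h (ys k)
    H-eq k = S.trans (S.+-congˡ (S.-‿cong (S.*-cong
      (S.trans (PS.ĉ-* u (x + - 1#)) (S.*-congˡ {û} (S.sym (PS.ĉ-difference x 1#)))) (P-eq k)))) (H-form (ys k))

    B-eq : ∀ k → F.B k S.≈ tt S.* (σ S.* br (ys k))
    B-eq k = S.trans
      (S.+-cong (S.+-cong tuv-eq (S.*-congˡ {ẑ} (S.+-cong r-eq (S.-‿cong tuv-eq))))
                (S.-‿cong (S.*-cong (S.*-congʳ {ĉ 1# ⊖ ẑ} tuv-eq) (P-eq k))))
      (B-form (ys k))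

    infix 4 _₀≈_
    _₀≈_ : PS → Carrier → Set ℓ
    f ₀≈ a = f 0 ≈ a

    t-₀ : ∀ f → tt ⊗ f ₀≈ 0#
    t-₀ = tt-zero

    ⊗-₀0 : ∀ f g → f ₀≈ 0# → f ⊗ g ₀≈ 0#
    ⊗-₀0 f g e = trans (⊗-zero f g) (trans (*-congʳ e) (zeroˡ _))

    ⊗-0₀ : ∀ f g → g ₀≈ 0# → f ⊗ g ₀≈ 0#
    ⊗-0₀ f g e = trans (⊗-zero f g) (trans (*-congˡ e) (zeroʳ _))

    1-₀ : ∀ f g → f ₀≈ 1# → g ₀≈ 0# → f ⊖ g ₀≈ 1#
    1-₀ f g e e′ = trans (+-cong e (-‿cong e′)) (trans (+-congˡ -0≈0) (+-identityʳ 1#))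
      where
      open import Algebra.Properties.Ring ring using () renaming (-0#≈0# to -0≈0)

    s₀ : Carrier
    s₀ = x + u + - (x * u)

    σ-₀ : σ ₀≈ s₀
    σ-₀ = +-congˡ (-‿cong (⊗-zero x̂ û))

    q-₀ : ∀ k → q (ys k) ₀≈ 0#
    q-₀ k = t-₀ (û S.* ys k)

    1-q-₀ : ∀ k → S.1# S.- q (ys k) ₀≈ 1#
    1-q-₀ k = 1-₀ S.1# (q (ys k)) refl (q-₀ k)

    1-vq-₀ : ∀ k → S.1# S.- v̂ S.* q (ys k) ₀≈ 1#
    1-vq-₀ k = 1-₀ S.1# (v̂ S.* q (ys k)) refl (⊗-0₀ v̂ (q (ys k)) (q-₀ k))

    h-₀ : ∀ k → h (ys k) ₀≈ 1#
    h-₀ k = trans (+-cong (1-₀ S.1# (r S.* ys k) refl (⊗-₀0 r (ys k) (t-₀ σ)))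
                          (⊗-₀0 (tt S.* x̂) (ys k) (t-₀ x̂))) (+-identityʳ 1#)

    N-₀ : ∀ k → N (ys k) ₀≈ 1#
    N-₀ k = 1-₀ (S.1# S.- q (ys k)) (tt S.* (û S.* v̂ S.* P (ys k))) (1-q-₀ k) (t-₀ (û S.* v̂ S.* P (ys k)))

    open import Algebra.Properties.CommutativeSemigroup *-commutativeSemigroup using (interchange)

    constant₁ : ∀ f → f ₀≈ 1# → w * (σ ⊗ f) 0 ≈ 1#
    constant₁ f e = trans (*-congˡ (trans (⊗-zero σ f) (*-cong σ-₀ e))) (trans (*-congˡ (*-identityʳ s₀)) w-inverse)

    constant-* : ∀ a b f g → a * f 0 ≈ 1# → b * g 0 ≈ 1# → a * b * (f ⊗ g) 0 ≈ 1#
    constant-* a b f g e e′ = trans (*-congˡ (⊗-zero f g))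
      (trans (interchange a b (f 0) (g 0)) (trans (*-cong e e′) (*-identityˡ 1#)))

    constant₂ : ∀ f g → f ₀≈ 1# → g ₀≈ 1# → w * w * (σ ⊗ f ⊗ (σ ⊗ g)) 0 ≈ 1#
    constant₂ f g e e′ = constant-* w w (σ ⊗ f) (σ ⊗ g) (constant₁ f e) (constant₁ g e′)

    constant₃ : ∀ f g k → f ₀≈ 1# → g ₀≈ 1# → k ₀≈ 1# → w * w * w * (σ ⊗ f ⊗ (σ ⊗ g) ⊗ (σ ⊗ k)) 0 ≈ 1#
    constant₃ f g k e e′ e″ = constant-* (w * w) w (σ ⊗ f ⊗ (σ ⊗ g)) (σ ⊗ k) (constant₂ f g e e′) (constant₁ k e″)

    unit-σ : Unit σ
    unit-σ = ĉ w , S.trans (⊗-comm σ (ĉ w)) (pointwise λ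
      { zero → trans (⊗-zero (ĉ w) σ) (trans (*-congˡ σ-₀) w-inverse)
      ; (suc n) → trans (ĉ-⊗ w σ (suc n)) (trans (*-congˡ (σ-suc n)) (zeroʳ w)) })
      where
      σ-suc : ∀ n → σ (suc n) ≈ 0#
      σ-suc n = trans (+-cong (+-identityˡ 0#) (trans (-‿cong (trans (ĉ-⊗ x û (suc n)) (zeroʳ x))) refl)) (-‿inverseʳ 0#)

    open Cancel unit-σ

    factor1-eq : ∀ k → factor1 k S.* h (ys k) S.≈ x̂ S.* tt S.* (ys k S.+ ẑ S.* P (ys k))
    factor1-eq k = cancel₁ {factor1 k} {h (ys k)} {M} (divBy-inverse 0 w {D′ = σ S.* h (ys k)}
      numerator (H-eq k) (constant₁ (h (ys k)) (h-₀ k)))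
      where
      M = x̂ S.* tt S.* (ys k S.+ ẑ S.* P (ys k))
      numerator : (x̂ ⊖ x̂ ⊗ (ĉ 1# ⊖ F.r ⊗ ẑ) ⊗ F.P k) S.≈ σ S.* M
      numerator = S.trans (S.+-congˡ {x̂} (S.-‿cong (S.*-cong
        (S.*-congˡ {x̂} (S.+-congˡ {ĉ 1#} (S.-‿cong (S.*-congʳ {ẑ} r-eq)))) (P-eq k)))) (factor1-numerator (ys k))

    factor2-eq : ∀ k → factor2 k S.* (h (ys k) S.* N (ys k)) S.≈ x̂ S.* tt S.* ys k S.* (S.1# S.- q (ys k))
    factor2-eq k = cancel₂ {factor2 k} {h (ys k)} {N (ys k)} {M} (divBy-inverse 0 (w * w)
      {D′ = σ S.* h (ys k) S.* (σ S.* N (ys k))} numerator denominator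
      (constant₂ (h (ys k)) (N (ys k)) (h-₀ k) (N-₀ k)))
      where
      M = x̂ S.* tt S.* ys k S.* (S.1# S.- q (ys k))
      numerator : (x̂ ⊗ (ĉ 1# ⊖ F.P k) ⊗ F.E k) S.≈ σ S.* σ S.* M
      numerator = S.trans (S.*-cong (S.*-congˡ {x̂} (S.+-congˡ {ĉ 1#} (S.-‿cong (P-eq k)))) (E-eq k)) (factor2-numerator (ys k))
      denominator : (F.H k ⊗ (x̂ ⊖ ĉ (x * u) ⊕ û ⊗ (ĉ 1# ⊖ F.r ⊗ v̂) ⊗ F.P k)) S.≈ σ S.* h (ys k) S.* (σ S.* N (ys k))
      denominator = S.*-cong (H-eq k) (S.trans (S.+-cong xu-eq
        (S.*-cong (S.*-congˡ {û} (S.+-congˡ {ĉ 1#} (S.-‿cong (S.*-congʳ {v̂} r-eq)))) (P-eq k))) (factor2-denominator (ys k)))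

    inner-eq : ∀ k → inner k S.* (S.1# S.- q (ys k)) S.≈ tt S.* v̂ S.* P (ys k)
    inner-eq k = cancel₁ {inner k} {S.1# S.- q (ys k)} {M} (divBy-inverse 0 w {D′ = σ S.* (S.1# S.- q (ys k))}
      numerator (E-eq k) (constant₁ (S.1# S.- q (ys k)) (1-q-₀ k)))
      where
      M = tt S.* v̂ S.* P (ys k)
      numerator : (F.r ⊗ v̂ ⊗ F.P k) S.≈ σ S.* M
      numerator = S.trans (S.*-cong (S.*-congʳ {v̂} r-eq) (P-eq k)) (inner-numerator (ys k))

    -- One t with y z v belongs to the first letter, the other t is the one split off in `run-sum`.
    T : PS
    T = tt S.* tt S.* (ŷ S.* ẑ S.* v̂)

    numerator1 numerator2 denominator1 denominator2 coefficient1 coefficient2 : ℕ → PS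
    numerator1 k = ĉ y ⊗ F.r ^ₛ 2 ⊗ ĉ v ⊗ ĉ x ⊗ ĉ z ⊗ F.B k ⊗ F.P k
    numerator2 k = ĉ y ⊗ F.r ^ₛ 2 ⊗ ĉ u ^ₛ 2 ⊗ ĉ v ⊗ tt ⊗ ĉ z ⊗ (ĉ 1# ⊖ ĉ v) ⊗ F.B k ⊗ F.P k
    denominator1 k = F.E k ⊗ F.F (suc k) ⊗ F.H k
    denominator2 k = F.E k ⊗ F.F (suc k) ⊗ F.F k
    coefficient1 k = divBy 1 (w * w * w) (numerator1 k) (denominator1 k)
    coefficient2 k = divBy 2 (w * w * w) (numerator2 k) (denominator2 k)

    m₁ m₂ c₁ c₂ : ℕ → PS
    m₁ k = x̂ S.* P (ys k) S.* br (ys k)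
    m₂ k = û S.* (S.1# S.- v̂) S.* P (ys k) S.* br (ys k)

    d₁ d₂ d₃ d₄ : ℕ → PS
    d₁ k = S.1# S.- q (ys k)
    d₂ k = S.1# S.- v̂ S.* q (ys (suc k))
    d₃ k = h (ys k)
    d₄ k = S.1# S.- v̂ S.* q (ys k)

    unit₁ : ∀ k → Unit (d₁ k S.* d₂ k S.* d₃ k)
    unit₁ k = unit-* (unit-* (unit-1-t* (û S.* ys k)) (unit-1-vq (ys (suc k)))) (unit-h (ys k))

    unit₂ : ∀ k → Unit (d₁ k S.* d₂ k S.* d₄ k)
    unit₂ k = unit-* (unit-* (unit-1-t* (û S.* ys k)) (unit-1-vq (ys (suc k)))) (unit-1-vq (ys k))

    c₁ k = m₁ k ÷ unit₁ k
    c₂ k = m₂ k ÷ unit₂ k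

    r²-eq : F.r ^ₛ 2 S.≈ S.1# S.* r S.* r
    r²-eq = S.*-cong (S.*-congˡ {ĉ 1#} r-eq) r-eq

    coefficient1-eq : ∀ k → coefficient1 k S.≈ T S.* c₁ k
    coefficient1-eq k = ÷-unique {coefficient1 k} {T} {m₁ k} (unit₁ k)
      (cancel₃ {coefficient1 k} {d₁ k} {d₂ k} {d₃ k} {T S.* m₁ k}
        (divBy-inverse 1 (w * w * w) {numerator1 k} {denominator1 k} {N′} {D′} numerator denominator
          (constant₃ (d₁ k) (d₂ k) (d₃ k) (1-q-₀ k) (1-vq-₀ (suc k)) (h-₀ k))))
      where
      N′ = σ S.* σ S.* σ S.* (T S.* m₁ k)
      D′ = σ S.* d₁ k S.* (σ S.* d₂ k) S.* (σ S.* d₃ k)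
      numerator : numerator1 k S.≈ tt S.* N′
      numerator = S.trans
        (S.*-cong (S.*-cong (S.*-congʳ {ẑ} (S.*-congʳ {x̂} (S.*-congʳ {v̂} (S.*-congˡ {ŷ} r²-eq)))) (B-eq k)) (P-eq k))
        (term1-numerator ŷ (ys k))
      denominator : denominator1 k S.≈ tt S.* D′
      denominator = S.trans (S.*-cong (S.*-cong (E-eq k) (F-eq (suc k))) (H-eq k))
        (term1-denominator (σ S.* d₁ k) (σ S.* d₂ k) (σ S.* d₃ k))

    coefficient2-eq : ∀ k → coefficient2 k S.≈ T S.* (û S.* c₂ k)
    coefficient2-eq k = ÷-unique′ {coefficient2 k} {T} {û} {m₂ k} (unit₂ k)
      (cancel₃ {coefficient2 k} {d₁ k} {d₂ k} {d₄ k} {T S.* (û S.* m₂ k)}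
        (divBy-inverse 2 (w * w * w) {numerator2 k} {denominator2 k} {N′} {D′} numerator denominator
          (constant₃ (d₁ k) (d₂ k) (d₄ k) (1-q-₀ k) (1-vq-₀ (suc k)) (1-vq-₀ k))))
      where
      N′ = σ S.* σ S.* σ S.* (T S.* (û S.* m₂ k))
      D′ = σ S.* d₁ k S.* (σ S.* d₂ k) S.* (σ S.* d₄ k)
      numerator : numerator2 k S.≈ tt S.* (tt S.* N′)
      numerator = S.trans
        (S.*-cong (S.*-cong (S.*-congʳ {ĉ 1# ⊖ v̂} (S.*-congʳ {ẑ} (S.*-congʳ {tt} (S.*-congʳ {v̂} (S.*-congʳ {û ^ₛ 2} (S.*-congˡ {ŷ} r²-eq))))))
          (B-eq k)) (P-eq k))
        (term2-numerator ŷ (ys k))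
      denominator : denominator2 k S.≈ tt S.* (tt S.* D′)
      denominator = S.trans (S.*-cong (S.*-cong (E-eq k) (F-eq (suc k))) (F-eq k))
        (term2-denominator (σ S.* d₁ k) (σ S.* d₂ k) (σ S.* d₄ k))

  private
    module Rz = PS.Family z
    module R° = PS.Family 0#

    a°-rec : ∀ m → PS.a° m S.≈ S.1# S.+ tt S.* (û S.* PS.Up 0# m)
    a°-rec m = S.trans (R°.a-rec m) (no-zeros x̂ (PS.a° m) (û S.* PS.Up 0# m))

    open Runs ẑ (PS.a z) PS.a° (PS.Up z) (PS.Up 0#) (PS.Θ z) (PS.E z) (PS.pw z)
      Rz.a-rec a°-rec Rz.Up-zero R°.Up-zero (PS.Θ-zero z) (PS.Θ-suc z) S.refl (PS.pw-suc z) (PS.E-eq z)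
      using (a-zero; a°-zero; J-eq; run-sum)

    B C J : ℕ → PS
    B k = geom (û S.* ys k) (λ l → PS.a z (suc l)) 0
    C k = geom (û S.* ys k) (λ l → PS.a° (suc l)) 0

    J k = geom (û S.* ys k) (PS.pw z) 0

    module CF (k : ℕ) = ClosedForms ẑ (ys k) (B k) (B (suc k)) (C k) (C (suc k))

    feB : ∀ k → CF.FE k ẑ (B k) (B (suc k))
    feB k = FunctionalEquation.functionalEquation ẑ (PS.X z) (PS.D z) PS.a° (PS.gap z) Rz.down-zero (PS.down-suc z)
      Rz.down a°-zero (ys k)

    feC : ∀ k → CF.FE k S.0# (C k) (C (suc k))
    feC k = FunctionalEquation.functionalEquation S.0# (PS.X 0#) (PS.D 0#) PS.a° (PS.gap 0#) R°.down-zero (PS.down-suc 0#)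
      R°.down a°-zero (ys k)

    s uL : ℕ → PS
    s k = CF.s k (PS.a z 0) (ys k) (B k) (C k) (J k)
    uL k = CF.uL k (ys k) (C k)

    s-step : ∀ k → s k S.≈ c₁ k S.+ c₂ k S.* uL k S.+ factor1 k S.* s (suc k)
    s-step k = CF.s-rec k (feC k) (PS.a z 0) (J k) (J (suc k)) (factor1 k) (c₁ k) (c₂ k)
      (feB k) a-zero (J-eq (ys k)) (J-eq (ys (suc k))) (factor1-eq k) (÷-eq (m₁ k) (unit₁ k)) (÷-eq (m₂ k) (unit₂ k))

    uL-step : ∀ k → uL k S.≈ factor2 k S.* (û S.* inner k S.+ uL (suc k))
    uL-step k = CF.uL-rec k (feC k) (factor2 k) (inner k) (factor2-eq k) (inner-eq k)

    Π : ℕ → PS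
    Π k = prodFrom 0 k factor1

    run-form : PS.run z y 0 S.≈ J 0 S.+ tt S.* s 0
    run-form = S.trans (geom-unique (û S.* ŷ) (PS.E z) (PS.run z y) (PS.run-rec z y) 0) (run-sum ŷ)

    G-form : G x y u z v S.≈ tt S.* (ŷ S.* ẑ S.* v̂ S.* PS.run z y 0)
    G-form .at zero    = sym (tt-zero (ŷ S.* ẑ S.* v̂ S.* PS.run z y 0))
    G-form .at (suc n) = trans (Enumeration.G-run R x y u z v n) (sym (trans (tt-suc (ŷ S.* ẑ S.* v̂ S.* PS.run z y 0) n)
      (trans (at (S.*-congʳ {PS.run z y 0} (S.trans (S.*-congʳ {v̂} (S.sym (PS.ĉ-* y z))) (S.sym (PS.ĉ-* (y * z) v)))) n)
        (ĉ-⊗ (y * z * v) (PS.run z y 0) n))))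

    term0-eq : term0 S.≈ tt S.* (ŷ S.* ẑ S.* v̂ S.* J 0)
    term0-eq = term0-form ŷ (J 0) term0 (J-eq ŷ)
      (divBy-inverse 0 1# {ĉ v ⊗ ĉ y ⊗ tt ⊗ ĉ z} {D′ = d₄ 0} S.refl (term0-denominator ŷ)
        (trans (*-identityˡ _) (1-vq-₀ 0)))

    G-split : G x y u z v S.≈ term0 S.+ T S.* s 0
    G-split = begin
      G x y u z v                                        ≈⟨ G-form ⟩
      tt S.* (ŷ S.* ẑ S.* v̂ S.* PS.run z y 0)            ≈⟨ S.*-congˡ {tt} (S.*-congˡ {ŷ S.* ẑ S.* v̂} run-form) ⟩
      tt S.* (ŷ S.* ẑ S.* v̂ S.* (J 0 S.+ tt S.* s 0))    ≈⟨ total-form ŷ (J 0) (s 0) ⟩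
      tt S.* (ŷ S.* ẑ S.* v̂ S.* J 0) S.+ T S.* s 0       ≈⟨ S.+-congʳ {T S.* s 0} term0-eq ⟨
      term0 S.+ T S.* s 0                                ∎

  sumFrom-cong : ∀ a len (f g : ℕ → PS) → (∀ k → a ≤ k → f k S.≈ g k) → sumFrom a len f S.≈ sumFrom a len g
  sumFrom-cong a zero      f g e = S.refl
  sumFrom-cong a (suc len) f g e =
    S.+-cong (e a ℕₚ.≤-refl) (sumFrom-cong (suc a) len f g λ k a<k → e k (ℕₚ.<⇒≤ a<k))

  sumFrom-+ : ∀ a len (f g : ℕ → PS) → sumFrom a len (λ k → f k S.+ g k) S.≈ sumFrom a len f S.+ sumFrom a len g
  sumFrom-+ a zero      f g = S.sym (S.+-identityˡ S.0#)
  sumFrom-+ a (suc len) f g = S.trans (S.+-congˡ {f a S.+ g a} (sumFrom-+ (suc a) len f g))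
    (+-interchange (f a) (g a) (sumFrom (suc a) len f) (sumFrom (suc a) len g))
    where open import Algebra.Properties.CommutativeSemigroup S.+-commutativeSemigroup renaming (interchange to +-interchange)

  sumFrom-*ˡ : ∀ a len b (f : ℕ → PS) → sumFrom a len (λ k → b S.* f k) S.≈ b S.* sumFrom a len f
  sumFrom-*ˡ a zero      b f = S.sym (S.zeroʳ b)
  sumFrom-*ˡ a (suc len) b f = S.trans (S.+-congˡ {b S.* f a} (sumFrom-*ˡ (suc a) len b f))
    (S.sym (S.distribˡ b (f a) (sumFrom (suc a) len f)))

  sumFrom-*ʳ : ∀ a len b (f : ℕ → PS) → sumFrom a len (λ k → f k S.* b) S.≈ sumFrom a len f S.* b
  sumFrom-*ʳ a zero      b f = S.sym (S.zeroˡ b)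
  sumFrom-*ʳ a (suc len) b f = S.trans (S.+-congˡ {f a S.* b} (sumFrom-*ʳ (suc a) len b f))
    (S.sym (S.distribʳ b (f a) (sumFrom (suc a) len f)))

  prodFrom-suc : ∀ a len (f : ℕ → PS) → prodFrom a (suc len) f S.≈ prodFrom a len f S.* f (a ℕ.+ len)
  prodFrom-suc a zero f = S.trans (S.*-comm (f a) S.1#)
    (S.*-congˡ {S.1#} (S.reflexive (≡.cong f (≡.sym (ℕₚ.+-identityʳ a)))))
  prodFrom-suc a (suc len) f = begin
    f a S.* prodFrom (suc a) (suc len) f
      ≈⟨ S.*-congˡ {f a} (prodFrom-suc (suc a) len f) ⟩
    f a S.* (prodFrom (suc a) len f S.* f (suc a ℕ.+ len))
      ≈⟨ S.*-assoc (f a) (prodFrom (suc a) len f) (f (suc a ℕ.+ len)) ⟨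
    prodFrom a (suc len) f S.* f (suc a ℕ.+ len)
      ≈⟨ S.*-congˡ {prodFrom a (suc len) f} (S.reflexive (≡.cong f (≡.sym (ℕₚ.+-suc a len)))) ⟩
    prodFrom a (suc len) f S.* f (a ℕ.+ suc len) ∎

  private
    innerTerm : ℕ → ℕ → PS
    innerTerm k m = inner m S.* prodFrom k (suc m ∸ k) factor2

    uL-sum : ∀ len k → uL k S.≈ û S.* sumFrom k len (innerTerm k) S.+ prodFrom k len factor2 S.* uL (k ℕ.+ len)
    uL-sum zero k = begin
      uL k                                       ≈⟨ S.*-identityˡ (uL k) ⟨
      S.1# S.* uL k                              ≈⟨ S.*-congˡ {S.1#} (S.reflexive (≡.cong uL (≡.sym (ℕₚ.+-identityʳ k)))) ⟩
      S.1# S.* uL (k ℕ.+ 0)                      ≈⟨ S.+-identityˡ (S.1# S.* uL (k ℕ.+ 0)) ⟨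
      S.0# S.+ S.1# S.* uL (k ℕ.+ 0)             ≈⟨ S.+-congʳ {S.1# S.* uL (k ℕ.+ 0)} (S.zeroʳ û) ⟨
      û S.* S.0# S.+ S.1# S.* uL (k ℕ.+ 0)       ∎
    uL-sum (suc len) k = begin
      uL k
        ≈⟨ inner-step (uL k) (uL (suc k)) (factor2 k) (inner k) Σ Π′ (uL (suc k ℕ.+ len)) (uL-step k) (uL-sum len (suc k)) ⟩
      û S.* (inner k S.* (factor2 k S.* S.1#) S.+ factor2 k S.* Σ) S.+ prodFrom k (suc len) factor2 S.* uL (suc k ℕ.+ len)
        ≈⟨ S.+-cong (S.*-congˡ {û} (S.+-cong (S.*-congˡ {inner k} first) later))
             (S.*-congˡ {prodFrom k (suc len) factor2} (S.reflexive (≡.cong uL (≡.sym (ℕₚ.+-suc k len))))) ⟩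
      û S.* sumFrom k (suc len) (innerTerm k) S.+ prodFrom k (suc len) factor2 S.* uL (k ℕ.+ suc len) ∎
      where
      Σ  = sumFrom (suc k) len (innerTerm (suc k))
      Π′ = prodFrom (suc k) len factor2
      first : factor2 k S.* S.1# S.≈ prodFrom k (suc k ∸ k) factor2
      first = S.reflexive (≡.cong (λ n → prodFrom k n factor2) (≡.sym (ℕₚ.m+n∸n≡m 1 k)))
      swap : ∀ m → factor2 k S.* innerTerm (suc k) m S.≈ inner m S.* (factor2 k S.* prodFrom (suc k) (m ∸ k) factor2)
      swap m = begin
        factor2 k S.* (inner m S.* p)   ≈⟨ S.*-assoc (factor2 k) (inner m) p ⟨
        (factor2 k S.* inner m) S.* p   ≈⟨ S.*-congʳ {p} (S.*-comm (factor2 k) (inner m)) ⟩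
        (inner m S.* factor2 k) S.* p   ≈⟨ S.*-assoc (inner m) (factor2 k) p ⟩
        inner m S.* (factor2 k S.* p)   ∎
        where p = prodFrom (suc k) (m ∸ k) factor2
      later : factor2 k S.* Σ S.≈ sumFrom (suc k) len (innerTerm k)
      later = S.trans (S.sym (sumFrom-*ˡ (suc k) len (factor2 k) (innerTerm (suc k))))
        (sumFrom-cong (suc k) len (λ m → factor2 k S.* innerTerm (suc k) m) (innerTerm k) λ m k<m → S.trans (swap m)
          (S.*-congˡ {inner m} (S.reflexive (≡.cong (λ n → prodFrom k n factor2) (≡.sym (ℕₚ.+-∸-assoc 1 (ℕₚ.<⇒≤ k<m)))))))

    outerTerm : ℕ → PS
    outerTerm k = Π k S.* (c₁ k S.+ c₂ k S.* uL k)

    s-sum : ∀ len a → Π a S.* s a S.≈ sumFrom a len outerTerm S.+ Π (a ℕ.+ len) S.* s (a ℕ.+ len)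
    s-sum zero a = S.trans (S.reflexive (≡.cong (λ k → Π k S.* s k) (≡.sym (ℕₚ.+-identityʳ a))))
      (S.sym (S.+-identityˡ (Π (a ℕ.+ 0) S.* s (a ℕ.+ 0))))
    s-sum (suc len) a = begin
      Π a S.* s a
        ≈⟨ outer-step (Π a) (c₁ a) (c₂ a) (factor1 a) (uL a) (s a) (s (suc a)) (s-step a) ⟩
      outerTerm a S.+ (Π a S.* factor1 a) S.* s (suc a)
        ≈⟨ S.+-congˡ {outerTerm a} (S.*-congʳ {s (suc a)} (prodFrom-suc 0 a factor1)) ⟨
      outerTerm a S.+ Π (suc a) S.* s (suc a)
        ≈⟨ S.+-congˡ {outerTerm a} (s-sum len (suc a)) ⟩
      outerTerm a S.+ (sumFrom (suc a) len outerTerm S.+ Π (suc a ℕ.+ len) S.* s (suc a ℕ.+ len))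
        ≈⟨ S.+-assoc (outerTerm a) (sumFrom (suc a) len outerTerm) (Π (suc a ℕ.+ len) S.* s (suc a ℕ.+ len)) ⟨
      sumFrom a (suc len) outerTerm S.+ Π (suc a ℕ.+ len) S.* s (suc a ℕ.+ len)
        ≈⟨ S.+-congˡ {sumFrom a (suc len) outerTerm} (S.reflexive (≡.cong (λ k → Π k S.* s k) (≡.sym (ℕₚ.+-suc a len)))) ⟩
      sumFrom a (suc len) outerTerm S.+ Π (a ℕ.+ suc len) S.* s (a ℕ.+ suc len) ∎

    -- `partial K` cuts the inner sums at K as well, whereas `uL` stands for the full inner sum;
    -- `rest` is the tail lost by this cut.
    innerSum rest : ℕ → ℕ → PS
    innerSum K k = sumFrom k (K ∸ k) (term2 k)
    rest K k = T S.* (Π k S.* (c₂ k S.* (prodFrom k (K ∸ k) factor2 S.* uL (k ℕ.+ (K ∸ k)))))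

    outerTerm-eq : ∀ K k → T S.* outerTerm k S.≈ (term1 k S.+ innerSum K k) S.+ rest K k
    outerTerm-eq K k = S.trans
      (collect T (Π k) (c₁ k) (c₂ k) (uL k) Σ (prodFrom k (K ∸ k) factor2) (uL (k ℕ.+ (K ∸ k))) (coefficient1 k) (coefficient2 k)
        (coefficient1-eq k) (coefficient2-eq k) (uL-sum (K ∸ k) k))
      (S.+-congʳ {rest K k} (S.+-congˡ {term1 k} (S.sym pulled)))
      where
      Σ = sumFrom k (K ∸ k) (innerTerm k)
      pulled : innerSum K k S.≈ coefficient2 k S.* Σ S.* Π k
      pulled = S.trans (sumFrom-*ʳ k (K ∸ k) (Π k) (λ m → coefficient2 k S.* innerTerm k m))
        (S.*-congʳ {Π k} (sumFrom-*ˡ k (K ∸ k) (coefficient2 k) (innerTerm k)))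

    remainder : ℕ → PS
    remainder K = sumFrom 0 K (rest K) S.+ T S.* (Π K S.* s K)

    G-remainder : ∀ K → G x y u z v S.≈ partial K S.+ remainder K
    G-remainder K = begin
      G x y u z v
        ≈⟨ G-split ⟩
      term0 S.+ T S.* s 0
        ≈⟨ S.+-congˡ {term0} (S.*-congˡ {T} (S.trans (S.sym (S.*-identityˡ (s 0))) (s-sum K 0))) ⟩
      term0 S.+ T S.* (sumFrom 0 K outerTerm S.+ Π K S.* s K)
        ≈⟨ S.+-congˡ {term0} (S.distribˡ T (sumFrom 0 K outerTerm) (Π K S.* s K)) ⟩
      term0 S.+ (T S.* sumFrom 0 K outerTerm S.+ T S.* (Π K S.* s K))
        ≈⟨ S.+-congˡ {term0} (S.+-congʳ {T S.* (Π K S.* s K)} expanded) ⟩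
      term0 S.+ (((S₁ S.+ S₂) S.+ S₃) S.+ T S.* (Π K S.* s K))
        ≈⟨ S.+-congˡ {term0} (S.+-assoc (S₁ S.+ S₂) S₃ (T S.* (Π K S.* s K))) ⟩
      term0 S.+ ((S₁ S.+ S₂) S.+ remainder K)
        ≈⟨ S.+-assoc term0 (S₁ S.+ S₂) (remainder K) ⟨
      (term0 S.+ (S₁ S.+ S₂)) S.+ remainder K
        ≈⟨ S.+-congʳ {remainder K} (S.+-assoc term0 S₁ S₂) ⟨
      partial K S.+ remainder K ∎
      where
      S₁ = sumFrom 0 K term1
      S₂ = sumFrom 0 K (innerSum K)
      S₃ = sumFrom 0 K (rest K)
      expanded : T S.* sumFrom 0 K outerTerm S.≈ (S₁ S.+ S₂) S.+ S₃
      expanded = begin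
        T S.* sumFrom 0 K outerTerm                              ≈⟨ sumFrom-*ˡ 0 K T outerTerm ⟨
        sumFrom 0 K (λ k → T S.* outerTerm k)
          ≈⟨ sumFrom-cong 0 K _ (λ k → (term1 k S.+ innerSum K k) S.+ rest K k) (λ k _ → outerTerm-eq K k) ⟩
        sumFrom 0 K (λ k → (term1 k S.+ innerSum K k) S.+ rest K k)
          ≈⟨ sumFrom-+ 0 K (λ k → term1 k S.+ innerSum K k) (rest K) ⟩
        sumFrom 0 K (λ k → term1 k S.+ innerSum K k) S.+ S₃
          ≈⟨ S.+-congʳ {S₃} (sumFrom-+ 0 K term1 (innerSum K)) ⟩
        (S₁ S.+ S₂) S.+ S₃                                       ∎

    quotient-₀ : ∀ f d m → d ₀≈ 1# → f S.* d S.≈ m → m ₀≈ 0# → f ₀≈ 0#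
    quotient-₀ f d m d₀ e m₀ = trans (sym (*-identityʳ (f 0)))
      (trans (*-congˡ (sym d₀)) (trans (sym (⊗-zero f d)) (trans (at e 0) m₀)))

    factor1-₀ : ∀ k → factor1 k ₀≈ 0#
    factor1-₀ k = quotient-₀ (factor1 k) (h (ys k)) _ (h-₀ k) (factor1-eq k)
      (⊗-₀0 (x̂ S.* tt) (ys k S.+ ẑ S.* P (ys k)) (⊗-0₀ x̂ tt refl))

    factor2-₀ : ∀ k → factor2 k ₀≈ 0#
    factor2-₀ k = quotient-₀ (factor2 k) (h (ys k) S.* N (ys k)) _
      (trans (⊗-zero (h (ys k)) (N (ys k))) (trans (*-cong (h-₀ k) (N-₀ k)) (*-identityˡ 1#))) (factor2-eq k)
      (⊗-₀0 (x̂ S.* tt S.* ys k) (S.1# S.- q (ys k)) (⊗-₀0 (x̂ S.* tt) (ys k) (⊗-0₀ x̂ tt refl)))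

    order-⊗ˡ : ∀ {K} f g → Order K f → Order K (f ⊗ g)
    order-⊗ˡ {K} f g o = order-cong {K} (⊗-comm g f) (order-⊗ʳ {K} {f} g o)

    -- k copies of `factor1` and K - k copies of `factor2`, each divisible by t, give the order K
    -- uniformly in k.
    order-rest : ∀ K k → k < K → Order K (rest K k)
    order-rest K k k<K = order-⊗ʳ {K} T (≡.subst (λ n → Order n (Π k S.* (c₂ k S.* tailₖ)))
      (ℕₚ.m+[n∸m]≡n (ℕₚ.<⇒≤ k<K))
      (order-⊗ {k} {K ∸ k} {Π k} (order-prodFrom k 0 factor1 factor1-₀)
        (order-⊗ʳ {K ∸ k} (c₂ k) (order-⊗ˡ {K ∸ k} (prodFrom k (K ∸ k) factor2) (uL (k ℕ.+ (K ∸ k)))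
          (order-prodFrom (K ∸ k) k factor2 factor2-₀)))))
      where tailₖ = prodFrom k (K ∸ k) factor2 S.* uL (k ℕ.+ (K ∸ k))

    order-remainder : ∀ K → Order K (remainder K)
    order-remainder K = order-+ {K} {sumFrom 0 K (rest K)}
      (order-sumFrom {K} K 0 (rest K) λ k _ k<K → order-rest K k k<K)
      (order-⊗ʳ {K} T (order-⊗ˡ {K} (Π K) (s K) (order-prodFrom K 0 factor1 factor1-₀)))

  partial-tends : Tends partial (G x y u z v)
  -- The remainder at K has order K, so coefficient n is settled from K = n + 1 on.
  partial-tends n = suc n , λ K n<K → sym (trans (at (G-remainder K) n)
    (trans (+-congˡ (order-remainder K n n<K)) (+-identityʳ (partial K n))))

theorem35 : ∀ {c ℓ} (R : CommutativeRing c ℓ) →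
    let open CommutativeRing R in
    let open Series R in
    ∀ (x y u z v w : Carrier) →
    w * (x + u + - (x * u)) ≈ 1# →
    Tends (RHS.partial x y u z v w) (G x y u z v)
theorem35 R x y u z v w = Expansion.partial-tends R x y u z v w
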